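{- Let $H$ be a finite abelian group with exponent $e$, and let $S_1\subseteq H$ satisfy $0\notin S_1$ and $\ell S_1=S_1$ for all $\ell\in\mathbb{Z}_e^*$. Let $G=\mathbb{Z}_2\times H$ and $$S=(\{1\}\times S_1)\cup(\{0\}\times S_1)\cup\{(1,0)\}.$$ Let $p$ be a prime dividing $d=|S_1|$, let $f$ be the characteristic function of $S_1$, and suppose $f$ is $p^r$-plateaued over $H$ with $r\ge1$. Put $r_0=\min(r,v_p(d))$ (so $r_0\geq1$). Then for every $(x,y)\in G$, the Cayley graph $\mathrm{Cay}(G,S)$ has fractional revival between $(x+1,y)$ and $(x,y)$ at time $t=\pi/p^{r_0}$; specifically $e^{\imath t\lambda_g}=e^{\imath\pi/p^{r_0}}$ for $g\in\{0\}\times H$ and $e^{\imath t\lambda_g}=e^{ -\imath\pi/p^{r_0}}$ for $g\in\{1\}\times H$, giving $(\cos(\pi/p^{r_0}),\ \imath\sin(\pi/p^{r_0}))$-fractional revival.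
   Context: $\mathbb{Z}_e^*=\{\ell:1\le\ell\le e-1,\gcd(\ell,e)=1\}$ and $\ell S_1=\{\ell s:s\in S_1\}$. $v_p(d)$ is the exponent of the highest power of $p$ dividing $d$. A class function over $H$ is $f:H\to\mathbb{Z}$ with $f(\ell x)=f(x)$ for all $x\in H$, $\ell\in\mathbb{Z}_e^*$. The Fourier transform is $\widehat{f}(\chi)=\sum_{x\in H}f(x)\overline{\chi(x)}$. A class function $f$ is $p^r$-plateaued over $H$ if there is an integer $k$ with $\widehat{f}(\chi)\equiv k\pmod{p^r}$ for every character $\chi$ of $H$, $r$ being the largest such exponent. $\mathrm{Cay}(G,S)$ has vertex set $G$, $u\sim v$ iff $u-v\in S$; $A$ its adjacency matrix, $H(t)=\exp(\imath tA)$; eigenvalues $\lambda_g=\sum_{s\in S}\chi_g(s)$. Fractional revival from $u$ to $v$ at time $t$ means $H(t)\mathbf{e}_u=\alpha\mathbf{e}_u+\beta\mathbf{e}_v$ for some $\alpha,\beta\in\mathbb{C}$ with $\beta\neq0$, $|\alpha|^2+|\beta|^2=1$. -}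

module Defs where

open import Algebra.Bundles using (AbelianGroup; RawSemiring)
import Algebra.Construct.DirectProduct as DirectProduct
import Algebra.Definitions.RawMonoid as RawMonoidDefinitions
import Algebra.Definitions.RawSemiring as RawSemiringDefinitions
open import Algebra.Morphism.Structures using (module MonoidMorphisms)
open import Data.Bool.Base using (if_then_else_; true; false)
open import Data.Fin.Base using (Fin; zero; suc)
import Data.Fin.Properties as Fin
open import Data.Integer.Base as ℤ using (ℤ; +_; +[1+_]; -[1+_])
import Data.Integer.Properties as ℤ
open import Data.Nat.Base as ℕ using (ℕ; zero; suc; _!)
import Data.Nat.Divisibility.Core as ℕ
open import Data.Nat.GCD using (gcd)
open import Data.Nat.Primality using (Prime; prime⇒nonZero)
import Data.Nat.Properties as ℕ
open import Data.Parity.Base as ℙ using (Parity; 0ℙ; 1ℙ)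
import Data.Parity.Properties as ℙ
open import Data.Product.Base using (∃; ∃-syntax; _×_; _,_; proj₁; proj₂)
import Data.Product.Function.NonDependent.Setoid as ×ₛ
open import Data.Product.Relation.Binary.Pointwise.NonDependent using (Pointwise-≡↔≡)
open import Data.Rational.Base as ℚ using (ℚ; 0ℚ; 1ℚ; ½; ∣_∣; Positive)
import Data.Rational.Properties as ℚ
open import Data.Rational.Solver using (module +-*-Solver)
import Data.Rational.Unnormalised.Base as ℚᵘ
import Data.Rational.Unnormalised.Properties as ℚᵘ
open import Data.Sum.Base using (_⊎_; inj₁; inj₂)
open import Function.Bundles using (Inverse)
import Function.Construct.Composition as Compose
open import Function.Properties.Inverse using (Inverse⇒Injection; ↔-sym)
open import Level using (Level; 0ℓ; _⊔_) renaming (suc to lsuc)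
open import Relation.Binary.Core using (Rel; _Preserves_⟶_)
open import Relation.Binary.Definitions using (_Respects_)
open import Relation.Binary.PropositionalEquality as ≡
  using (_≡_; refl; sym; trans; cong; cong₂; subst; subst₂)
open import Relation.Nullary using (¬_; Dec; does; _×-dec_; _⊎-dec_)
open import Relation.Nullary.Decidable using (via-injection)
open import Relation.Unary using (Pred; Decidable)

Eventually : (ℕ → Set) → Set
Eventually P = ∃[ N ] (∀ n → N ℕ.≤ n → P n)

ev-map : ∀ {P Q : ℕ → Set} → (∀ {n} → P n → Q n) → Eventually P → Eventually Q
ev-map f (N , p) = N , λ n N≤n → f (p n N≤n)

ev-zip : ∀ {P Q R : ℕ → Set} → (∀ {n} → P n → Q n → R n) →
         Eventually P → Eventually Q → Eventually R
ev-zip f (M , p) (N , q) = M ℕ.⊔ N , λ n le →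
  f (p n (ℕ.≤-trans (ℕ.m≤m⊔n M N) le)) (q n (ℕ.≤-trans (ℕ.m≤n⊔m M N) le))

ev-∃ : ∀ {P : ℕ → Set} → Eventually P → ∃ P
ev-∃ (N , p) = N , p N ℕ.≤-refl

infix 8 ½·_

opaque
  ½·_ : ℚ → ℚ
  ½· ε = ½ ℚ.* ε

  ½·-positive : ∀ ε .{{_ : Positive ε}} → Positive (½· ε)
  ½·-positive ε = ℚ.pos*pos⇒pos ½ ε

  ½·+½· : ∀ ε → ½· ε ℚ.+ ½· ε ≡ ε
  ½·+½· ε = trans (sym (ℚ.*-distribʳ-+ ε ½ ½)) (ℚ.*-identityˡ ε)

opaque
  triangle : ∀ {a b} x y z → ∣ x ℚ.- y ∣ ℚ.≤ a → ∣ y ℚ.- z ∣ ℚ.≤ b → ∣ x ℚ.- z ∣ ℚ.≤ a ℚ.+ b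
  triangle {a} {b} x y z p q = begin
    ∣ x ℚ.- z ∣                        ≡⟨ cong ∣_∣ (solve 3 (λ x y z → x :- z := (x :- y) :+ (y :- z)) refl x y z) ⟩
    ∣ (x ℚ.- y) ℚ.+ (y ℚ.- z) ∣        ≤⟨ ℚ.∣p+q∣≤∣p∣+∣q∣ (x ℚ.- y) (y ℚ.- z) ⟩
    ∣ x ℚ.- y ∣ ℚ.+ ∣ y ℚ.- z ∣        ≤⟨ ℚ.+-mono-≤ p q ⟩
    a ℚ.+ b                            ∎
    where open ℚ.≤-Reasoning; open +-*-Solver

opaque
  dist-sym : ∀ x y → ∣ x ℚ.- y ∣ ≡ ∣ y ℚ.- x ∣
  dist-sym x y = trans (cong ∣_∣ (solve 2 (λ x y → x :- y := :- (y :- x)) refl x y)) (ℚ.∣-p∣≡∣p∣ (y ℚ.- x))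
    where open +-*-Solver

opaque
  dist-+ : ∀ {a b} x x′ y y′ → ∣ x ℚ.- x′ ∣ ℚ.≤ a → ∣ y ℚ.- y′ ∣ ℚ.≤ b →
           ∣ (x ℚ.+ y) ℚ.- (x′ ℚ.+ y′) ∣ ℚ.≤ a ℚ.+ b
  dist-+ {a} {b} x x′ y y′ p q = begin
    ∣ (x ℚ.+ y) ℚ.- (x′ ℚ.+ y′) ∣      ≡⟨ cong ∣_∣ (solve 4 (λ x x′ y y′ → (x :+ y) :- (x′ :+ y′) := (x :- x′) :+ (y :- y′)) refl x x′ y y′) ⟩
    ∣ (x ℚ.- x′) ℚ.+ (y ℚ.- y′) ∣      ≤⟨ ℚ.∣p+q∣≤∣p∣+∣q∣ (x ℚ.- x′) (y ℚ.- y′) ⟩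
    ∣ x ℚ.- x′ ∣ ℚ.+ ∣ y ℚ.- y′ ∣      ≤⟨ ℚ.+-mono-≤ p q ⟩
    a ℚ.+ b                            ∎
    where open ℚ.≤-Reasoning; open +-*-Solver

opaque
  dist-neg : ∀ x y → ∣ (ℚ.- x) ℚ.- (ℚ.- y) ∣ ≡ ∣ x ℚ.- y ∣
  dist-neg x y = trans (cong ∣_∣ (solve 2 (λ x y → (:- x) :- (:- y) := :- (x :- y)) refl x y)) (ℚ.∣-p∣≡∣p∣ (x ℚ.- y))
    where open +-*-Solver

opaque
  abs-*-mono : ∀ {a b} x y → ∣ x ∣ ℚ.≤ a → ∣ y ∣ ℚ.≤ b → ∣ x ℚ.* y ∣ ℚ.≤ a ℚ.* b
  abs-*-mono {a} {b} x y p q = begin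
    ∣ x ℚ.* y ∣          ≡⟨ ℚ.∣p*q∣≡∣p∣*∣q∣ x y ⟩
    ∣ x ∣ ℚ.* ∣ y ∣      ≤⟨ ℚ.*-monoˡ-≤-nonNeg ∣ x ∣ {{ℚ.∣-∣-nonNeg x}} q ⟩
    ∣ x ∣ ℚ.* b          ≤⟨ ℚ.*-monoʳ-≤-nonNeg b {{ℚ.nonNegative (ℚ.≤-trans (ℚ.0≤∣p∣ y) q)}} p ⟩
    a ℚ.* b              ∎
    where open ℚ.≤-Reasoning

opaque
  dist-* : ∀ {a b c d} x x′ y y′ → ∣ x ℚ.- x′ ∣ ℚ.≤ a → ∣ y ∣ ℚ.≤ b → ∣ x′ ∣ ℚ.≤ c → ∣ y ℚ.- y′ ∣ ℚ.≤ d →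
           ∣ (x ℚ.* y) ℚ.- (x′ ℚ.* y′) ∣ ℚ.≤ a ℚ.* b ℚ.+ c ℚ.* d
  dist-* {a} {b} {c} {d} x x′ y y′ p q r s = begin
    ∣ (x ℚ.* y) ℚ.- (x′ ℚ.* y′) ∣                      ≡⟨ cong ∣_∣ (solve 4 (λ x x′ y y′ → (x :* y) :- (x′ :* y′) := (x :- x′) :* y :+ x′ :* (y :- y′)) refl x x′ y y′) ⟩
    ∣ (x ℚ.- x′) ℚ.* y ℚ.+ x′ ℚ.* (y ℚ.- y′) ∣         ≤⟨ ℚ.∣p+q∣≤∣p∣+∣q∣ ((x ℚ.- x′) ℚ.* y) (x′ ℚ.* (y ℚ.- y′)) ⟩
    ∣ (x ℚ.- x′) ℚ.* y ∣ ℚ.+ ∣ x′ ℚ.* (y ℚ.- y′) ∣     ≤⟨ ℚ.+-mono-≤ (abs-*-mono (x ℚ.- x′) y p q) (abs-*-mono x′ (y ℚ.- y′) r s) ⟩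
    a ℚ.* b ℚ.+ c ℚ.* d                                ∎
    where open ℚ.≤-Reasoning; open +-*-Solver

opaque
  ι : ℕ → ℚ
  ι n = + n ℚ./ 1

  /1≡fromℚᵘ : ∀ i → i ℚ./ 1 ≡ ℚ.fromℚᵘ (ℚᵘ.mkℚᵘ i 0)
  /1≡fromℚᵘ (+ n)      = refl
  /1≡fromℚᵘ -[1+ n ]   = refl

  toℚᵘ-/1 : ∀ i → ℚ.toℚᵘ (i ℚ./ 1) ℚᵘ.≃ ℚᵘ.mkℚᵘ i 0
  toℚᵘ-/1 i = subst (λ q → ℚ.toℚᵘ q ℚᵘ.≃ ℚᵘ.mkℚᵘ i 0) (sym (/1≡fromℚᵘ i)) (ℚ.toℚᵘ-fromℚᵘ (ℚᵘ.mkℚᵘ i 0))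

  ι-+ : ∀ m n → ι m ℚ.+ ι n ≡ ι (m ℕ.+ n)
  ι-+ m n = ℚ.toℚᵘ-injective (begin
    ℚ.toℚᵘ (ι m ℚ.+ ι n)                   ≈⟨ ℚ.toℚᵘ-homo-+ (ι m) (ι n) ⟩
    ℚ.toℚᵘ (ι m) ℚᵘ.+ ℚ.toℚᵘ (ι n)         ≈⟨ ℚᵘ.+-cong (toℚᵘ-/1 (+ m)) (toℚᵘ-/1 (+ n)) ⟩
    ℚᵘ.mkℚᵘ (+ m) 0 ℚᵘ.+ ℚᵘ.mkℚᵘ (+ n) 0   ≈⟨ ℚᵘ.*≡* (cong (ℤ._* + 1) (cong₂ ℤ._+_ (ℤ.*-identityʳ (+ m)) (ℤ.*-identityʳ (+ n)))) ⟩
    ℚᵘ.mkℚᵘ (+ (m ℕ.+ n)) 0                ≈⟨ toℚᵘ-/1 (+ (m ℕ.+ n)) ⟨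
    ℚ.toℚᵘ (ι (m ℕ.+ n))                   ∎)
    where open import Relation.Binary.Reasoning.Setoid ℚᵘ.≃-setoid

  ι-* : ∀ m n → ι m ℚ.* ι n ≡ ι (m ℕ.* n)
  ι-* m n = ℚ.toℚᵘ-injective (begin
    ℚ.toℚᵘ (ι m ℚ.* ι n)                   ≈⟨ ℚ.toℚᵘ-homo-* (ι m) (ι n) ⟩
    ℚ.toℚᵘ (ι m) ℚᵘ.* ℚ.toℚᵘ (ι n)         ≈⟨ ℚᵘ.*-cong (toℚᵘ-/1 (+ m)) (toℚᵘ-/1 (+ n)) ⟩
    ℚᵘ.mkℚᵘ (+ m) 0 ℚᵘ.* ℚᵘ.mkℚᵘ (+ n) 0   ≈⟨ ℚᵘ.*≡* (cong (ℤ._* + 1) (sym (ℤ.pos-* m n))) ⟩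
    ℚᵘ.mkℚᵘ (+ (m ℕ.* n)) 0                ≈⟨ toℚᵘ-/1 (+ (m ℕ.* n)) ⟨
    ℚ.toℚᵘ (ι (m ℕ.* n))                   ∎)
    where open import Relation.Binary.Reasoning.Setoid ℚᵘ.≃-setoid

  ι-mono : ∀ {m n} → m ℕ.≤ n → ι m ℚ.≤ ι n
  ι-mono {m} {n} m≤n = ℚ.toℚᵘ-cancel-≤ (begin
    ℚ.toℚᵘ (ι m)      ≃⟨ toℚᵘ-/1 (+ m) ⟩
    ℚᵘ.mkℚᵘ (+ m) 0   ≤⟨ ℚᵘ.*≤* (ℤ.*-monoʳ-≤-nonNeg (+ 1) (ℤ.+≤+ m≤n)) ⟩
    ℚᵘ.mkℚᵘ (+ n) 0   ≃⟨ toℚᵘ-/1 (+ n) ⟨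
    ℚ.toℚᵘ (ι n)      ∎)
    where open ℚᵘ.≤-Reasoning

  ι1≡1 : ι 1 ≡ 1ℚ
  ι1≡1 = refl

  0≤ι : ∀ n → 0ℚ ℚ.≤ ι n
  0≤ι n = ι-mono {0} {n} ℕ.z≤n

  ⌈_⌉ : ℚ → ℕ
  ⌈ q ⌉ = ℤ.∣ ℚ.↥ q ∣

  ≤⌈⌉ : ∀ q → q ℚ.≤ ι ⌈ q ⌉
  ≤⌈⌉ q@(ℚ.mkℚ _ _ _) = ℚ.toℚᵘ-cancel-≤ (begin
    ℚ.toℚᵘ q                  ≤⟨ ℚᵘ.*≤* (step (ℚ.↥ q) (ℚ.ℚ.denominator-1 q)) ⟩
    ℚᵘ.mkℚᵘ (+ ⌈ q ⌉) 0       ≃⟨ toℚᵘ-/1 (+ ⌈ q ⌉) ⟨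
    ℚ.toℚᵘ (ι ⌈ q ⌉)          ∎)
    where
    open ℚᵘ.≤-Reasoning
    step : ∀ i d → i ℤ.* + 1 ℤ.≤ + ℤ.∣ i ∣ ℤ.* + suc d
    step (+ n) d = subst₂ ℤ._≤_ (ℤ.pos-* n 1) (ℤ.pos-* n (suc d)) (ℤ.+≤+ (ℕ.*-monoʳ-≤ n (ℕ.s≤s ℕ.z≤n)))
    step -[1+ n ] d = ℤ.-≤+

  archimedean : ∀ ε .{{_ : Positive ε}} n → ι n ℚ.≤ ε ℚ.* ι (n ℕ.* ℚ.↧ₙ ε)
  archimedean ε@(ℚ.mkℚ +[1+ a ] d _) n = ℚ.toℚᵘ-cancel-≤ (begin
    ℚ.toℚᵘ (ι n)                                       ≃⟨ toℚᵘ-/1 (+ n) ⟩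
    ℚᵘ.mkℚᵘ (+ n) 0                                    ≤⟨ ℚᵘ.*≤* step ⟩
    ℚᵘ.mkℚᵘ +[1+ a ] d ℚᵘ.* ℚᵘ.mkℚᵘ (+ (n ℕ.* suc d)) 0  ≃⟨ ℚᵘ.*-cong (ℚᵘ.≃-refl {ℚ.toℚᵘ ε}) (toℚᵘ-/1 (+ (n ℕ.* suc d))) ⟨
    ℚ.toℚᵘ ε ℚᵘ.* ℚ.toℚᵘ (ι (n ℕ.* suc d))             ≃⟨ ℚ.toℚᵘ-homo-* ε (ι (n ℕ.* suc d)) ⟨
    ℚ.toℚᵘ (ε ℚ.* ι (n ℕ.* suc d))                     ∎)
    where
    open ℚᵘ.≤-Reasoning
    step : + n ℤ.* + (suc d ℕ.* 1) ℤ.≤ (+[1+ a ] ℤ.* + (n ℕ.* suc d)) ℤ.* + 1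
    step = subst₂ ℤ._≤_ (ℤ.pos-* n (suc d ℕ.* 1))
      (trans (ℤ.pos-* (suc a) (n ℕ.* suc d)) (sym (ℤ.*-identityʳ _)))
      (ℤ.+≤+ (ℕ.≤-trans (ℕ.≤-reflexive (cong (n ℕ.*_) (ℕ.*-identityʳ (suc d)))) (ℕ.m≤m+n _ _)))

½^ : ℕ → ℚ
½^ zero    = 1ℚ
½^ (suc n) = ½· ½^ n

opaque
  ½^-positive : ∀ n → Positive (½^ n)
  ½^-positive zero    = _
  ½^-positive (suc n) = ½·-positive (½^ n) {{½^-positive n}}

0≤½^ : ∀ n → 0ℚ ℚ.≤ ½^ n
0≤½^ n = ℚ.<⇒≤ (ℚ.positive⁻¹ (½^ n) {{½^-positive n}})

opaque
  2^*½^ : ∀ n → ι (2 ℕ.^ n) ℚ.* ½^ n ≡ 1ℚ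
  2^*½^ zero    = trans (ℚ.*-identityʳ (ι 1)) ι1≡1
  2^*½^ (suc n) = begin
    ι (2 ℕ.* 2 ℕ.^ n) ℚ.* ½· ½^ n                         ≡⟨ cong (ℚ._* ½· ½^ n) (cong (λ k → ι (2 ℕ.^ n ℕ.+ k)) (ℕ.+-identityʳ (2 ℕ.^ n))) ⟩
    ι (2 ℕ.^ n ℕ.+ 2 ℕ.^ n) ℚ.* ½· ½^ n                   ≡⟨ cong (ℚ._* ½· ½^ n) (ι-+ (2 ℕ.^ n) (2 ℕ.^ n)) ⟨
    (ι (2 ℕ.^ n) ℚ.+ ι (2 ℕ.^ n)) ℚ.* ½· ½^ n             ≡⟨ ℚ.*-distribʳ-+ (½· ½^ n) (ι (2 ℕ.^ n)) (ι (2 ℕ.^ n)) ⟩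
    ι (2 ℕ.^ n) ℚ.* ½· ½^ n ℚ.+ ι (2 ℕ.^ n) ℚ.* ½· ½^ n   ≡⟨ ℚ.*-distribˡ-+ (ι (2 ℕ.^ n)) (½· ½^ n) (½· ½^ n) ⟨
    ι (2 ℕ.^ n) ℚ.* (½· ½^ n ℚ.+ ½· ½^ n)                 ≡⟨ cong (ι (2 ℕ.^ n) ℚ.*_) (½·+½· (½^ n)) ⟩
    ι (2 ℕ.^ n) ℚ.* ½^ n                                  ≡⟨ 2^*½^ n ⟩
    1ℚ                                                    ∎
    where open ≡.≡-Reasoning

n≤2^n : ∀ n → n ℕ.≤ 2 ℕ.^ n
n≤2^n zero    = ℕ.z≤n
n≤2^n (suc n) = ℕ.+-mono-≤ (ℕ.>-nonZero⁻¹ (2 ℕ.^ n) {{ℕ.m^n≢0 2 n}})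
                  (ℕ.≤-trans (n≤2^n n) (ℕ.≤-reflexive (sym (ℕ.+-identityʳ (2 ℕ.^ n)))))

opaque
  *½^-mono : ∀ {p q} N → p ℚ.≤ q → p ℚ.* ½^ N ℚ.≤ q ℚ.* ½^ N
  *½^-mono N = ℚ.*-monoʳ-≤-nonNeg (½^ N) {{ℚ.pos⇒nonNeg (½^ N) {{½^-positive N}}}}

  *½^-≤ : ∀ c ε .{{_ : Positive ε}} N → ι c ℚ.≤ ε ℚ.* ι N → ι c ℚ.* ½^ N ℚ.≤ ε
  *½^-≤ c ε N c≤ = begin
    ι c ℚ.* ½^ N                  ≤⟨ *½^-mono N c≤ ⟩
    ε ℚ.* ι N ℚ.* ½^ N            ≡⟨ ℚ.*-assoc ε (ι N) (½^ N) ⟩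
    ε ℚ.* (ι N ℚ.* ½^ N)          ≤⟨ ℚ.*-monoˡ-≤-nonNeg ε {{ℚ.pos⇒nonNeg ε}} (*½^-mono N (ι-mono (n≤2^n N))) ⟩
    ε ℚ.* (ι (2 ℕ.^ N) ℚ.* ½^ N)  ≡⟨ cong (ε ℚ.*_) (2^*½^ N) ⟩
    ε ℚ.* 1ℚ                      ≡⟨ ℚ.*-identityʳ ε ⟩
    ε                             ∎
    where open ℚ.≤-Reasoning

  ½^-small : ∀ c ε .{{_ : Positive ε}} → ∃[ N ] (ι c ℚ.* ½^ N ℚ.≤ ε)
  ½^-small c ε = c ℕ.* ℚ.↧ₙ ε , *½^-≤ c ε (c ℕ.* ℚ.↧ₙ ε) (archimedean ε c)

opaque
  ½^-antimono : ∀ {m n} → m ℕ.≤ n → ½^ n ℚ.≤ ½^ m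
  ½^-antimono {n = zero} ℕ.z≤n = ℚ.≤-refl
  ½^-antimono {m} {suc n} m≤n with ℕ.m≤n⇒m<n∨m≡n m≤n
  ... | inj₂ refl = ℚ.≤-refl
  ... | inj₁ (ℕ.s≤s m≤n′) = ℚ.≤-trans (begin
    ½· ½^ n              ≡⟨ ℚ.+-identityʳ (½· ½^ n) ⟨
    ½· ½^ n ℚ.+ 0ℚ       ≤⟨ ℚ.+-monoʳ-≤ (½· ½^ n) (0≤½^ (suc n)) ⟩
    ½· ½^ n ℚ.+ ½· ½^ n  ≡⟨ ½·+½· (½^ n) ⟩
    ½^ n                 ∎) (½^-antimono m≤n′)
    where open ℚ.≤-Reasoning

IsCauchy : (ℕ → ℚ) → Set
IsCauchy x = ∀ ε .{{_ : Positive ε}} → ∃[ N ] (∀ m n → N ℕ.≤ m → N ℕ.≤ n → ∣ x m ℚ.- x n ∣ ℚ.≤ ε)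

-- The real numbers, with the equality _≃_ below.  The operations on ℝ and ℂ are opaque so that
-- type checking never unfolds them into rational arithmetic.
record ℝ : Set where
  no-eta-equality
  constructor mkℝ
  field
    approx : ℕ → ℚ
    cauchy : IsCauchy approx
open ℝ

Close : ℚ → ℝ → ℝ → Set
Close ε x y = Eventually (λ i → ∣ approx x i ℚ.- approx y i ∣ ℚ.≤ ε)

infix 4 _≃_ _<_

_≃_ : Rel ℝ 0ℓ
x ≃ y = ∀ ε .{{_ : Positive ε}} → Close ε x y

_<_ : Rel ℝ 0ℓ
x < y = ∃[ ε ] (Positive ε × Eventually (λ i → approx x i ℚ.+ ε ℚ.≤ approx y i))

Bounded : ℝ → ℕ → Set
Bounded x b = Eventually (λ i → ∣ approx x i ∣ ℚ.≤ ι b)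

opaque
  bounded : ∀ x → ∃ (Bounded x)
  bounded x = let N , close = cauchy x 1ℚ in ⌈ ∣ approx x N ∣ ℚ.+ 1ℚ ⌉ , N , λ n N≤n → ℚ.≤-trans (begin
    ∣ approx x n ∣                                        ≡⟨ cong ∣_∣ (solve 2 (λ p q → p := q :+ (p :- q)) refl (approx x n) (approx x N)) ⟩
    ∣ approx x N ℚ.+ (approx x n ℚ.- approx x N) ∣        ≤⟨ ℚ.∣p+q∣≤∣p∣+∣q∣ (approx x N) (approx x n ℚ.- approx x N) ⟩
    ∣ approx x N ∣ ℚ.+ ∣ approx x n ℚ.- approx x N ∣      ≤⟨ ℚ.+-monoʳ-≤ ∣ approx x N ∣ (close n N N≤n ℕ.≤-refl) ⟩
    ∣ approx x N ∣ ℚ.+ 1ℚ                                 ∎) (≤⌈⌉ (∣ approx x N ∣ ℚ.+ 1ℚ))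
    where
    open ℚ.≤-Reasoning; open +-*-Solver

infixl 6 _+ʳ_
infixl 7 _*ʳ_
infix  8 -ʳ_

⊔ˡ : ∀ {n} M N → M ℕ.⊔ N ℕ.≤ n → M ℕ.≤ n
⊔ˡ M N = ℕ.≤-trans (ℕ.m≤m⊔n M N)

⊔ʳ : ∀ {n} M N → M ℕ.⊔ N ℕ.≤ n → N ℕ.≤ n
⊔ʳ M N = ℕ.≤-trans (ℕ.m≤n⊔m M N)

opaque
  +-cauchy : ∀ x y → IsCauchy (λ n → approx x n ℚ.+ approx y n)
  +-cauchy x y ε
    with M , p ← cauchy x (½· ε) {{½·-positive ε}}
       | N , q ← cauchy y (½· ε) {{½·-positive ε}} = M ℕ.⊔ N , λ m n m≥ n≥ → begin
    ∣ (approx x m ℚ.+ approx y m) ℚ.- (approx x n ℚ.+ approx y n) ∣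
      ≤⟨ dist-+ (approx x m) (approx x n) (approx y m) (approx y n)
           (p m n (⊔ˡ M N m≥) (⊔ˡ M N n≥)) (q m n (⊔ʳ M N m≥) (⊔ʳ M N n≥)) ⟩
    ½· ε ℚ.+ ½· ε  ≡⟨ ½·+½· ε ⟩
    ε              ∎
    where open ℚ.≤-Reasoning

opaque
  const-cauchy : ∀ q → IsCauchy (λ _ → q)
  const-cauchy q ε = 0 , λ _ _ _ _ → begin
    ∣ q ℚ.- q ∣  ≡⟨ cong ∣_∣ (ℚ.+-inverseʳ q) ⟩
    0ℚ           ≤⟨ ℚ.<⇒≤ (ℚ.positive⁻¹ ε) ⟩
    ε            ∎
    where open ℚ.≤-Reasoning

opaque
  neg-cauchy : ∀ x → IsCauchy (λ n → ℚ.- approx x n)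
  neg-cauchy x ε with N , p ← cauchy x ε = N , λ m n m≥ n≥ →
    ℚ.≤-trans (ℚ.≤-reflexive (dist-neg (approx x m) (approx x n))) (p m n m≥ n≥)

opaque
  scaled : ∀ ε .{{_ : Positive ε}} b → ∃[ δ ] (Positive δ × δ ℚ.* ι b ℚ.≤ ½· ε)
  scaled ε b = helper (½^-small b (½· ε) {{½·-positive ε}})
    where
    helper : ∃[ N ] (ι b ℚ.* ½^ N ℚ.≤ ½· ε) → ∃[ δ ] (Positive δ × δ ℚ.* ι b ℚ.≤ ½· ε)
    helper (N , le) = ½^ N , ½^-positive N , subst (λ q → q ℚ.≤ ½· ε) (ℚ.*-comm (ι b) (½^ N)) le

opaque
  halves : ∀ ε a b c d → a ℚ.* b ℚ.≤ ½· ε → d ℚ.* c ℚ.≤ ½· ε → a ℚ.* b ℚ.+ c ℚ.* d ℚ.≤ ε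
  halves ε a b c d p q = subst₂ (λ u v → a ℚ.* b ℚ.+ u ℚ.≤ v) (ℚ.*-comm d c) (½·+½· ε)
    (ℚ.+-mono-≤ {a ℚ.* b} {½· ε} {d ℚ.* c} {½· ε} p q)

  *-cauchy : ∀ x y → IsCauchy (λ n → approx x n ℚ.* approx y n)
  *-cauchy x y ε = helper (bounded x) (bounded y)
    where
    helper : ∃ (Bounded x) → ∃ (Bounded y) → ∃[ N ] (∀ m n → N ℕ.≤ m → N ℕ.≤ n →
             ∣ approx x m ℚ.* approx y m ℚ.- approx x n ℚ.* approx y n ∣ ℚ.≤ ε)
    helper (b , B , x≤b) (c , C , y≤c) = K , close
      where
      δ η : ℚ
      M N K : ℕ
      δ = proj₁ (scaled ε c)
      η = proj₁ (scaled ε b)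
      M = proj₁ (cauchy x δ {{proj₁ (proj₂ (scaled ε c))}})
      N = proj₁ (cauchy y η {{proj₁ (proj₂ (scaled ε b))}})
      K = (B ℕ.⊔ C) ℕ.⊔ (M ℕ.⊔ N)
      close : ∀ m n → K ℕ.≤ m → K ℕ.≤ n →
              ∣ approx x m ℚ.* approx y m ℚ.- approx x n ℚ.* approx y n ∣ ℚ.≤ ε
      close m n m≥ n≥ = ℚ.≤-trans
        {∣ approx x m ℚ.* approx y m ℚ.- approx x n ℚ.* approx y n ∣} {δ ℚ.* ι c ℚ.+ ι b ℚ.* η} {ε}
        (dist-* {δ} {ι c} {ι b} {η} (approx x m) (approx x n) (approx y m) (approx y n)
               (proj₂ (cauchy x δ {{proj₁ (proj₂ (scaled ε c))}}) m n
                 (⊔ˡ M N (⊔ʳ (B ℕ.⊔ C) _ m≥)) (⊔ˡ M N (⊔ʳ (B ℕ.⊔ C) _ n≥)))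
               (y≤c m (⊔ʳ B C (⊔ˡ _ (M ℕ.⊔ N) m≥)))
               (x≤b n (⊔ˡ B C (⊔ˡ _ (M ℕ.⊔ N) n≥)))
               (proj₂ (cauchy y η {{proj₁ (proj₂ (scaled ε b))}}) m n
                 (⊔ʳ M N (⊔ʳ (B ℕ.⊔ C) _ m≥)) (⊔ʳ M N (⊔ʳ (B ℕ.⊔ C) _ n≥))))
        (halves ε δ (ι c) (ι b) η (proj₂ (proj₂ (scaled ε c))) (proj₂ (proj₂ (scaled ε b))))

opaque
  fromℚ : ℚ → ℝ
  fromℚ q = mkℝ (λ _ → q) (const-cauchy q)

  _+ʳ_ : ℝ → ℝ → ℝ
  x +ʳ y = mkℝ (λ n → approx x n ℚ.+ approx y n) (+-cauchy x y)

  -ʳ_ : ℝ → ℝ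
  -ʳ x = mkℝ (λ n → ℚ.- approx x n) (neg-cauchy x)

  _*ʳ_ : ℝ → ℝ → ℝ
  x *ʳ y = mkℝ (λ n → approx x n ℚ.* approx y n) (*-cauchy x y)

0ʳ 1ʳ : ℝ
0ʳ = fromℚ 0ℚ
1ʳ = fromℚ 1ℚ

infix 4 _⟶_

_⟶_ : (ℕ → ℝ) → ℝ → Set
s ⟶ x = ∀ ε .{{_ : Positive ε}} → ∃[ N ] (∀ n → N ℕ.≤ n → Close ε (s n) x)

IsCauchyʳ : (ℕ → ℝ) → Set
IsCauchyʳ s = ∀ ε .{{_ : Positive ε}} → ∃[ N ] (∀ m n → N ℕ.≤ m → N ℕ.≤ n → Close ε (s m) (s n))

-- The n-th rational approximation of the limit is a rational within ½^ n of s n.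
diagonalIndex : (ℕ → ℝ) → ℕ → ℕ
diagonalIndex s n = proj₁ (cauchy (s n) (½^ n) {{½^-positive n}})

diagonal : (ℕ → ℝ) → ℕ → ℚ
diagonal s n = approx (s n) (diagonalIndex s n)

opaque
  diagonal-close : ∀ s n → Eventually (λ i → ∣ diagonal s n ℚ.- approx (s n) i ∣ ℚ.≤ ½^ n)
  diagonal-close s n = diagonalIndex s n , λ i i≥ →
    proj₂ (cauchy (s n) (½^ n) {{½^-positive n}}) (diagonalIndex s n) i ℕ.≤-refl i≥

opaque
  thirds : ∀ ε → ½· ½· ε ℚ.+ ½· ε ℚ.+ ½· ½· ε ≡ ε
  thirds ε = trans (solve 2 (λ a b → a :+ b :+ a := (a :+ a) :+ b) refl (½· ½· ε) (½· ε))
                   (trans (cong (ℚ._+ ½· ε) (½·+½· (½· ε))) (½·+½· ε))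
    where open +-*-Solver

opaque
  ½^-small′ : ∀ ε .{{_ : Positive ε}} → ∃[ N ] (∀ n → N ℕ.≤ n → ½^ n ℚ.≤ ε)
  ½^-small′ ε with N , le ← ½^-small 1 ε = N , λ n N≤n →
    ℚ.≤-trans (½^-antimono N≤n) (subst (ℚ._≤ ε) (trans (cong (ℚ._* ½^ N) ι1≡1) (ℚ.*-identityˡ (½^ N))) le)

opaque
  two-thirds : ∀ ε .{{_ : Positive ε}} → ½· ½· ε ℚ.+ ½· ε ℚ.≤ ε
  two-thirds ε = begin
    ½· ½· ε ℚ.+ ½· ε              ≡⟨ ℚ.+-identityʳ (½· ½· ε ℚ.+ ½· ε) ⟨
    ½· ½· ε ℚ.+ ½· ε ℚ.+ 0ℚ       ≤⟨ ℚ.+-monoʳ-≤ (½· ½· ε ℚ.+ ½· ε) (ℚ.<⇒≤ (ℚ.positive⁻¹ (½· ½· ε) {{quarter}})) ⟩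
    ½· ½· ε ℚ.+ ½· ε ℚ.+ ½· ½· ε  ≡⟨ thirds ε ⟩
    ε                             ∎
    where
    open ℚ.≤-Reasoning
    quarter : Positive (½· ½· ε)
    quarter = ½·-positive (½· ε) {{½·-positive ε}}

opaque
  diagonal-close′ : ∀ s → IsCauchyʳ s → ∀ ε .{{_ : Positive ε}} → ∃[ N ] (∀ m n → N ℕ.≤ m → N ℕ.≤ n →
    Eventually (λ i → ∣ diagonal s m ℚ.- approx (s n) i ∣ ℚ.≤ ½· ½· ε ℚ.+ ½· ε))
  diagonal-close′ s s-cauchy ε
    with M , p ← ½^-small′ (½· ½· ε) {{½·-positive (½· ε) {{½·-positive ε}}}}
       | N , q ← s-cauchy (½· ε) {{½·-positive ε}} = M ℕ.⊔ N , λ m n m≥ n≥ → ev-zip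
         (λ {i} u v → triangle (diagonal s m) (approx (s m) i) (approx (s n) i)
                        (ℚ.≤-trans u (p m (⊔ˡ M N m≥))) v)
         (diagonal-close s m)
         (q m n (⊔ʳ M N m≥) (⊔ʳ M N n≥))

opaque
  diagonal-cauchy : ∀ s → IsCauchyʳ s → IsCauchy (diagonal s)
  diagonal-cauchy s s-cauchy ε
    with M , p ← ½^-small′ (½· ½· ε) {{½·-positive (½· ε) {{½·-positive ε}}}}
       | N , q ← diagonal-close′ s s-cauchy ε = M ℕ.⊔ N , λ m n m≥ n≥ → close m n (p n (⊔ˡ M N n≥))
         (ev-∃ (ev-zip _,_ (q m n (⊔ʳ M N m≥) (⊔ʳ M N n≥)) (diagonal-close s n)))
    where
    close : ∀ m n → ½^ n ℚ.≤ ½· ½· ε →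
            ∃[ i ] (∣ diagonal s m ℚ.- approx (s n) i ∣ ℚ.≤ ½· ½· ε ℚ.+ ½· ε
                    × ∣ diagonal s n ℚ.- approx (s n) i ∣ ℚ.≤ ½^ n) →
            ∣ diagonal s m ℚ.- diagonal s n ∣ ℚ.≤ ε
    close m n le (i , u , v) = ℚ.≤-trans
      (triangle (diagonal s m) (approx (s n) i) (diagonal s n) u
        (ℚ.≤-trans (ℚ.≤-reflexive (dist-sym (approx (s n) i) (diagonal s n))) (ℚ.≤-trans v le)))
      (ℚ.≤-reflexive (thirds ε))

opaque
  lim : ∀ s → IsCauchyʳ s → ℝ
  lim s s-cauchy = mkℝ (diagonal s) (diagonal-cauchy s s-cauchy)

  lim-⟶ : ∀ s s-cauchy → s ⟶ lim s s-cauchy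
  lim-⟶ s s-cauchy ε
    with M , p ← diagonal-close′ s s-cauchy (½· ε) {{½·-positive ε}}
       | N , q ← diagonal-cauchy s s-cauchy (½· ε) {{½·-positive ε}} = M , λ n n≥ → ev-zip
         (λ {i} u v → close n i u v)
         (p (M ℕ.⊔ N) n (ℕ.m≤m⊔n M N) n≥)
         (N , λ i i≥ → q i (M ℕ.⊔ N) i≥ (ℕ.m≤n⊔m M N))
    where
    close : ∀ {K} n i → ∣ diagonal s K ℚ.- approx (s n) i ∣ ℚ.≤ ½· ½· ½· ε ℚ.+ ½· ½· ε →
            ∣ diagonal s i ℚ.- diagonal s K ∣ ℚ.≤ ½· ε →
            ∣ approx (s n) i ℚ.- diagonal s i ∣ ℚ.≤ ε
    close {K} n i u v = begin
      ∣ approx (s n) i ℚ.- diagonal s i ∣   ≡⟨ dist-sym (approx (s n) i) (diagonal s i) ⟩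
      ∣ diagonal s i ℚ.- approx (s n) i ∣   ≤⟨ triangle (diagonal s i) (diagonal s K) (approx (s n) i) v
                                                 (ℚ.≤-trans u (two-thirds (½· ε) {{½·-positive ε}})) ⟩
      ½· ε ℚ.+ ½· ε                         ≡⟨ ½·+½· ε ⟩
      ε                                     ∎
      where open ℚ.≤-Reasoning

partialSum : (ℕ → ℝ) → ℕ → ℝ
partialSum a zero    = 0ʳ
partialSum a (suc n) = partialSum a n +ʳ a n

GeometricallyBounded : (ℕ → ℝ) → Set
GeometricallyBounded a = ∃[ c ] (∀ k → Eventually (λ i → ∣ approx (a k) i ∣ ℚ.≤ ι c ℚ.* ½^ k))

step-arith : ∀ c s s₀ a h t → ∣ s ℚ.- s₀ ∣ ℚ.+ c ℚ.* (h ℚ.+ h) ℚ.≤ t → ∣ a ∣ ℚ.≤ c ℚ.* h →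
             ∣ (s ℚ.+ a) ℚ.- s₀ ∣ ℚ.+ c ℚ.* h ℚ.≤ t
step-arith c s s₀ a h t p q = begin
  ∣ (s ℚ.+ a) ℚ.- s₀ ∣ ℚ.+ c ℚ.* h              ≡⟨ cong (λ x → ∣ x ∣ ℚ.+ c ℚ.* h) (solve 3 (λ s s₀ a → (s :+ a) :- s₀ := (s :- s₀) :+ a) refl s s₀ a) ⟩
  ∣ (s ℚ.- s₀) ℚ.+ a ∣ ℚ.+ c ℚ.* h              ≤⟨ ℚ.+-monoˡ-≤ (c ℚ.* h) (ℚ.∣p+q∣≤∣p∣+∣q∣ (s ℚ.- s₀) a) ⟩
  ∣ s ℚ.- s₀ ∣ ℚ.+ ∣ a ∣ ℚ.+ c ℚ.* h            ≤⟨ ℚ.+-monoˡ-≤ (c ℚ.* h) (ℚ.+-monoʳ-≤ ∣ s ℚ.- s₀ ∣ q) ⟩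
  ∣ s ℚ.- s₀ ∣ ℚ.+ c ℚ.* h ℚ.+ c ℚ.* h          ≡⟨ solve 3 (λ x c h → x :+ c :* h :+ c :* h := x :+ c :* (h :+ h)) refl ∣ s ℚ.- s₀ ∣ c h ⟩
  ∣ s ℚ.- s₀ ∣ ℚ.+ c ℚ.* (h ℚ.+ h)              ≤⟨ p ⟩
  t                                             ∎
  where open ℚ.≤-Reasoning; open +-*-Solver

opaque
  unfolding _+ʳ_

  tail-invariant : ∀ a c → (∀ k → Eventually (λ i → ∣ approx (a k) i ∣ ℚ.≤ ι c ℚ.* ½^ k)) → ∀ N j →
    Eventually (λ i → ∣ approx (partialSum a (j ℕ.+ N)) i ℚ.- approx (partialSum a N) i ∣
                        ℚ.+ ι c ℚ.* (½^ (j ℕ.+ N) ℚ.+ ½^ (j ℕ.+ N))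
                      ℚ.≤ ι c ℚ.* (½^ N ℚ.+ ½^ N))
  tail-invariant a c bound N zero = 0 , λ i _ → ℚ.≤-reflexive (trans
    (cong (λ q → ∣ q ∣ ℚ.+ ι c ℚ.* (½^ N ℚ.+ ½^ N)) (ℚ.+-inverseʳ (approx (partialSum a N) i)))
    (ℚ.+-identityˡ (ι c ℚ.* (½^ N ℚ.+ ½^ N))))
  tail-invariant a c bound N (suc j) = ev-zip
    (λ {i} u v → subst
      (λ h → ∣ (approx (partialSum a (j ℕ.+ N)) i ℚ.+ approx (a (j ℕ.+ N)) i) ℚ.- approx (partialSum a N) i ∣
               ℚ.+ ι c ℚ.* h ℚ.≤ ι c ℚ.* (½^ N ℚ.+ ½^ N))
      (sym (½·+½· (½^ (j ℕ.+ N))))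
      (step-arith (ι c) (approx (partialSum a (j ℕ.+ N)) i) (approx (partialSum a N) i) (approx (a (j ℕ.+ N)) i)
                  (½^ (j ℕ.+ N)) (ι c ℚ.* (½^ N ℚ.+ ½^ N)) u v))
    (tail-invariant a c bound N j) (bound (j ℕ.+ N))

tail-small : ∀ c h t x ε → 0ℚ ℚ.≤ c ℚ.* h → c ℚ.* t ℚ.≤ ½· ½· ε →
             x ℚ.+ c ℚ.* (h ℚ.+ h) ℚ.≤ c ℚ.* (t ℚ.+ t) → x ℚ.≤ ½· ε
tail-small c h t x ε 0≤ small p = begin
  x                              ≡⟨ ℚ.+-identityʳ x ⟨
  x ℚ.+ 0ℚ                       ≡⟨ cong (x ℚ.+_) (ℚ.+-identityʳ 0ℚ) ⟨
  x ℚ.+ (0ℚ ℚ.+ 0ℚ)              ≤⟨ ℚ.+-monoʳ-≤ x (ℚ.+-mono-≤ 0≤ 0≤) ⟩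
  x ℚ.+ (c ℚ.* h ℚ.+ c ℚ.* h)    ≡⟨ cong (x ℚ.+_) (ℚ.*-distribˡ-+ c h h) ⟨
  x ℚ.+ c ℚ.* (h ℚ.+ h)          ≤⟨ p ⟩
  c ℚ.* (t ℚ.+ t)                ≡⟨ ℚ.*-distribˡ-+ c t t ⟩
  c ℚ.* t ℚ.+ c ℚ.* t            ≤⟨ ℚ.+-mono-≤ small small ⟩
  ½· ½· ε ℚ.+ ½· ½· ε            ≡⟨ ½·+½· (½· ε) ⟩
  ½· ε                           ∎
  where open ℚ.≤-Reasoning

0≤ι*½^ : ∀ c n → 0ℚ ℚ.≤ ι c ℚ.* ½^ n
0≤ι*½^ c n = subst (ℚ._≤ ι c ℚ.* ½^ n) (ℚ.*-zeroˡ (½^ n)) (*½^-mono n (0≤ι c))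

opaque
  partialSum-cauchy : ∀ a → GeometricallyBounded a → IsCauchyʳ (partialSum a)
  partialSum-cauchy a (c , bound) ε
    with N , small ← ½^-small c (½· ½· ε) {{½·-positive (½· ε) {{½·-positive ε}}}} = N , λ m n m≥ n≥ →
      ev-zip (λ {i} u v → ℚ.≤-trans
               (triangle (approx (partialSum a m) i) (approx (partialSum a N) i) (approx (partialSum a n) i) u
                 (subst (ℚ._≤ ½· ε) (dist-sym (approx (partialSum a n) i) (approx (partialSum a N) i)) v))
               (ℚ.≤-reflexive (½·+½· ε)))
             (tail m m≥) (tail n n≥)
    where
    tail : ∀ m → N ℕ.≤ m → Close (½· ε) (partialSum a m) (partialSum a N)
    tail m N≤m = subst (λ k → Close (½· ε) (partialSum a k) (partialSum a N)) (ℕ.m∸n+n≡m N≤m)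
      (ev-map (λ {i} → tail-small (ι c) (½^ (m ℕ.∸ N ℕ.+ N)) (½^ N)
                (∣ approx (partialSum a (m ℕ.∸ N ℕ.+ N)) i ℚ.- approx (partialSum a N) i ∣) ε (0≤ι*½^ c (m ℕ.∸ N ℕ.+ N)) small) (tail-invariant a c bound N (m ℕ.∸ N)))

∑∞ : ∀ a → GeometricallyBounded a → ℝ
∑∞ a bound = lim (partialSum a) (partialSum-cauchy a bound)

record ℂ : Set where
  constructor _+i_
  field
    re im : ℝ
open ℂ public

infix 4 _≃ᶜ_
infixl 6 _+ᶜ_
infixl 7 _*ᶜ_
infix  8 -ᶜ_

_≃ᶜ_ : Rel ℂ 0ℓ
z ≃ᶜ w = re z ≃ re w × im z ≃ im w

fromℝ : ℝ → ℂ
fromℝ x = x +i 0ʳ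

fromℤ : ℤ → ℂ
fromℤ n = fromℝ (fromℚ (n ℚ./ 1))

0ᶜ 1ᶜ 𝕚 : ℂ
0ᶜ = fromℝ 0ʳ
1ᶜ = fromℝ 1ʳ
𝕚  = 0ʳ +i 1ʳ

opaque
  _+ᶜ_ _*ᶜ_ : ℂ → ℂ → ℂ
  z +ᶜ w = (re z +ʳ re w) +i (im z +ʳ im w)
  z *ᶜ w = (re z *ʳ re w +ʳ -ʳ (im z *ʳ im w)) +i (re z *ʳ im w +ʳ im z *ʳ re w)

  -ᶜ_ conj : ℂ → ℂ
  -ᶜ z   = (-ʳ re z) +i (-ʳ im z)
  conj z = re z +i (-ʳ im z)

∣_∣² : ℂ → ℝ
∣ z ∣² = re z *ʳ re z +ʳ im z *ʳ im z

ℂ-rawSemiring : RawSemiring 0ℓ 0ℓ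
ℂ-rawSemiring = record { Carrier = ℂ ; _≈_ = _≃ᶜ_ ; _+_ = _+ᶜ_ ; _*_ = _*ᶜ_ ; 0# = 0ᶜ ; 1# = 1ᶜ }

open RawSemiringDefinitions ℂ-rawSemiring public using () renaming (sum to ∑; _^_ to _^ᶜ_)

Boundedᶜ : ℂ → ℕ → Set
Boundedᶜ z b = Bounded (re z) b × Bounded (im z) b

opaque
  unfolding _+ʳ_

  bounded-mono : ∀ {x b c} → b ℕ.≤ c → Bounded x b → Bounded x c
  bounded-mono b≤c = ev-map (λ p → ℚ.≤-trans p (ι-mono b≤c))

  bounded-fromℚ : ∀ q b → ∣ q ∣ ℚ.≤ ι b → Bounded (fromℚ q) b
  bounded-fromℚ q b p = 0 , λ _ _ → p

  bounded-neg : ∀ x {b} → Bounded x b → Bounded (-ʳ x) b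
  bounded-neg x = ev-map (λ {i} → ℚ.≤-trans (ℚ.≤-reflexive (ℚ.∣-p∣≡∣p∣ (approx x i))))

  bounded-+ : ∀ x y {b c} → Bounded x b → Bounded y c → Bounded (x +ʳ y) (b ℕ.+ c)
  bounded-+ x y {b} {c} = ev-zip (λ {i} p q → subst (∣ approx x i ℚ.+ approx y i ∣ ℚ.≤_) (ι-+ b c)
    (ℚ.≤-trans (ℚ.∣p+q∣≤∣p∣+∣q∣ (approx x i) (approx y i)) (ℚ.+-mono-≤ p q)))

  bounded-* : ∀ x y {b c} → Bounded x b → Bounded y c → Bounded (x *ʳ y) (b ℕ.* c)
  bounded-* x y {b} {c} = ev-zip (λ {i} p q → subst (∣ approx x i ℚ.* approx y i ∣ ℚ.≤_) (ι-* b c)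
    (abs-*-mono (approx x i) (approx y i) p q))

opaque
  unfolding ι

  bounded-0 : ∀ b → Bounded 0ʳ b
  bounded-0 b = bounded-fromℚ 0ℚ b (0≤ι b)

  bounded-1 : Bounded 1ʳ 1
  bounded-1 = bounded-fromℚ 1ℚ 1 ℚ.≤-refl

boundedᶜ : ∀ z → ∃ (Boundedᶜ z)
boundedᶜ z with b , p ← bounded (re z) | c , q ← bounded (im z) =
  b ℕ.⊔ c , bounded-mono {re z} (ℕ.m≤m⊔n b c) p , bounded-mono {im z} (ℕ.m≤n⊔m b c) q

boundedᶜ-0 : ∀ b → Boundedᶜ 0ᶜ b
boundedᶜ-0 b = bounded-0 b , bounded-0 b

boundedᶜ-1 : Boundedᶜ 1ᶜ 1
boundedᶜ-1 = bounded-1 , bounded-0 1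

opaque
  unfolding _+ᶜ_

  boundedᶜ-+ : ∀ z w {b c} → Boundedᶜ z b → Boundedᶜ w c → Boundedᶜ (z +ᶜ w) (b ℕ.+ c)
  boundedᶜ-+ z w (p , q) (p′ , q′) = bounded-+ (re z) (re w) p p′ , bounded-+ (im z) (im w) q q′

  boundedᶜ-* : ∀ z w {b c} → Boundedᶜ z b → Boundedᶜ w c → Boundedᶜ (z *ᶜ w) (2 ℕ.* (b ℕ.* c))
  boundedᶜ-* z w {b} {c} (p , q) (p′ , q′) = subst (Boundedᶜ (z *ᶜ w)) (sym (cong (b ℕ.* c ℕ.+_) (ℕ.+-identityʳ (b ℕ.* c))))
    ( bounded-+ (re z *ʳ re w) (-ʳ (im z *ʳ im w)) (bounded-* (re z) (re w) p p′)
        (bounded-neg (im z *ʳ im w) (bounded-* (im z) (im w) q q′))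
    , bounded-+ (re z *ʳ im w) (im z *ʳ re w) (bounded-* (re z) (im w) p q′) (bounded-* (im z) (re w) q p′))

boundedᶜ-∑ : ∀ n (f : Fin n → ℂ) b → (∀ i → Boundedᶜ (f i) b) → Boundedᶜ (∑ f) (n ℕ.* b)
boundedᶜ-∑ zero    f b p = boundedᶜ-0 0
boundedᶜ-∑ (suc n) f b p = boundedᶜ-+ (f zero) (∑ (λ i → f (suc i))) (p zero) (boundedᶜ-∑ n (λ i → f (suc i)) b (λ i → p (suc i)))

_!⁻¹ : ℕ → ℚ
k !⁻¹ = (+ 1 ℚ./ (k !)) {{k ℕ.!≢0}}

-- These bounds make the series of the y k / k! converge.
ExponentiallyBounded : (ℕ → ℂ) → Set
ExponentiallyBounded y = ∃[ b ] (∀ k → Boundedᶜ (y k) (b ℕ.^ k))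

opaque
  unfolding ι

  /*ι : ∀ n .{{_ : ℕ.NonZero n}} → + 1 ℚ./ n ℚ.* ι n ≡ 1ℚ
  /*ι n@(suc d) = ℚ.toℚᵘ-injective (begin
    ℚ.toℚᵘ (+ 1 ℚ./ n ℚ.* ι n)                  ≈⟨ ℚ.toℚᵘ-homo-* (+ 1 ℚ./ n) (ι n) ⟩
    ℚ.toℚᵘ (+ 1 ℚ./ n) ℚᵘ.* ℚ.toℚᵘ (ι n)        ≈⟨ ℚᵘ.*-cong (ℚ.toℚᵘ-fromℚᵘ (ℚᵘ.mkℚᵘ (+ 1) d)) (toℚᵘ-/1 (+ n)) ⟩
    ℚᵘ.mkℚᵘ (+ 1) d ℚᵘ.* ℚᵘ.mkℚᵘ (+ n) 0        ≈⟨ ℚᵘ.*≡* (cong (λ k → + suc k) (arith d)) ⟩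
    ℚᵘ.mkℚᵘ (+ 1) 0                             ∎)
    where
    open import Relation.Binary.Reasoning.Setoid ℚᵘ.≃-setoid
    arith : ∀ d → (d ℕ.+ 0) ℕ.* 1 ≡ d ℕ.* 1 ℕ.+ 0
    arith d = trans (cong (ℕ._* 1) (ℕ.+-identityʳ d)) (sym (ℕ.+-identityʳ (d ℕ.* 1)))

^-distrib-* : ∀ a b k → (a ℕ.* b) ℕ.^ k ≡ a ℕ.^ k ℕ.* b ℕ.^ k
^-distrib-* a b zero    = refl
^-distrib-* a b (suc k) = trans (cong (a ℕ.* b ℕ.*_) (^-distrib-* a b k))
  (ℕ.[m*n]*[o*p]≡[m*o]*[n*p] a b (a ℕ.^ k) (b ℕ.^ k))

power≤factorial : ∀ m k → m ℕ.^ k ℕ.≤ m ℕ.^ m ℕ.* k !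
power≤factorial m zero = subst (1 ℕ.≤_) (sym (ℕ.*-identityʳ (m ℕ.^ m))) (m^m≥1 m)
  where
  m^m≥1 : ∀ m → 1 ℕ.≤ m ℕ.^ m
  m^m≥1 zero    = ℕ.≤-refl
  m^m≥1 (suc m) = ℕ.m^n>0 (suc m) (suc m)
power≤factorial m (suc k) with ℕ.≤-total m (suc k)
... | inj₁ m≤1+k = begin
  m ℕ.* m ℕ.^ k                  ≤⟨ ℕ.*-mono-≤ m≤1+k (power≤factorial m k) ⟩
  suc k ℕ.* (m ℕ.^ m ℕ.* k !)    ≡⟨ ℕ.*-assoc (suc k) (m ℕ.^ m) (k !) ⟨
  suc k ℕ.* m ℕ.^ m ℕ.* k !      ≡⟨ cong (ℕ._* k !) (ℕ.*-comm (suc k) (m ℕ.^ m)) ⟩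
  m ℕ.^ m ℕ.* suc k ℕ.* k !      ≡⟨ ℕ.*-assoc (m ℕ.^ m) (suc k) (k !) ⟩
  m ℕ.^ m ℕ.* (suc k) !          ∎
  where open ℕ.≤-Reasoning
power≤factorial (suc m) (suc k) | inj₂ 1+k≤m = begin
  suc m ℕ.^ suc k                ≤⟨ ℕ.^-monoʳ-≤ (suc m) 1+k≤m ⟩
  suc m ℕ.^ suc m                ≤⟨ ℕ.m≤m*n (suc m ℕ.^ suc m) ((suc k) !) {{(suc k) ℕ.!≢0}} ⟩
  suc m ℕ.^ suc m ℕ.* (suc k) !  ∎
  where open ℕ.≤-Reasoning

0≤!⁻¹ : ∀ k → 0ℚ ℚ.≤ k !⁻¹
0≤!⁻¹ k = ℚ.nonNegative⁻¹ (k !⁻¹) {{ℚ.normalize-nonNeg 1 (k !) {{k ℕ.!≢0}}}}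

term-arith : ∀ v b t h c f → t ℚ.* h ≡ 1ℚ → v ℚ.* f ≡ 1ℚ → 0ℚ ℚ.≤ v → 0ℚ ℚ.≤ h →
             b ℚ.* t ℚ.≤ c ℚ.* f → v ℚ.* b ℚ.≤ c ℚ.* h
term-arith v b t h c f th vf 0≤v 0≤h le = begin
  v ℚ.* b                        ≡⟨ ℚ.*-identityʳ (v ℚ.* b) ⟨
  v ℚ.* b ℚ.* 1ℚ                 ≡⟨ cong (v ℚ.* b ℚ.*_) th ⟨
  v ℚ.* b ℚ.* (t ℚ.* h)          ≡⟨ solve 4 (λ v b t h → v :* b :* (t :* h) := v :* (b :* t) :* h) refl v b t h ⟩
  v ℚ.* (b ℚ.* t) ℚ.* h          ≤⟨ ℚ.*-monoʳ-≤-nonNeg h {{ℚ.nonNegative 0≤h}} (ℚ.*-monoˡ-≤-nonNeg v {{ℚ.nonNegative 0≤v}} le) ⟩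
  v ℚ.* (c ℚ.* f) ℚ.* h          ≡⟨ solve 4 (λ v c f h → v :* (c :* f) :* h := v :* f :* (c :* h)) refl v c f h ⟩
  v ℚ.* f ℚ.* (c ℚ.* h)          ≡⟨ cong (ℚ._* (c ℚ.* h)) vf ⟩
  1ℚ ℚ.* (c ℚ.* h)               ≡⟨ ℚ.*-identityˡ (c ℚ.* h) ⟩
  c ℚ.* h                        ∎
  where open ℚ.≤-Reasoning; open +-*-Solver

term≤ : ∀ b k → k !⁻¹ ℚ.* ι (b ℕ.^ k) ℚ.≤ ι ((b ℕ.* 2) ℕ.^ (b ℕ.* 2)) ℚ.* ½^ k
term≤ b k = term-arith (k !⁻¹) (ι (b ℕ.^ k)) (ι (2 ℕ.^ k)) (½^ k) (ι ((b ℕ.* 2) ℕ.^ (b ℕ.* 2))) (ι (k !))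
  (2^*½^ k) (/*ι (k !) {{k ℕ.!≢0}}) (0≤!⁻¹ k) (0≤½^ k)
  (subst₂ ℚ._≤_ (trans (cong ι (^-distrib-* b 2 k)) (sym (ι-* (b ℕ.^ k) (2 ℕ.^ k))))
                (sym (ι-* ((b ℕ.* 2) ℕ.^ (b ℕ.* 2)) (k !)))
                (ι-mono (power≤factorial (b ℕ.* 2) k)))

opaque
  unfolding _+ʳ_

  /!-geometricallyBounded : ∀ (y : ℕ → ℝ) b → (∀ k → Bounded (y k) (b ℕ.^ k)) →
                            GeometricallyBounded (λ k → fromℚ (k !⁻¹) *ʳ y k)
  /!-geometricallyBounded y b bound = (b ℕ.* 2) ℕ.^ (b ℕ.* 2) , λ k → ev-map
    (λ {i} p → ℚ.≤-trans
      (abs-*-mono {k !⁻¹} {ι (b ℕ.^ k)} (k !⁻¹) (approx (y k) i) (ℚ.≤-reflexive (ℚ.0≤p⇒∣p∣≡p (0≤!⁻¹ k))) p)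
      (term≤ b k))
    (bound k)

expSeries : ∀ y → ExponentiallyBounded y → ℂ
expSeries y (b , bound) =
  ∑∞ (λ k → fromℚ (k !⁻¹) *ʳ re (y k)) (/!-geometricallyBounded (λ k → re (y k)) b (λ k → proj₁ (bound k))) +i
  ∑∞ (λ k → fromℚ (k !⁻¹) *ʳ im (y k)) (/!-geometricallyBounded (λ k → im (y k)) b (λ k → proj₂ (bound k)))

reassoc : ∀ a b x → a ℕ.* (b ℕ.* x) ≡ a ℕ.* b ℕ.* x
reassoc a b x = sym (ℕ.*-assoc a b x)

opaque
  power-bounded : ∀ z → ExponentiallyBounded (λ k → z ^ᶜ k)
  power-bounded z with b , p ← boundedᶜ z = 2 ℕ.* b , bound
    where
    bound : ∀ k → Boundedᶜ (z ^ᶜ k) ((2 ℕ.* b) ℕ.^ k)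
    bound zero    = boundedᶜ-1
    bound (suc k) = subst (Boundedᶜ (z ^ᶜ suc k)) (reassoc 2 b ((2 ℕ.* b) ℕ.^ k)) (boundedᶜ-* z (z ^ᶜ k) p (bound k))

exp : ℂ → ℂ
exp z = expSeries (λ k → z ^ᶜ k) (power-bounded z)

cos sin : ℝ → ℝ
cos x = re (exp (𝕚 *ᶜ fromℝ x))
sin x = im (exp (𝕚 *ᶜ fromℝ x))

-- π is the least positive zero of the sine; this determines it up to _≃_.
record IsPi (π : ℝ) : Set where
  field
    positive : 0ʳ < π
    sin≃0    : sin π ≃ 0ʳ
    least    : ∀ x → 0ʳ < x → x < π → 0ʳ < sin x

Vec : ℕ → Set
Vec n = Fin n → ℂ

Matrix : ℕ → Set
Matrix n = Fin n → Fin n → ℂ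

infixl 7 _·_ _•_

_·_ : ∀ {n} → Matrix n → Vec n → Vec n
(M · v) i = ∑ (λ j → M i j *ᶜ v j)

_•_ : ∀ {n} → ℂ → Matrix n → Matrix n
(z • M) i j = z *ᶜ M i j

basis : ∀ {n} → Fin n → Vec n
basis i j = if does (i Fin.≟ j) then 1ᶜ else 0ᶜ

Matrix-rawSemiring : ℕ → RawSemiring 0ℓ 0ℓ
Matrix-rawSemiring n = record
  { Carrier = Matrix n
  ; _≈_ = λ M N → ∀ i j → M i j ≃ᶜ N i j
  ; _+_ = λ M N i j → M i j +ᶜ N i j
  ; _*_ = λ M N i j → ∑ (λ k → M i k *ᶜ N k j)
  ; 0#  = λ _ _ → 0ᶜ
  ; 1#  = basis
  }

infixr 8 _^ᴹ_

_^ᴹ_ : ∀ {n} → Matrix n → ℕ → Matrix n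
_^ᴹ_ {n} = RawSemiringDefinitions._^_ (Matrix-rawSemiring n)

uniform : ∀ n (P : Fin n → ℕ → Set) → (∀ i {b c} → b ℕ.≤ c → P i b → P i c) →
          (∀ i → ∃ (P i)) → ∃[ b ] (∀ i → P i b)
uniform zero    P mono p = 0 , λ ()
uniform (suc n) P mono p
  with b , q ← p zero | c , r ← uniform n (λ i → P (suc i)) (λ i → mono (suc i)) (λ i → p (suc i)) =
    b ℕ.⊔ c , λ { zero → mono zero (ℕ.m≤m⊔n b c) q ; (suc i) → mono (suc i) (ℕ.m≤n⊔m b c) (r i) }

boundedᶜ-mono : ∀ z {b c} → b ℕ.≤ c → Boundedᶜ z b → Boundedᶜ z c
boundedᶜ-mono z b≤c (p , q) = bounded-mono {re z} b≤c p , bounded-mono {im z} b≤c q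

boundedᴹ : ∀ {n} (M : Matrix n) → ∃[ b ] (∀ i j → Boundedᶜ (M i j) b)
boundedᴹ {n} M = uniform n (λ i b → ∀ j → Boundedᶜ (M i j) b) (λ i b≤c p j → boundedᶜ-mono (M i j) b≤c (p j))
  (λ i → uniform n (λ j b → Boundedᶜ (M i j) b) (λ j → boundedᶜ-mono (M i j)) (λ j → boundedᶜ (M i j)))

boundedᶜ-basis : ∀ {n} (i j : Fin n) → Boundedᶜ (basis i j) 1
boundedᶜ-basis i j with does (i Fin.≟ j)
... | true  = boundedᶜ-1
... | false = boundedᶜ-0 1

opaque
  powerᴹ-bounded : ∀ {n} (M : Matrix n) i j → ExponentiallyBounded (λ k → (M ^ᴹ k) i j)
  powerᴹ-bounded {n} M i j with b , p ← boundedᴹ M = n ℕ.* (2 ℕ.* b) , λ k → bound b p k i j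
    where
    bound : ∀ b → (∀ i j → Boundedᶜ (M i j) b) → ∀ k i j → Boundedᶜ ((M ^ᴹ k) i j) ((n ℕ.* (2 ℕ.* b)) ℕ.^ k)
    bound b p zero    i j = boundedᶜ-basis i j
    bound b p (suc k) i j = subst (Boundedᶜ ((M ^ᴹ suc k) i j))
      (trans (cong (n ℕ.*_) (reassoc 2 b ((n ℕ.* (2 ℕ.* b)) ℕ.^ k))) (reassoc n (2 ℕ.* b) ((n ℕ.* (2 ℕ.* b)) ℕ.^ k)))
      (boundedᶜ-∑ n (λ l → M i l *ᶜ (M ^ᴹ k) l j) (2 ℕ.* (b ℕ.* (n ℕ.* (2 ℕ.* b)) ℕ.^ k))
        (λ l → boundedᶜ-* (M i l) ((M ^ᴹ k) l j) (p i l) (bound b p k l j)))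

expᴹ : ∀ {n} → Matrix n → Matrix n
expᴹ M i j = expSeries (λ k → (M ^ᴹ k) i j) (powerᴹ-bounded M i j)

-- Written additively: _⊕_, 0#, _⊖_, and n ×ᴳ x for the n-fold sum of x.
record FiniteAbelianGroup c ℓ : Set (lsuc (c ⊔ ℓ)) where
  field
    abelianGroup : AbelianGroup c ℓ
    order        : ℕ
    enumeration  : Inverse (AbelianGroup.setoid abelianGroup) (≡.setoid (Fin order))

  open AbelianGroup abelianGroup public using (Carrier; _≈_; setoid; rawMonoid; isAbelianGroup; sym; trans)
    renaming (_∙_ to _⊕_; ε to 0#; _-_ to _⊖_)
  open RawMonoidDefinitions rawMonoid public using () renaming (_×_ to _×ᴳ_)
  open Inverse enumeration public using () renaming (to to index; from to element)

  _≟_ : ∀ x y → Dec (x ≈ y)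
  _≟_ = via-injection (Inverse⇒Injection enumeration) Fin._≟_

ℤ₂ : FiniteAbelianGroup 0ℓ 0ℓ
ℤ₂ = record
  { abelianGroup = ℙ.+-0-abelianGroup
  ; order        = 2
  ; enumeration  = record
    { to        = λ { 0ℙ → zero ; 1ℙ → suc zero }
    ; from      = λ { zero → 0ℙ ; (suc zero) → 1ℙ }
    ; to-cong   = cong _
    ; from-cong = cong _
    ; inverse   = (λ { {zero} refl → refl ; {suc zero} refl → refl })
                , (λ { {0ℙ} refl → refl ; {1ℙ} refl → refl })
    }
  }

_×ᶠ_ : ∀ {a b ℓ₁ ℓ₂} → FiniteAbelianGroup a ℓ₁ → FiniteAbelianGroup b ℓ₂ →
       FiniteAbelianGroup (a ⊔ b) (ℓ₁ ⊔ ℓ₂)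
G ×ᶠ H = record
  { abelianGroup = DirectProduct.abelianGroup G.abelianGroup H.abelianGroup
  ; order        = G.order ℕ.* H.order
  ; enumeration  = Compose.inverse (G.enumeration ×ₛ.×-inverse H.enumeration)
                     (Compose.inverse Pointwise-≡↔≡ (↔-sym Fin.*↔×))
  }
  where
  module G = FiniteAbelianGroup G
  module H = FiniteAbelianGroup H

record Subset {c ℓ} (G : FiniteAbelianGroup c ℓ) s : Set (c ⊔ ℓ ⊔ lsuc s) where
  open FiniteAbelianGroup G
  field
    member   : Pred Carrier s
    respects : member Respects _≈_
    member?  : Decidable member

open Subset public using (member; member?)

module _ {c ℓ} (G : FiniteAbelianGroup c ℓ) where
  open FiniteAbelianGroup G

  private variable
    s : Level

  ∑ᴳ : (Carrier → ℂ) → ℂ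
  ∑ᴳ φ = ∑ (λ i → φ (element i))

  ∑[_] : Subset G s → (Carrier → ℂ) → ℂ
  ∑[ S ] φ = ∑ᴳ (λ x → if does (member? S x) then φ x else 0ᶜ)

  indicator : Subset G s → Carrier → ℤ
  indicator S x = if does (member? S x) then + 1 else + 0

  cardinality : Subset G s → ℕ
  cardinality S = sumℕ (λ i → if does (member? S (element i)) then 1 else 0)
    where open RawMonoidDefinitions ℕ.+-0-rawMonoid renaming (sum to sumℕ)

  dilate : ℕ → Subset G s → Pred Carrier (c ⊔ ℓ ⊔ s)
  dilate n S x = ∃[ y ] (member S y × x ≈ n ×ᴳ y)

  record IsExponent (e : ℕ) : Set (c ⊔ ℓ) where
    field
      positive    : 1 ℕ.≤ e
      annihilates : ∀ x → e ×ᴳ x ≈ 0#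
      least       : ∀ m → 1 ℕ.≤ m → (∀ x → m ×ᴳ x ≈ 0#) → e ℕ.≤ m

  -- The values are automatically non-zero, since the homomorphism starts from a group.
  record Character : Set (c ⊔ ℓ) where
    open MonoidMorphisms rawMonoid (RawSemiring.*-rawMonoid ℂ-rawSemiring)
    field
      χ                    : Carrier → ℂ
      isMonoidHomomorphism : IsMonoidHomomorphism χ

  open Character public using (χ)

  fourier : (Carrier → ℤ) → Character → ℂ
  fourier f ψ = ∑ᴳ (λ x → fromℤ (f x) *ᶜ conj (χ ψ x))

  adjacency : Subset G s → Matrix order
  adjacency S i j = if does (member? S (element i ⊖ element j)) then 1ᶜ else 0ᶜ

  -- (α , β)-revival; β ≠ 0 is the negation of the equality β ≃ᶜ 0ᶜ.
  record FractionalRevival (S : Subset G s) (t : ℝ) (u v : Carrier) (α β : ℂ) : Set where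
    field
      evolution  : ∀ i → (expᴹ ((𝕚 *ᶜ fromℝ t) • adjacency S) · basis (index u)) i
                         ≃ᶜ α *ᶜ basis (index u) i +ᶜ β *ᶜ basis (index v) i
      nonzero    : ¬ β ≃ᶜ 0ᶜ
      normalised : ∣ α ∣² +ʳ ∣ β ∣² ≃ 1ʳ

_∈ℤ*_ : ℕ → ℕ → Set
n ∈ℤ* e = 1 ℕ.≤ n × n ℕ.≤ e ℕ.∸ 1 × gcd n e ≡ 1

_≡_[mod_] : ℂ → ℤ → ℕ → Set
z ≡ k [mod m ] = ∃[ j ] (z ≃ᶜ fromℤ (k ℤ.+ j ℤ.* + m))

module _ {c ℓ} (H : FiniteAbelianGroup c ℓ) (e : ℕ) where
  open FiniteAbelianGroup H

  record IsClassFunction (f : Carrier → ℤ) : Set (c ⊔ ℓ) where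
    field
      respects  : f Preserves _≈_ ⟶ _≡_
      invariant : ∀ n x → n ∈ℤ* e → f (n ×ᴳ x) ≡ f x

  FourierConstantMod : ℕ → (Carrier → ℤ) → Set (c ⊔ ℓ)
  FourierConstantMod m f = ∃[ k ] (∀ ψ → fourier H f ψ ≡ k [mod m ])

  record IsPlateaued (p r : ℕ) (f : Carrier → ℤ) : Set (c ⊔ ℓ) where
    field
      isClassFunction : IsClassFunction f
      congruence      : FourierConstantMod (p ℕ.^ r) f
      largest         : ∀ s → FourierConstantMod (p ℕ.^ s) f → s ℕ.≤ r

-- v is the exponent of p in d; no v qualifies for d = 0.
IsValuation : ℕ → ℕ → ℕ → Set
IsValuation p d v = p ℕ.^ v ℕ.∣ d × ¬ (p ℕ.^ suc v ℕ.∣ d)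

angle : ℝ → ∀ {p} → Prime p → ℕ → ℝ
angle π {p} p-prime r = π *ʳ fromℚ ((+ 1 ℚ./ p ℕ.^ r) {{ℕ.m^n≢0 p r {{prime⇒nonZero p-prime}}}})

sign : Parity → ℂ
sign 0ℙ = 1ᶜ
sign 1ℙ = -ᶜ 1ᶜ

module _ {c ℓ} (H : FiniteAbelianGroup c ℓ) where
  private
    module H = FiniteAbelianGroup H
    module G = FiniteAbelianGroup (ℤ₂ ×ᶠ H)

  connectionSet : ∀ {s} → Subset H s → Subset (ℤ₂ ×ᶠ H) (ℓ ⊔ s)
  connectionSet S₁ = record
    { member   = λ (x , y) → (x ≡ 1ℙ × member S₁ y) ⊎ (x ≡ 0ℙ × member S₁ y) ⊎ ((x , y) G.≈ (1ℙ , H.0#))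
    ; respects = λ where
        (refl , y≈) (inj₁ (x≡1 , y∈))        → inj₁ (x≡1 , Subset.respects S₁ y≈ y∈)
        (refl , y≈) (inj₂ (inj₁ (x≡0 , y∈))) → inj₂ (inj₁ (x≡0 , Subset.respects S₁ y≈ y∈))
        eq          (inj₂ (inj₂ eq′))        → inj₂ (inj₂ (G.trans (G.sym eq) eq′))
    ; member?  = λ (x , y) → (x ℙ.≟ 1ℙ ×-dec member? S₁ y) ⊎-dec (x ℙ.≟ 0ℙ ×-dec member? S₁ y)
                             ⊎-dec ((x , y) G.≟ (1ℙ , H.0#))
    }

  -- Characters of ℤ₂ × H: for g = (a , h) and ψ = χ_h, χ_g (x , y) = (-1)^(a x) ψ(y).  The
  -- labelling h ↦ χ_h of the characters of H by its elements involves a choice, so ψ itself is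
  -- used as the label.
  productCharacter : Parity → Character H → G.Carrier → ℂ
  productCharacter a ψ (x , y) = sign (a ℙ.* x) *ᶜ χ ψ y

  eigenvalue : ∀ {s} → Subset H s → Parity → Character H → ℂ
  eigenvalue S₁ a ψ = ∑[_] (ℤ₂ ×ᶠ H) (connectionSet S₁) (productCharacter a ψ)

{-# OPTIONS --safe #-}
-- Over H the graph splits along characters.  For a character ψ of H and a sign a, functions of the
-- form (x , y) ↦ (-1)^(a x) φ(y), with φ(y − h) = ψ(h) φ(y), are eigenvectors of the adjacency matrix;
-- the eigenvalue is -1 for a = 1 and 1 + 2 Σ_{s ∈ S₁} ψ(s) for a = 0.  Comparing with the trivial
-- character, whose sum is d, the plateau condition makes Σ ψ(s) an integer multiple of p^r₀, and
-- exp(2πi) = 1 gives the two values of exp(i t λ).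
--
-- Every function on H is a sum of such φ, without the structure theorem: for a primitive N-th root of
-- unity ω and N h = 0, the averages N⁻¹ Σ_j ω^(a j) φ(x + j h) are eigenfunctions of the translation by
-- h which add up to φ.  Doing this for all h yields joint eigenfunctions with eigenvalues ω^a(h), and
-- either a is additive modulo N, which gives a character, or the eigenfunction vanishes.
--
-- From the definition of π only sin π = 0 and the positivity of sin on (0 , π) are needed: with
-- z = exp(iθ), z z̄ = 1, the former gives exp(2πi) = (exp(πi))² = 1, and z² − 1 = 2i z sin θ shows that
-- the roots of unity are apart from 1.
module Submission where

open import Defs
open import Data.Nat.Base using (ℕ; _≤_; _⊓_)
open import Data.Nat.Divisibility.Core using (_∣_)
open import Data.Nat.Primality using (Prime)
open import Data.Parity.Base using (0ℙ; 1ℙ; _+_)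
open import Data.Product.Base using (_×_; _,_)
open import Relation.Nullary.Negation.Core using (¬_)
open import Relation.Unary using (_≐_)

open import Algebra.Bundles using (AbelianGroup; CommutativeRing)
import Algebra.Definitions.RawMonoid as RawMonoidDefinitions
open import Algebra.Morphism.Structures using (module MonoidMorphisms)
import Algebra.Properties.AbelianGroup as AbelianGroupProperties
import Algebra.Properties.CommutativeSemiring.Binomial as Binomial
import Algebra.Properties.Semiring.Exp as Exp
import Algebra.Properties.Semiring.Mult as Mult
import Algebra.Properties.Semiring.Sum as Sum
import Algebra.Solver.Ring as RingSolver
open import Algebra.Solver.Ring.AlmostCommutativeRing using (_-Raw-AlmostCommutative⟶_; fromCommutativeRing)
open import Data.Bool.Base using (true; false; if_then_else_; _∧_)
open import Data.Fin.Base as Fin using (Fin; zero; suc; toℕ; combine; _↑ˡ_; _↑ʳ_)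
open import Data.Fin.Permutation using (Permutation)
import Data.Fin.Properties as Fin
open import Data.Integer.Base as ℤ using (ℤ; +_; -[1+_])
import Data.Integer.Properties as ℤ
import Data.Integer.Solver as ℤ-Solver
open import Data.List.Base as List using ([]; _∷_)
open import Data.List.Relation.Unary.All as All using (All; []; _∷_)
import Data.List.Relation.Unary.All.Properties as All
open import Data.Maybe.Base using (Maybe; just; nothing)
open import Data.Nat.Base as ℕ using (zero; suc; _!; _∸_)
open import Data.Nat.Combinatorics using (_C_; nCk≡n!/k![n-k]!; k![n∸k]!∣n!)
open import Data.Nat.Divisibility using (divides; ∣-trans)
open import Data.Nat.DivMod using (_%_; m≡m%n+[m/n]*n; m%n<n; m/n*n≡m)
open import Data.Nat.Primality using (prime⇒nonZero; prime⇒nonTrivial)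
import Data.Nat.Properties as ℕ
open import Data.Parity.Base as ℙ using (Parity)
import Data.Parity.Properties as ℙ
open import Data.Product.Base using (∃-syntax; proj₁; proj₂)
open import Data.Rational.Base as ℚ using (ℚ; 0ℚ; 1ℚ; ½; ∣_∣; Positive)
import Data.Rational.Properties as ℚ
import Data.Rational.Solver as ℚ-Solver
import Data.Rational.Unnormalised.Base as ℚᵘ
import Data.Rational.Unnormalised.Properties as ℚᵘ
open import Data.Sum.Base using (inj₁; inj₂)
open import Function.Bundles using (Inverse; mk↔ₛ′; _⇔_; mk⇔)
open import Level using (0ℓ; _⊔_)
open import Relation.Binary.Definitions using (tri<; tri≈; tri>)
open import Relation.Binary.PropositionalEquality as ≡
  using (_≡_; refl; sym; trans; cong; cong₂; subst; subst₂)
import Relation.Binary.Reasoning.Setoid as SetoidReasoning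
open import Relation.Nullary using (Dec; yes; no; does; contradiction; _×-dec_)
open import Relation.Nullary.Decidable using (does-⇔; dec-true; dec-false)
open ℝ
open MonoidMorphisms using (module IsMonoidHomomorphism)

-- The ring of complex numbers

-- Equality in `ℂ` is undecidable, and a number merely known to differ from 0 cannot be inverted
-- constructively; several choices below avoid both. That a power of ω is apart from 1 is kept as a
-- cancellation property: a product with ω^j - 1 vanishes only if the other factor does. Eigenvalues
-- of translations are carried as natural exponents of ω, which can be compared modulo N, so the
-- alternative between a character and the zero function is a finite check. The decomposition into
-- characters appears as an induction principle for predicates closed under sums.
--
-- That principle applies to the matrix exponential because exp(i t λ) depends on the sign a alone:
-- multiplying by a factor depending only on a is a condition linear in φ, so it passes from
-- eigenfunctions of different characters to their sums, in particular to point masses, although the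
-- eigenvalues λ themselves vary with the character.

0≤pos : ∀ ε .{{_ : Positive ε}} → 0ℚ ℚ.≤ ε
0≤pos ε = ℚ.<⇒≤ (ℚ.positive⁻¹ ε)

≡⇒∣-∣≤ : ∀ {p q ε} → 0ℚ ℚ.≤ ε → p ≡ q → ∣ p ℚ.- q ∣ ℚ.≤ ε
≡⇒∣-∣≤ {p} 0≤ε refl = ℚ.≤-trans (ℚ.≤-reflexive (cong ∣_∣ (ℚ.+-inverseʳ p))) 0≤ε

pointwise⇒≃ : ∀ {x y} → (∀ i → approx x i ≡ approx y i) → x ≃ y
pointwise⇒≃ eq ε = 0 , λ i _ → ≡⇒∣-∣≤ (0≤pos ε) (eq i)

≃-refl : ∀ {x} → x ≃ x
≃-refl {x} = pointwise⇒≃ {x} {x} (λ _ → refl)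

≃-sym : ∀ {x y} → x ≃ y → y ≃ x
≃-sym {x} {y} p ε = ev-map (λ {i} → subst (ℚ._≤ ε) (dist-sym (approx x i) (approx y i))) (p ε)

≃-trans : ∀ {x y z} → x ≃ y → y ≃ z → x ≃ z
≃-trans {x} {y} {z} p q ε = ev-zip
  (λ {i} u v → subst (∣ approx x i ℚ.- approx z i ∣ ℚ.≤_) (½·+½· ε) (triangle (approx x i) (approx y i) (approx z i) u v))
  (p (½· ε) {{½·-positive ε}}) (q (½· ε) {{½·-positive ε}})

opaque
  unfolding _+ʳ_

  +ʳ-cong : ∀ {x x′ y y′} → x ≃ x′ → y ≃ y′ → x +ʳ y ≃ x′ +ʳ y′
  +ʳ-cong {x} {x′} {y} {y′} p q ε = ev-zip
    (λ {i} u v → subst (∣ (approx x i ℚ.+ approx y i) ℚ.- (approx x′ i ℚ.+ approx y′ i) ∣ ℚ.≤_) (½·+½· ε)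
      (dist-+ (approx x i) (approx x′ i) (approx y i) (approx y′ i) u v))
    (p (½· ε) {{½·-positive ε}}) (q (½· ε) {{½·-positive ε}})

  -ʳ-cong : ∀ {x x′} → x ≃ x′ → -ʳ x ≃ -ʳ x′
  -ʳ-cong {x} {x′} p ε = ev-map
    (λ {i} → subst (ℚ._≤ ε) (sym (dist-neg (approx x i) (approx x′ i)))) (p ε)

  *ʳ-cong : ∀ {x x′ y y′} → x ≃ x′ → y ≃ y′ → x *ʳ y ≃ x′ *ʳ y′
  *ʳ-cong {x} {x′} {y} {y′} p q ε
    with b , x′≤b ← bounded x′ | c , y≤c ← bounded y
    with δ , δ>0 , δc≤ ← scaled ε c | η , η>0 , ηb≤ ← scaled ε b = ev-zip
      (λ { {i} (u , v) (u′ , v′) → ℚ.≤-trans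
        (dist-* (approx x i) (approx x′ i) (approx y i) (approx y′ i) u v u′ v′)
        (halves ε δ (ι c) (ι b) η δc≤ ηb≤) })
      (ev-zip _,_ (p δ {{δ>0}}) y≤c) (ev-zip _,_ x′≤b (q η {{η>0}}))

infix 4 _≈ᶜ_

-- A record, because _≃ᶜ_ computes and so its arguments cannot be inferred from a proof.
record _≈ᶜ_ (z w : ℂ) : Set where
  constructor mk≈
  field un≈ : z ≃ᶜ w
open _≈ᶜ_

≈ᶜ-refl : ∀ {z} → z ≈ᶜ z
≈ᶜ-refl {z} = mk≈ (≃-refl {re z} , ≃-refl {im z})

≈ᶜ-sym : ∀ {z w} → z ≈ᶜ w → w ≈ᶜ z
≈ᶜ-sym {z} {w} (mk≈ (p , q)) = mk≈ (≃-sym {re z} {re w} p , ≃-sym {im z} {im w} q)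

≈ᶜ-trans : ∀ {z w v} → z ≈ᶜ w → w ≈ᶜ v → z ≈ᶜ v
≈ᶜ-trans {z} {w} {v} (mk≈ (p , q)) (mk≈ (p′ , q′)) =
  mk≈ (≃-trans {re z} {re w} {re v} p p′ , ≃-trans {im z} {im w} {im v} q q′)

fromℚᶜ : ℚ → ℂ
fromℚᶜ q = fromℝ (fromℚ q)

opaque
  unfolding _+ʳ_ _+ᶜ_

  +ᶜ-cong : ∀ {z z′ w w′} → z ≈ᶜ z′ → w ≈ᶜ w′ → z +ᶜ w ≈ᶜ z′ +ᶜ w′
  +ᶜ-cong {z} {z′} {w} {w′} (mk≈ (p , q)) (mk≈ (p′ , q′)) = mk≈
    ( +ʳ-cong {re z} {re z′} {re w} {re w′} p p′
    , +ʳ-cong {im z} {im z′} {im w} {im w′} q q′)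

  -ᶜ-cong : ∀ {z z′} → z ≈ᶜ z′ → -ᶜ z ≈ᶜ -ᶜ z′
  -ᶜ-cong {z} {z′} (mk≈ (p , q)) = mk≈ (-ʳ-cong {re z} {re z′} p , -ʳ-cong {im z} {im z′} q)

  conj-cong : ∀ {z z′} → z ≈ᶜ z′ → conj z ≈ᶜ conj z′
  conj-cong {z} {z′} (mk≈ (p , q)) = mk≈ (p , -ʳ-cong {im z} {im z′} q)

  *ᶜ-cong : ∀ {z z′ w w′} → z ≈ᶜ z′ → w ≈ᶜ w′ → z *ᶜ w ≈ᶜ z′ *ᶜ w′
  *ᶜ-cong {z} {z′} {w} {w′} (mk≈ (p , q)) (mk≈ (p′ , q′)) = mk≈
    ( +ʳ-cong {re z *ʳ re w} {re z′ *ʳ re w′} { -ʳ (im z *ʳ im w)} { -ʳ (im z′ *ʳ im w′)}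
        (*ʳ-cong {re z} {re z′} {re w} {re w′} p p′)
        (-ʳ-cong {im z *ʳ im w} {im z′ *ʳ im w′} (*ʳ-cong {im z} {im z′} {im w} {im w′} q q′))
    , +ʳ-cong {re z *ʳ im w} {re z′ *ʳ im w′} {im z *ʳ re w} {im z′ *ʳ re w′}
        (*ʳ-cong {re z} {re z′} {im w} {im w′} p q′)
        (*ʳ-cong {im z} {im z′} {re w} {re w′} q p′))

  -- Operations act index by index on the rational approximations, so a ring law of `ℂ` holds
  -- exactly at every index and reduces to a polynomial identity over `ℚ`.
  approx⇒≈ᶜ : ∀ {z w} → (∀ i → approx (re z) i ≡ approx (re w) i) → (∀ i → approx (im z) i ≡ approx (im w) i) → z ≈ᶜ w
  approx⇒≈ᶜ {z} {w} p q = mk≈ (pointwise⇒≃ {re z} {re w} p , pointwise⇒≃ {im z} {im w} q)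

  +ᶜ-assoc : ∀ z w v → (z +ᶜ w) +ᶜ v ≈ᶜ z +ᶜ (w +ᶜ v)
  +ᶜ-assoc z w v = approx⇒≈ᶜ
    (λ i → ℚ.+-assoc (approx (re z) i) (approx (re w) i) (approx (re v) i))
    (λ i → ℚ.+-assoc (approx (im z) i) (approx (im w) i) (approx (im v) i))

  +ᶜ-comm : ∀ z w → z +ᶜ w ≈ᶜ w +ᶜ z
  +ᶜ-comm z w = approx⇒≈ᶜ
    (λ i → ℚ.+-comm (approx (re z) i) (approx (re w) i))
    (λ i → ℚ.+-comm (approx (im z) i) (approx (im w) i))

  +ᶜ-identityˡ : ∀ z → 0ᶜ +ᶜ z ≈ᶜ z
  +ᶜ-identityˡ z = approx⇒≈ᶜ (λ i → ℚ.+-identityˡ (approx (re z) i)) (λ i → ℚ.+-identityˡ (approx (im z) i))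

  -ᶜ-inverseˡ : ∀ z → -ᶜ z +ᶜ z ≈ᶜ 0ᶜ
  -ᶜ-inverseˡ z = approx⇒≈ᶜ (λ i → ℚ.+-inverseˡ (approx (re z) i)) (λ i → ℚ.+-inverseˡ (approx (im z) i))

  *ᶜ-assoc : ∀ z w v → (z *ᶜ w) *ᶜ v ≈ᶜ z *ᶜ (w *ᶜ v)
  *ᶜ-assoc z w v = approx⇒≈ᶜ
    (λ i → solve 6 (λ a b c d e f → (a :* c :+ :- (b :* d)) :* e :+ :- ((a :* d :+ b :* c) :* f)
                                 := a :* (c :* e :+ :- (d :* f)) :+ :- (b :* (c :* f :+ d :* e))) refl
       (approx (re z) i) (approx (im z) i) (approx (re w) i) (approx (im w) i) (approx (re v) i) (approx (im v) i))
    (λ i → solve 6 (λ a b c d e f → (a :* c :+ :- (b :* d)) :* f :+ (a :* d :+ b :* c) :* e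
                                 := a :* (c :* f :+ d :* e) :+ b :* (c :* e :+ :- (d :* f))) refl
       (approx (re z) i) (approx (im z) i) (approx (re w) i) (approx (im w) i) (approx (re v) i) (approx (im v) i))
    where
    open ℚ-Solver.+-*-Solver

  *ᶜ-comm : ∀ z w → z *ᶜ w ≈ᶜ w *ᶜ z
  *ᶜ-comm z w = approx⇒≈ᶜ
    (λ i → solve 4 (λ a b c d → a :* c :+ :- (b :* d) := c :* a :+ :- (d :* b)) refl
       (approx (re z) i) (approx (im z) i) (approx (re w) i) (approx (im w) i))
    (λ i → solve 4 (λ a b c d → a :* d :+ b :* c := c :* b :+ d :* a) refl
       (approx (re z) i) (approx (im z) i) (approx (re w) i) (approx (im w) i))
    where
    open ℚ-Solver.+-*-Solver

  *ᶜ-identityˡ : ∀ z → 1ᶜ *ᶜ z ≈ᶜ z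
  *ᶜ-identityˡ z = approx⇒≈ᶜ
    (λ i → solve 2 (λ a b → con 1ℚ :* a :+ :- (con 0ℚ :* b) := a) refl (approx (re z) i) (approx (im z) i))
    (λ i → solve 2 (λ a b → con 1ℚ :* b :+ con 0ℚ :* a := b) refl (approx (re z) i) (approx (im z) i))
    where
    open ℚ-Solver.+-*-Solver

  *ᶜ-distribʳ : ∀ z w v → (w +ᶜ v) *ᶜ z ≈ᶜ w *ᶜ z +ᶜ v *ᶜ z
  *ᶜ-distribʳ z w v = approx⇒≈ᶜ
    (λ i → solve 6 (λ a b c d e f → (c :+ e) :* a :+ :- ((d :+ f) :* b) := (c :* a :+ :- (d :* b)) :+ (e :* a :+ :- (f :* b))) refl
       (approx (re z) i) (approx (im z) i) (approx (re w) i) (approx (im w) i) (approx (re v) i) (approx (im v) i))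
    (λ i → solve 6 (λ a b c d e f → (c :+ e) :* b :+ (d :+ f) :* a := (c :* b :+ d :* a) :+ (e :* b :+ f :* a)) refl
       (approx (re z) i) (approx (im z) i) (approx (re w) i) (approx (im w) i) (approx (re v) i) (approx (im v) i))
    where
    open ℚ-Solver.+-*-Solver

  fromℚᶜ-+ : ∀ p q → fromℚᶜ (p ℚ.+ q) ≈ᶜ fromℚᶜ p +ᶜ fromℚᶜ q
  fromℚᶜ-+ p q = approx⇒≈ᶜ (λ _ → refl) (λ _ → refl)

  fromℚᶜ-neg : ∀ p → fromℚᶜ (ℚ.- p) ≈ᶜ -ᶜ fromℚᶜ p
  fromℚᶜ-neg p = approx⇒≈ᶜ (λ _ → refl) (λ _ → refl)

  fromℝ-* : ∀ x y → fromℝ (x *ʳ y) ≈ᶜ fromℝ x *ᶜ fromℝ y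
  fromℝ-* x y = approx⇒≈ᶜ
    (λ i → solve 2 (λ a b → a :* b := a :* b :+ :- (con 0ℚ :* con 0ℚ)) refl (approx x i) (approx y i))
    (λ i → solve 2 (λ a b → con 0ℚ := a :* con 0ℚ :+ con 0ℚ :* b) refl (approx x i) (approx y i))
    where
    open ℚ-Solver.+-*-Solver

  *ʳ-fromℚ : ∀ p q → fromℚ (p ℚ.* q) ≃ fromℚ p *ʳ fromℚ q
  *ʳ-fromℚ p q = pointwise⇒≃ {fromℚ (p ℚ.* q)} {fromℚ p *ʳ fromℚ q} (λ _ → refl)

  conj-+ : ∀ z w → conj (z +ᶜ w) ≈ᶜ conj z +ᶜ conj w
  conj-+ z w = approx⇒≈ᶜ (λ _ → refl) (λ i → ℚ.neg-distrib-+ (approx (im z) i) (approx (im w) i))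

  conj-* : ∀ z w → conj (z *ᶜ w) ≈ᶜ conj z *ᶜ conj w
  conj-* z w = approx⇒≈ᶜ
    (λ i → solve 4 (λ a b c d → a :* c :+ :- (b :* d) := a :* c :+ :- ((:- b) :* (:- d))) refl
       (approx (re z) i) (approx (im z) i) (approx (re w) i) (approx (im w) i))
    (λ i → solve 4 (λ a b c d → :- (a :* d :+ b :* c) := a :* (:- d) :+ (:- b) :* c) refl
       (approx (re z) i) (approx (im z) i) (approx (re w) i) (approx (im w) i))
    where
    open ℚ-Solver.+-*-Solver

  conj-neg : ∀ z → conj (-ᶜ z) ≈ᶜ -ᶜ conj z
  conj-neg z = approx⇒≈ᶜ (λ _ → refl) (λ _ → refl)

  conj-involutive : ∀ z → conj (conj z) ≈ᶜ z
  conj-involutive z = approx⇒≈ᶜ (λ _ → refl) (λ i → solve 1 (λ b → :- (:- b) := b) refl (approx (im z) i))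
    where
    open ℚ-Solver.+-*-Solver

  conj-fromℝ : ∀ x → conj (fromℝ x) ≈ᶜ fromℝ x
  conj-fromℝ x = approx⇒≈ᶜ (λ _ → refl) (λ _ → refl)

  conj-𝕚 : conj 𝕚 ≈ᶜ -ᶜ 𝕚
  conj-𝕚 = approx⇒≈ᶜ (λ _ → refl) (λ _ → refl)

  𝕚*𝕚 : 𝕚 *ᶜ 𝕚 ≈ᶜ -ᶜ 1ᶜ
  𝕚*𝕚 = approx⇒≈ᶜ (λ _ → refl) (λ _ → refl)

  re+im : ∀ z → z ≈ᶜ fromℝ (re z) +ᶜ 𝕚 *ᶜ fromℝ (im z)
  re+im z = approx⇒≈ᶜ
    (λ i → solve 2 (λ a b → a := a :+ (con 0ℚ :* b :+ :- (con 1ℚ :* con 0ℚ))) refl (approx (re z) i) (approx (im z) i))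
    (λ i → solve 2 (λ a b → b := con 0ℚ :+ (con 0ℚ :* con 0ℚ :+ con 1ℚ :* b)) refl (approx (re z) i) (approx (im z) i))
    where
    open ℚ-Solver.+-*-Solver

  conj≃ : ∀ z → conj z ≈ᶜ fromℝ (re z) +ᶜ -ᶜ (𝕚 *ᶜ fromℝ (im z))
  conj≃ z = approx⇒≈ᶜ
    (λ i → solve 2 (λ a b → a := a :+ (:- (con 0ℚ :* b :+ :- (con 1ℚ :* con 0ℚ)))) refl (approx (re z) i) (approx (im z) i))
    (λ i → solve 2 (λ a b → :- b := con 0ℚ :+ (:- (con 0ℚ :* con 0ℚ :+ con 1ℚ :* b))) refl (approx (re z) i) (approx (im z) i))
    where
    open ℚ-Solver.+-*-Solver

ℂ-commutativeRing : CommutativeRing 0ℓ 0ℓ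
ℂ-commutativeRing = record
  { Carrier = ℂ ; _≈_ = _≈ᶜ_ ; _+_ = _+ᶜ_ ; _*_ = _*ᶜ_ ; -_ = -ᶜ_ ; 0# = 0ᶜ ; 1# = 1ᶜ
  ; isCommutativeRing = record
    { isRing = record
      { +-isAbelianGroup = record
        { isGroup = record
          { isMonoid = record
            { isSemigroup = record
              { isMagma = record
                { isEquivalence = record { refl = ≈ᶜ-refl ; sym = ≈ᶜ-sym ; trans = ≈ᶜ-trans }
                ; ∙-cong = +ᶜ-cong }
              ; assoc = +ᶜ-assoc }
            ; identity = +ᶜ-identityˡ , λ z → ≈ᶜ-trans (+ᶜ-comm z 0ᶜ) (+ᶜ-identityˡ z) }
          ; inverse = -ᶜ-inverseˡ , λ z → ≈ᶜ-trans (+ᶜ-comm z (-ᶜ z)) (-ᶜ-inverseˡ z)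
          ; ⁻¹-cong = -ᶜ-cong }
        ; comm = +ᶜ-comm }
      ; *-cong = *ᶜ-cong
      ; *-assoc = *ᶜ-assoc
      ; *-identity = *ᶜ-identityˡ , λ z → ≈ᶜ-trans (*ᶜ-comm z 1ᶜ) (*ᶜ-identityˡ z)
      ; distrib = (λ z w v → ≈ᶜ-trans (*ᶜ-comm z (w +ᶜ v)) (≈ᶜ-trans (*ᶜ-distribʳ z w v)
                    (+ᶜ-cong (*ᶜ-comm w z) (*ᶜ-comm v z)))) , *ᶜ-distribʳ }
    ; *-comm = *ᶜ-comm }
  }

module ℂᴿ = CommutativeRing ℂ-commutativeRing

-- Rational coefficients let the solver use constants such as ½, and only these coefficients have to
-- be compared for equality.
ℚ⟶ℂ : ℚ.+-*-rawRing -Raw-AlmostCommutative⟶ fromCommutativeRing ℂ-commutativeRing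
ℚ⟶ℂ = record
  { ⟦_⟧ = fromℚᶜ
  ; +-homo = fromℚᶜ-+
  ; *-homo = λ p q → ≈ᶜ-trans (mk≈ (*ʳ-fromℚ p q , ≃-refl {0ʳ})) (fromℝ-* (fromℚ p) (fromℚ q))
  ; -‿homo = fromℚᶜ-neg
  ; 0-homo = ≈ᶜ-refl
  ; 1-homo = ≈ᶜ-refl
  }

fromℚᶜ-≟ : ∀ p q → Maybe (fromℚᶜ p ≈ᶜ fromℚᶜ q)
fromℚᶜ-≟ p q with p ℚ.≟ q
... | yes refl = just ≈ᶜ-refl
... | no _     = nothing

module ℂ-Solver = RingSolver ℚ.+-*-rawRing (fromCommutativeRing ℂ-commutativeRing) ℚ⟶ℂ fromℚᶜ-≟

-- Norm bounds and limits

open Sum ℂᴿ.semiring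
  using (sum-cong-≋; ∑-comm; ∑-distrib-+; *-distribˡ-sum; *-distribʳ-sum; sum-permute; sum-replicate-zero)
open Exp ℂᴿ.semiring using (^-congˡ) renaming (_^_ to _^ˢ_)
open Mult ℂᴿ.semiring using () renaming (_×_ to _×ᶜ_)
open RawMonoidDefinitions ℕ.+-0-rawMonoid using () renaming (sum to sumℕ)
module ≈ᶜ-Reasoning = SetoidReasoning ℂᴿ.setoid

infix 4 ‖_‖≤_

-- A bound on approximations is not invariant under `_≈ᶜ_`, since equal numbers may have
-- approximations slightly above q. Passing to some representative restores invariance without
-- enlarging q. The sum of absolute values replaces the modulus: it needs no square root.
record ‖_‖≤_ (z : ℂ) (q : ℚ) : Set where
  constructor norm≤
  field
    {representative} : ℂ
    representative≈  : z ≈ᶜ representative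
    bound            : Eventually (λ i → ∣ approx (re representative) i ∣ ℚ.+ ∣ approx (im representative) i ∣ ℚ.≤ q)

‖‖≤-resp : ∀ {z w q} → z ≈ᶜ w → ‖ z ‖≤ q → ‖ w ‖≤ q
‖‖≤-resp z≈w (norm≤ z≈ b) = norm≤ (≈ᶜ-trans (≈ᶜ-sym z≈w) z≈) b

‖‖≤-mono : ∀ {z p q} → p ℚ.≤ q → ‖ z ‖≤ p → ‖ z ‖≤ q
‖‖≤-mono p≤q (norm≤ z≈ b) = norm≤ z≈ (ev-map (λ le → ℚ.≤-trans le p≤q) b)

l1-+ : ∀ {p q} a b c d → ∣ a ∣ ℚ.+ ∣ b ∣ ℚ.≤ p → ∣ c ∣ ℚ.+ ∣ d ∣ ℚ.≤ q →
       ∣ a ℚ.+ c ∣ ℚ.+ ∣ b ℚ.+ d ∣ ℚ.≤ p ℚ.+ q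
l1-+ {p} {q} a b c d u v = begin
  ∣ a ℚ.+ c ∣ ℚ.+ ∣ b ℚ.+ d ∣                     ≤⟨ ℚ.+-mono-≤ (ℚ.∣p+q∣≤∣p∣+∣q∣ a c) (ℚ.∣p+q∣≤∣p∣+∣q∣ b d) ⟩
  (∣ a ∣ ℚ.+ ∣ c ∣) ℚ.+ (∣ b ∣ ℚ.+ ∣ d ∣)         ≡⟨ solve 4 (λ a b c d → (a :+ c) :+ (b :+ d) := (a :+ b) :+ (c :+ d)) refl (∣ a ∣) (∣ b ∣) (∣ c ∣) (∣ d ∣) ⟩
  (∣ a ∣ ℚ.+ ∣ b ∣) ℚ.+ (∣ c ∣ ℚ.+ ∣ d ∣)         ≤⟨ ℚ.+-mono-≤ u v ⟩
  p ℚ.+ q                                         ∎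
  where
  open ℚ.≤-Reasoning
  open ℚ-Solver.+-*-Solver

-- The four products that bound the two parts are exactly the expansion of (|a| + |b|)(|c| + |d|),
-- so this norm is submultiplicative with constant 1.
l1-* : ∀ {p q} a b c d → ∣ a ∣ ℚ.+ ∣ b ∣ ℚ.≤ p → ∣ c ∣ ℚ.+ ∣ d ∣ ℚ.≤ q →
       ∣ a ℚ.* c ℚ.+ ℚ.- (b ℚ.* d) ∣ ℚ.+ ∣ a ℚ.* d ℚ.+ b ℚ.* c ∣ ℚ.≤ p ℚ.* q
l1-* {p} {q} a b c d u v = begin
  ∣ a ℚ.* c ℚ.+ ℚ.- (b ℚ.* d) ∣ ℚ.+ ∣ a ℚ.* d ℚ.+ b ℚ.* c ∣
    ≤⟨ ℚ.+-mono-≤ (ℚ.∣p+q∣≤∣p∣+∣q∣ (a ℚ.* c) (ℚ.- (b ℚ.* d))) (ℚ.∣p+q∣≤∣p∣+∣q∣ (a ℚ.* d) (b ℚ.* c)) ⟩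
  (∣ a ℚ.* c ∣ ℚ.+ ∣ ℚ.- (b ℚ.* d) ∣) ℚ.+ (∣ a ℚ.* d ∣ ℚ.+ ∣ b ℚ.* c ∣)
    ≡⟨ cong₂ ℚ._+_ (cong₂ ℚ._+_ (ℚ.∣p*q∣≡∣p∣*∣q∣ a c) (trans (ℚ.∣-p∣≡∣p∣ (b ℚ.* d)) (ℚ.∣p*q∣≡∣p∣*∣q∣ b d)))
                   (cong₂ ℚ._+_ (ℚ.∣p*q∣≡∣p∣*∣q∣ a d) (ℚ.∣p*q∣≡∣p∣*∣q∣ b c)) ⟩
  (∣ a ∣ ℚ.* ∣ c ∣ ℚ.+ ∣ b ∣ ℚ.* ∣ d ∣) ℚ.+ (∣ a ∣ ℚ.* ∣ d ∣ ℚ.+ ∣ b ∣ ℚ.* ∣ c ∣)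
    ≡⟨ solve 4 (λ a b c d → (a :* c :+ b :* d) :+ (a :* d :+ b :* c) := (a :+ b) :* (c :+ d)) refl (∣ a ∣) (∣ b ∣) (∣ c ∣) (∣ d ∣) ⟩
  (∣ a ∣ ℚ.+ ∣ b ∣) ℚ.* (∣ c ∣ ℚ.+ ∣ d ∣)
    ≤⟨ ℚ.*-monoˡ-≤-nonNeg (∣ a ∣ ℚ.+ ∣ b ∣) {{ℚ.nonNegative (0≤l1 a b)}} v ⟩
  (∣ a ∣ ℚ.+ ∣ b ∣) ℚ.* q
    ≤⟨ ℚ.*-monoʳ-≤-nonNeg q {{ℚ.nonNegative (ℚ.≤-trans (0≤l1 c d) v)}} u ⟩
  p ℚ.* q ∎
  where
  open ℚ.≤-Reasoning
  open ℚ-Solver.+-*-Solver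
  0≤l1 : ∀ a b → 0ℚ ℚ.≤ ∣ a ∣ ℚ.+ ∣ b ∣
  0≤l1 a b = subst (ℚ._≤ ∣ a ∣ ℚ.+ ∣ b ∣) (ℚ.+-identityʳ 0ℚ) (ℚ.+-mono-≤ (ℚ.0≤∣p∣ a) (ℚ.0≤∣p∣ b))

opaque
  unfolding _+ʳ_ _+ᶜ_

  ‖‖≤-+ : ∀ {z w p q} → ‖ z ‖≤ p → ‖ w ‖≤ q → ‖ z +ᶜ w ‖≤ p ℚ.+ q
  ‖‖≤-+ (norm≤ {z} z≈ u) (norm≤ {w} w≈ v) = norm≤ (+ᶜ-cong z≈ w≈) (ev-zip
    (λ {i} → l1-+ (approx (re z) i) (approx (im z) i) (approx (re w) i) (approx (im w) i)) u v)

  ‖‖≤-* : ∀ {z w p q} → ‖ z ‖≤ p → ‖ w ‖≤ q → ‖ z *ᶜ w ‖≤ p ℚ.* q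
  ‖‖≤-* (norm≤ {z} z≈ u) (norm≤ {w} w≈ v) = norm≤ (*ᶜ-cong z≈ w≈) (ev-zip
    (λ {i} → l1-* (approx (re z) i) (approx (im z) i) (approx (re w) i) (approx (im w) i)) u v)

  ‖‖≤-conj : ∀ {z q} → ‖ z ‖≤ q → ‖ conj z ‖≤ q
  ‖‖≤-conj {q = q} (norm≤ {z} z≈ u) = norm≤ (conj-cong z≈) (ev-map
    (λ {i} → subst (λ x → ∣ approx (re z) i ∣ ℚ.+ x ℚ.≤ q) (sym (ℚ.∣-p∣≡∣p∣ (approx (im z) i)))) u)

  ‖‖≤-neg : ∀ {z q} → ‖ z ‖≤ q → ‖ -ᶜ z ‖≤ q
  ‖‖≤-neg {q = q} (norm≤ {z} z≈ u) = norm≤ (-ᶜ-cong z≈) (ev-map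
    (λ {i} → subst (ℚ._≤ q) (cong₂ ℚ._+_ (sym (ℚ.∣-p∣≡∣p∣ (approx (re z) i))) (sym (ℚ.∣-p∣≡∣p∣ (approx (im z) i))))) u)

  ‖fromℚᶜ‖≤ : ∀ {q} → 0ℚ ℚ.≤ q → ‖ fromℚᶜ q ‖≤ q
  ‖fromℚᶜ‖≤ {q} 0≤q = norm≤ ≈ᶜ-refl (0 , λ _ _ → ℚ.≤-reflexive (trans (ℚ.+-identityʳ ∣ q ∣) (ℚ.0≤p⇒∣p∣≡p 0≤q)))

  ‖‖≤-exists : ∀ z → ∃[ b ] (‖ z ‖≤ ι b)
  ‖‖≤-exists z with b , p , q ← boundedᶜ z = b ℕ.+ b , norm≤ {representative = z} ≈ᶜ-refl (ev-zip
    (λ {i} u v → subst (∣ approx (re z) i ∣ ℚ.+ ∣ approx (im z) i ∣ ℚ.≤_) (ι-+ b b) (ℚ.+-mono-≤ u v)) p q)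

  Close⇒‖‖≤ : ∀ {z w ε} → Close ε (re z) (re w) → Close ε (im z) (im w) → ‖ z +ᶜ -ᶜ w ‖≤ ε ℚ.+ ε
  Close⇒‖‖≤ {z} {w} p q = norm≤ {representative = z +ᶜ -ᶜ w} ≈ᶜ-refl (ev-zip (λ u v → ℚ.+-mono-≤ u v) p q)

  ‖‖≤⇒≈0 : ∀ {z} → (∀ ε .{{_ : Positive ε}} → ‖ z ‖≤ ε) → z ≈ᶜ 0ᶜ
  ‖‖≤⇒≈0 {z} small = mk≈ (re≃0 , im≃0)
    where
    step : ∀ ε x y c → ∣ x ℚ.- y ∣ ℚ.≤ ½· ε → ∣ y ∣ ℚ.+ ∣ c ∣ ℚ.≤ ½· ε → ∣ x ℚ.- 0ℚ ∣ ℚ.≤ ε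
    step ε x y c p q = subst (∣ x ℚ.- 0ℚ ∣ ℚ.≤_) (½·+½· ε) (triangle x y 0ℚ p (begin
      ∣ y ℚ.- 0ℚ ∣       ≡⟨ cong ∣_∣ (ℚ.+-identityʳ y) ⟩
      ∣ y ∣              ≡⟨ ℚ.+-identityʳ ∣ y ∣ ⟨
      ∣ y ∣ ℚ.+ 0ℚ       ≤⟨ ℚ.+-monoʳ-≤ ∣ y ∣ (ℚ.0≤∣p∣ c) ⟩
      ∣ y ∣ ℚ.+ ∣ c ∣    ≤⟨ q ⟩
      ½· ε               ∎))
      where
      open ℚ.≤-Reasoning
    re≃0 : re z ≃ 0ʳ
    -- One half of ε pays for the distance to the representative, the other for the bound on the
    -- representative.
    re≃0 ε with norm≤ {w} (mk≈ (p , q)) u ← small (½· ε) {{½·-positive ε}} = ev-zip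
      (λ {i} a b → step ε (approx (re z) i) (approx (re w) i) (approx (im w) i) a b)
      (p (½· ε) {{½·-positive ε}}) u
    im≃0 : im z ≃ 0ʳ
    im≃0 ε with norm≤ {w} (mk≈ (p , q)) u ← small (½· ε) {{½·-positive ε}} = ev-zip
      (λ {i} a b → step ε (approx (im z) i) (approx (im w) i) (approx (re w) i) a
        (subst (ℚ._≤ ½· ε) (ℚ.+-comm ∣ approx (re w) i ∣ ∣ approx (im w) i ∣) b))
      (q (½· ε) {{½·-positive ε}}) u

‖0‖≤ : ∀ {q} → 0ℚ ℚ.≤ q → ‖ 0ᶜ ‖≤ q
‖0‖≤ 0≤q = ‖‖≤-mono 0≤q (‖fromℚᶜ‖≤ ℚ.≤-refl)

½·≤ : ∀ ε .{{_ : Positive ε}} → ½· ε ℚ.≤ ε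
½·≤ ε = begin
  ½· ε             ≡⟨ ℚ.+-identityʳ (½· ε) ⟨
  ½· ε ℚ.+ 0ℚ      ≤⟨ ℚ.+-monoʳ-≤ (½· ε) (0≤pos (½· ε) {{½·-positive ε}}) ⟩
  ½· ε ℚ.+ ½· ε    ≡⟨ ½·+½· ε ⟩
  ε                ∎
  where
  open ℚ.≤-Reasoning

-≈0⇒≈ : ∀ {z w} → z +ᶜ -ᶜ w ≈ᶜ 0ᶜ → z ≈ᶜ w
-≈0⇒≈ {z} {w} p = begin
  z                     ≈⟨ solve 2 (λ z w → z := (z :+ :- w) :+ w) ≈ᶜ-refl z w ⟩
  (z +ᶜ -ᶜ w) +ᶜ w      ≈⟨ +ᶜ-cong p ≈ᶜ-refl ⟩
  0ᶜ +ᶜ w               ≈⟨ +ᶜ-identityˡ w ⟩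
  w                     ∎
  where
  open ≈ᶜ-Reasoning
  open ℂ-Solver

infix 4 _⟶ᶜ_

_⟶ᶜ_ : (ℕ → ℂ) → ℂ → Set
s ⟶ᶜ z = ∀ ε .{{_ : Positive ε}} → ∃[ N ] (∀ n → N ℕ.≤ n → ‖ s n +ᶜ -ᶜ z ‖≤ ε)

⟶ᶜ-const : ∀ z → (λ _ → z) ⟶ᶜ z
⟶ᶜ-const z ε = 0 , λ _ _ → ‖‖≤-resp (≈ᶜ-sym (ℂᴿ.-‿inverseʳ z)) (‖0‖≤ (0≤pos ε))

⟶ᶜ-cong : ∀ {s t z} → (∀ n → s n ≈ᶜ t n) → s ⟶ᶜ z → t ⟶ᶜ z
⟶ᶜ-cong s≈t s⟶z ε with N , p ← s⟶z ε = N , λ n N≤n → ‖‖≤-resp (+ᶜ-cong (s≈t n) ≈ᶜ-refl) (p n N≤n)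

⟶ᶜ-+ : ∀ {s t z w} → s ⟶ᶜ z → t ⟶ᶜ w → (λ n → s n +ᶜ t n) ⟶ᶜ z +ᶜ w
⟶ᶜ-+ {s} {t} {z} {w} s⟶z t⟶w ε
  with M , p ← s⟶z (½· ε) {{½·-positive ε}} | N , q ← t⟶w (½· ε) {{½·-positive ε}} = M ℕ.⊔ N , λ n n≥ →
    subst (‖ (s n +ᶜ t n) +ᶜ -ᶜ (z +ᶜ w) ‖≤_) (½·+½· ε) (‖‖≤-resp
      (solve 4 (λ s t z w → (s :+ :- z) :+ (t :+ :- w) := (s :+ t) :+ :- (z :+ w)) ≈ᶜ-refl (s n) (t n) z w)
      (‖‖≤-+ (p n (⊔ˡ M N n≥)) (q n (⊔ʳ M N n≥))))
  where
  open ℂ-Solver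

⟶ᶜ-conj : ∀ {s z} → s ⟶ᶜ z → (λ n → conj (s n)) ⟶ᶜ conj z
⟶ᶜ-conj {s} {z} s⟶z ε with N , p ← s⟶z ε = N , λ n N≤n → ‖‖≤-resp
  (≈ᶜ-trans (conj-+ (s n) (-ᶜ z)) (+ᶜ-cong ≈ᶜ-refl (conj-neg z))) (‖‖≤-conj (p n N≤n))

⟶ᶜ-* : ∀ {s t z w} → s ⟶ᶜ z → t ⟶ᶜ w → (λ n → s n *ᶜ t n) ⟶ᶜ z *ᶜ w
⟶ᶜ-* {s} {t} {z} {w} s⟶z t⟶w ε
  with b , ‖z‖≤ ← ‖‖≤-exists z | c , ‖w‖≤ ← ‖‖≤-exists w
  -- The error is (s - z)(t - w) + z(t - w) + (s - z)w. With |t - w| bounded by 1 in the first term,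
  -- the three terms cost δ · 1, b · δ and δ · c.
  with δ , δ>0 , δ≤ ← scaled ε (1 ℕ.+ b ℕ.+ c)
  with L , o ← t⟶w 1ℚ | M , p ← s⟶z δ {{δ>0}} | N , q ← t⟶w δ {{δ>0}} = L ℕ.⊔ (M ℕ.⊔ N) , λ n n≥ →
    let s-z = p n (⊔ˡ M N (⊔ʳ L _ n≥)); t-w = q n (⊔ʳ M N (⊔ʳ L _ n≥)) in
    ‖‖≤-mono arith (‖‖≤-resp
      (solve 4 (λ s t z w → ((s :+ :- z) :* (t :+ :- w) :+ z :* (t :+ :- w)) :+ (s :+ :- z) :* w
                          := s :* t :+ :- (z :* w)) ≈ᶜ-refl (s n) (t n) z w)
      (‖‖≤-+ (‖‖≤-+ (‖‖≤-* s-z (o n (⊔ˡ L _ n≥))) (‖‖≤-* ‖z‖≤ t-w)) (‖‖≤-* s-z ‖w‖≤)))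
  where
  open ℂ-Solver
  arith : δ ℚ.* 1ℚ ℚ.+ ι b ℚ.* δ ℚ.+ δ ℚ.* ι c ℚ.≤ ε
  arith = begin
    δ ℚ.* 1ℚ ℚ.+ ι b ℚ.* δ ℚ.+ δ ℚ.* ι c   ≡⟨ cong (λ x → δ ℚ.* 1ℚ ℚ.+ x ℚ.+ δ ℚ.* ι c) (ℚ.*-comm (ι b) δ) ⟩
    δ ℚ.* 1ℚ ℚ.+ δ ℚ.* ι b ℚ.+ δ ℚ.* ι c   ≡⟨ cong (ℚ._+ δ ℚ.* ι c) (ℚ.*-distribˡ-+ δ 1ℚ (ι b)) ⟨
    δ ℚ.* (1ℚ ℚ.+ ι b) ℚ.+ δ ℚ.* ι c       ≡⟨ ℚ.*-distribˡ-+ δ (1ℚ ℚ.+ ι b) (ι c) ⟨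
    δ ℚ.* (1ℚ ℚ.+ ι b ℚ.+ ι c)             ≡⟨ cong (λ x → δ ℚ.* (x ℚ.+ ι b ℚ.+ ι c)) ι1≡1 ⟨
    δ ℚ.* (ι 1 ℚ.+ ι b ℚ.+ ι c)            ≡⟨ cong (λ x → δ ℚ.* (x ℚ.+ ι c)) (ι-+ 1 b) ⟩
    δ ℚ.* (ι (1 ℕ.+ b) ℚ.+ ι c)            ≡⟨ cong (δ ℚ.*_) (ι-+ (1 ℕ.+ b) c) ⟩
    δ ℚ.* ι (1 ℕ.+ b ℕ.+ c)                ≤⟨ δ≤ ⟩
    ½· ε                                   ≤⟨ ½·≤ ε ⟩
    ε                                      ∎
    where
    open ℚ.≤-Reasoning

⟶ᶜ-unique : ∀ {s z w} → s ⟶ᶜ z → s ⟶ᶜ w → z ≈ᶜ w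
⟶ᶜ-unique {s} {z} {w} s⟶z s⟶w = -≈0⇒≈ (‖‖≤⇒≈0 small)
  where
  open ℂ-Solver
  small : ∀ ε .{{_ : Positive ε}} → ‖ z +ᶜ -ᶜ w ‖≤ ε
  small ε with M , p ← s⟶z (½· ε) {{½·-positive ε}} | N , q ← s⟶w (½· ε) {{½·-positive ε}} =
    let n = M ℕ.⊔ N in
    subst (‖ z +ᶜ -ᶜ w ‖≤_) (½·+½· ε) (‖‖≤-resp
      (solve 3 (λ s z w → :- (s :+ :- z) :+ (s :+ :- w) := z :+ :- w) ≈ᶜ-refl (s n) z w)
      (‖‖≤-+ (‖‖≤-neg (p n (⊔ˡ M N ℕ.≤-refl))) (q n (⊔ʳ M N ℕ.≤-refl))))

⟶ᶜ-∑ : ∀ n (s : ℕ → Fin n → ℂ) (z : Fin n → ℂ) → (∀ i → (λ k → s k i) ⟶ᶜ z i) → (λ k → ∑ (s k)) ⟶ᶜ ∑ z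
⟶ᶜ-∑ zero    s z s⟶z = ⟶ᶜ-const 0ᶜ
⟶ᶜ-∑ (suc n) s z s⟶z = ⟶ᶜ-+ (s⟶z zero) (⟶ᶜ-∑ n (λ k i → s k (suc i)) (λ i → z (suc i)) (λ i → s⟶z (suc i)))

-- The Cauchy product and the exponential

∑< : ℕ → (ℕ → ℂ) → ℂ
∑< n f = ∑ {n} (λ i → f (toℕ i))

∑<-cong : ∀ n {f g : ℕ → ℂ} → (∀ k → f k ≈ᶜ g k) → ∑< n f ≈ᶜ ∑< n g
∑<-cong n f≈g = sum-cong-≋ {n} (λ i → f≈g (toℕ i))

∑<-+ : ∀ m n f → ∑< (m ℕ.+ n) f ≈ᶜ ∑< m f +ᶜ ∑< n (λ k → f (m ℕ.+ k))
∑<-+ zero    n f = ≈ᶜ-sym (+ᶜ-identityˡ (∑< n f))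
∑<-+ (suc m) n f = ≈ᶜ-trans (+ᶜ-cong ≈ᶜ-refl (∑<-+ m n (λ k → f (suc k)))) (≈ᶜ-sym (+ᶜ-assoc _ _ _))

∑<-suc : ∀ n f → ∑< (suc n) f ≈ᶜ ∑< n f +ᶜ f n
∑<-suc zero    f = +ᶜ-comm (f 0) 0ᶜ
∑<-suc (suc n) f = ≈ᶜ-trans (+ᶜ-cong ≈ᶜ-refl (∑<-suc n (λ k → f (suc k)))) (≈ᶜ-sym (+ᶜ-assoc _ _ _))

opaque
  unfolding ι

  ι0≡0 : ι 0 ≡ 0ℚ
  ι0≡0 = refl

ι-suc-* : ∀ n q → ι (suc n) ℚ.* q ≡ q ℚ.+ ι n ℚ.* q
ι-suc-* n q = begin
  ι (suc n) ℚ.* q              ≡⟨ cong (ℚ._* q) (ι-+ 1 n) ⟨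
  (ι 1 ℚ.+ ι n) ℚ.* q          ≡⟨ ℚ.*-distribʳ-+ q (ι 1) (ι n) ⟩
  ι 1 ℚ.* q ℚ.+ ι n ℚ.* q      ≡⟨ cong (λ x → x ℚ.* q ℚ.+ ι n ℚ.* q) ι1≡1 ⟩
  1ℚ ℚ.* q ℚ.+ ι n ℚ.* q       ≡⟨ cong (ℚ._+ ι n ℚ.* q) (ℚ.*-identityˡ q) ⟩
  q ℚ.+ ι n ℚ.* q              ∎
  where
  open ≡.≡-Reasoning

‖∑<‖≤ : ∀ n {q} f → (∀ k → ‖ f k ‖≤ q) → ‖ ∑< n f ‖≤ ι n ℚ.* q
‖∑<‖≤ zero    {q} f p = subst (‖ 0ᶜ ‖≤_) (sym (trans (cong (ℚ._* q) ι0≡0) (ℚ.*-zeroˡ q))) (‖0‖≤ ℚ.≤-refl)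
‖∑<‖≤ (suc n) {q} f p = subst (‖ ∑< (suc n) f ‖≤_) (sym (ι-suc-* n q))
  (‖‖≤-+ (p 0) (‖∑<‖≤ n (λ k → f (suc k)) (λ k → p (suc k))))

opaque
  unfolding ½·_

  ½^-+ : ∀ m n → ½^ (m ℕ.+ n) ≡ ½^ m ℚ.* ½^ n
  ½^-+ zero    n = sym (ℚ.*-identityˡ (½^ n))
  ½^-+ (suc m) n = trans (cong (½ ℚ.*_) (½^-+ m n)) (sym (ℚ.*-assoc ½ (½^ m) (½^ n)))

expTerm : ℂ → ℕ → ℂ
expTerm z k = fromℚᶜ (k !⁻¹) *ᶜ z ^ᶜ k

‖^‖≤ : ∀ {z b} → ‖ z ‖≤ ι b → ∀ k → ‖ z ^ᶜ k ‖≤ ι (b ℕ.^ k)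
‖^‖≤ {z} {b} ‖z‖≤ zero    = subst (‖ 1ᶜ ‖≤_) (sym ι1≡1) (‖fromℚᶜ‖≤ (0≤pos 1ℚ))
‖^‖≤ {z} {b} ‖z‖≤ (suc k) = subst (‖ z ^ᶜ suc k ‖≤_) (ι-* b (b ℕ.^ k)) (‖‖≤-* ‖z‖≤ (‖^‖≤ ‖z‖≤ k))

-- The factor 8⁻ᵏ is small enough to absorb the at most n² terms of index sum at least n in the
-- product of two partial sums of length n.
‖expTerm‖≤ : ∀ z → ∃[ c ] (∀ k → ‖ expTerm z k ‖≤ ι c ℚ.* ½^ (3 ℕ.* k))
‖expTerm‖≤ z with b , ‖z‖≤ ← ‖‖≤-exists z = (b ℕ.* 8) ℕ.^ (b ℕ.* 8) , λ k → ‖‖≤-mono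
  (term-arith (k !⁻¹) (ι (b ℕ.^ k)) (ι (8 ℕ.^ k)) (½^ (3 ℕ.* k)) (ι ((b ℕ.* 8) ℕ.^ (b ℕ.* 8))) (ι (k !))
    (trans (cong (λ n → ι n ℚ.* ½^ (3 ℕ.* k)) (ℕ.^-*-assoc 2 3 k)) (2^*½^ (3 ℕ.* k)))
    (/*ι (k !) {{k ℕ.!≢0}}) (0≤!⁻¹ k) (0≤½^ (3 ℕ.* k))
    (subst₂ ℚ._≤_ (trans (cong ι (^-distrib-* b 8 k)) (sym (ι-* (b ℕ.^ k) (8 ℕ.^ k))))
                  (sym (ι-* ((b ℕ.* 8) ℕ.^ (b ℕ.* 8)) (k !)))
                  (ι-mono (power≤factorial (b ℕ.* 8) k))))
  (‖‖≤-* (‖fromℚᶜ‖≤ (0≤!⁻¹ k)) (‖^‖≤ ‖z‖≤ k))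

-- The sum of a i b j over i + j < n, arranged by rows: row 0 has n entries, and the later rows form
-- the triangle of size n - 1 for the shifted sequence.
triangularSum : ℕ → (ℕ → ℂ) → (ℕ → ℂ) → ℂ
triangularSum zero    a b = 0ᶜ
triangularSum (suc n) a b = a 0 *ᶜ ∑< (suc n) b +ᶜ triangularSum n (λ k → a (suc k)) b

convolution : (ℕ → ℂ) → (ℕ → ℂ) → ℕ → ℂ
convolution a b n = ∑< (suc n) (λ k → a k *ᶜ b (n ∸ k))

-- The triangle grows by the antidiagonal i + j = n, which is the nth term of the Cauchy product.
triangularSum-suc : ∀ n a b → triangularSum (suc n) a b ≈ᶜ triangularSum n a b +ᶜ convolution a b n
triangularSum-suc zero    a b = solve 2 (λ a b → a :* (b :+ con 0ℚ) :+ con 0ℚ := con 0ℚ :+ (a :* b :+ con 0ℚ)) ≈ᶜ-refl (a 0) (b 0)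
  where
  open ℂ-Solver
triangularSum-suc (suc n) a b = begin
  a 0 *ᶜ ∑< (suc (suc n)) b +ᶜ triangularSum (suc n) a′ b
    ≈⟨ +ᶜ-cong (*ᶜ-cong ≈ᶜ-refl (∑<-suc (suc n) b)) (triangularSum-suc n a′ b) ⟩
  a 0 *ᶜ (∑< (suc n) b +ᶜ b (suc n)) +ᶜ (triangularSum n a′ b +ᶜ convolution a′ b n)
    ≈⟨ solve 5 (λ a s b t c → a :* (s :+ b) :+ (t :+ c) := (a :* s :+ t) :+ (a :* b :+ c)) ≈ᶜ-refl
         (a 0) (∑< (suc n) b) (b (suc n)) (triangularSum n a′ b) (convolution a′ b n) ⟩
  triangularSum (suc n) a b +ᶜ convolution a b (suc n) ∎
  where
  open ≈ᶜ-Reasoning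
  open ℂ-Solver
  a′ : ℕ → ℂ
  a′ k = a (suc k)

∑<-convolution : ∀ n a b → ∑< n (convolution a b) ≈ᶜ triangularSum n a b
∑<-convolution zero    a b = ≈ᶜ-refl
∑<-convolution (suc n) a b = ≈ᶜ-trans (∑<-suc n (convolution a b))
  (≈ᶜ-trans (+ᶜ-cong (∑<-convolution n a b) ≈ᶜ-refl) (≈ᶜ-sym (triangularSum-suc n a b)))

antitone-≤ : ∀ {h : ℕ → ℚ} → (∀ m → h (suc m) ℚ.≤ h m) → ∀ m k → h (m ℕ.+ k) ℚ.≤ h m
antitone-≤ {h} anti m zero    = ℚ.≤-reflexive (cong h (ℕ.+-identityʳ m))
antitone-≤ {h} anti m (suc k) = ℚ.≤-trans (ℚ.≤-reflexive (cong h (ℕ.+-suc m k))) (ℚ.≤-trans (anti (m ℕ.+ k)) (antitone-≤ anti m k))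

-- Removing a row from a square leaves a rectangle, so the induction is over n rows of fixed length
-- N. The row removed from n rows lacks its last k entries in the triangle; their index sums are at
-- least n, so each is at most h n, and k ≤ N. The remaining rows use the shifted h, whose value at
-- n - 1 is again h n.
square-triangle : ∀ n k N → n ℕ.+ k ≡ N → ∀ a b (h : ℕ → ℚ) → (∀ m → 0ℚ ℚ.≤ h m) → (∀ m → h (suc m) ℚ.≤ h m) →
  (∀ i j → ‖ a i *ᶜ b j ‖≤ h (i ℕ.+ j)) →
  ‖ ∑< n a *ᶜ ∑< N b +ᶜ -ᶜ triangularSum n a b ‖≤ ι n ℚ.* (ι N ℚ.* h n)
square-triangle zero k N _ a b h 0≤h anti ab≤ =
  subst (‖ 0ᶜ *ᶜ ∑< N b +ᶜ -ᶜ 0ᶜ ‖≤_) (sym (trans (cong (ℚ._* (ι N ℚ.* h 0)) ι0≡0) (ℚ.*-zeroˡ (ι N ℚ.* h 0))))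
    (‖‖≤-resp (solve 1 (λ b → con 0ℚ := con 0ℚ :* b :+ :- con 0ℚ) ≈ᶜ-refl (∑< N b)) (‖0‖≤ ℚ.≤-refl))
  where
  open ℂ-Solver
square-triangle (suc n) k N refl a b h 0≤h anti ab≤ =
  subst (‖ ∑< (suc n) a *ᶜ ∑< N b +ᶜ -ᶜ triangularSum (suc n) a b ‖≤_) (sym (ι-suc-* n (ι N ℚ.* h (suc n))))
    (‖‖≤-resp rearranged (‖‖≤-+
      (‖‖≤-mono (ℚ.*-monoʳ-≤-nonNeg (h (suc n)) {{ℚ.nonNegative (0≤h (suc n))}} (ι-mono (ℕ.m≤n+m k (suc n))))
        (‖∑<‖≤ k (λ j → a 0 *ᶜ b (suc n ℕ.+ j)) (λ j → ‖‖≤-mono (antitone-≤ anti (suc n) j) (ab≤ 0 (suc n ℕ.+ j)))))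
      (square-triangle n (suc k) N (ℕ.+-suc n k) a′ b (λ m → h (suc m)) (λ m → 0≤h (suc m)) (λ m → anti (suc m))
        (λ i j → ab≤ (suc i) j))))
  where
  open ≈ᶜ-Reasoning
  open ℂ-Solver
  a′ : ℕ → ℂ
  a′ k = a (suc k)
  tail : ℕ → ℂ
  tail j = b (suc n ℕ.+ j)
  rearranged : ∑< k (λ j → a 0 *ᶜ tail j) +ᶜ (∑< n a′ *ᶜ ∑< N b +ᶜ -ᶜ triangularSum n a′ b)
               ≈ᶜ ∑< (suc n) a *ᶜ ∑< N b +ᶜ -ᶜ triangularSum (suc n) a b
  rearranged = begin
    ∑< k (λ j → a 0 *ᶜ tail j) +ᶜ (∑< n a′ *ᶜ ∑< N b +ᶜ -ᶜ triangularSum n a′ b)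
      ≈⟨ +ᶜ-cong (≈ᶜ-sym (*-distribˡ-sum {k} (a 0) (λ j → tail (toℕ j)))) (+ᶜ-cong (*ᶜ-cong ≈ᶜ-refl (∑<-+ (suc n) k b)) ≈ᶜ-refl) ⟩
    a 0 *ᶜ ∑< k tail +ᶜ (∑< n a′ *ᶜ (∑< (suc n) b +ᶜ ∑< k tail) +ᶜ -ᶜ triangularSum n a′ b)
      ≈⟨ solve 5 (λ a t s b c → a :* t :+ (s :* (b :+ t) :+ :- c) := (a :+ s) :* (b :+ t) :+ :- (a :* b :+ c)) ≈ᶜ-refl
           (a 0) (∑< k tail) (∑< n a′) (∑< (suc n) b) (triangularSum n a′ b) ⟩
    (a 0 +ᶜ ∑< n a′) *ᶜ (∑< (suc n) b +ᶜ ∑< k tail) +ᶜ -ᶜ (a 0 *ᶜ ∑< (suc n) b +ᶜ triangularSum n a′ b)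
      ≈⟨ +ᶜ-cong (*ᶜ-cong ≈ᶜ-refl (≈ᶜ-sym (∑<-+ (suc n) k b))) ≈ᶜ-refl ⟩
    ∑< (suc n) a *ᶜ ∑< N b +ᶜ -ᶜ triangularSum (suc n) a b ∎

-- The two powers differ in the equality of the raw semiring they are built from.
^ᶜ≡^ˢ : ∀ z n → z ^ᶜ n ≡ z ^ˢ n
^ᶜ≡^ˢ z zero    = refl
^ᶜ≡^ˢ z (suc n) = cong (z *ᶜ_) (^ᶜ≡^ˢ z n)

^ᶜ-cong : ∀ n {z w} → z ≈ᶜ w → z ^ᶜ n ≈ᶜ w ^ᶜ n
^ᶜ-cong n {z} {w} z≈w = subst₂ _≈ᶜ_ (sym (^ᶜ≡^ˢ z n)) (sym (^ᶜ≡^ˢ w n)) (^-congˡ n z≈w)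

×ᶜ≈* : ∀ n z → n ×ᶜ z ≈ᶜ fromℚᶜ (ι n) *ᶜ z
×ᶜ≈* zero    z = ≈ᶜ-trans (≈ᶜ-sym (ℂᴿ.zeroˡ z)) (*ᶜ-cong (subst (λ q → 0ᶜ ≈ᶜ fromℚᶜ q) (sym ι0≡0) ≈ᶜ-refl) ≈ᶜ-refl)
×ᶜ≈* (suc n) z = begin
  z +ᶜ n ×ᶜ z                        ≈⟨ +ᶜ-cong ≈ᶜ-refl (×ᶜ≈* n z) ⟩
  z +ᶜ fromℚᶜ (ι n) *ᶜ z             ≈⟨ solve 2 (λ z n → z :+ n :* z := (con 1ℚ :+ n) :* z) ≈ᶜ-refl z (fromℚᶜ (ι n)) ⟩
  (fromℚᶜ 1ℚ +ᶜ fromℚᶜ (ι n)) *ᶜ z   ≈⟨ *ᶜ-cong (fromℚᶜ-+ 1ℚ (ι n)) ≈ᶜ-refl ⟨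
  fromℚᶜ (1ℚ ℚ.+ ι n) *ᶜ z           ≡⟨ cong (λ q → fromℚᶜ q *ᶜ z) (trans (cong (ℚ._+ ι n) (sym ι1≡1)) (ι-+ 1 n)) ⟩
  fromℚᶜ (ι (suc n)) *ᶜ z            ∎
  where
  open ≈ᶜ-Reasoning
  open ℂ-Solver

fromℚᶜ-* : ∀ p q → fromℚᶜ (p ℚ.* q) ≈ᶜ fromℚᶜ p *ᶜ fromℚᶜ q
fromℚᶜ-* p q = ≈ᶜ-trans (mk≈ (*ʳ-fromℚ p q , ≃-refl {0ʳ})) (fromℝ-* (fromℚ p) (fromℚ q))

-- Reciprocals enter only through equations of the form a · A = 1, so three of these together with C
-- · (A · B) = F replace division.
!⁻¹-binomial : ∀ n k → k ℕ.≤ n → k !⁻¹ ℚ.* (n ∸ k) !⁻¹ ≡ n !⁻¹ ℚ.* ι (n C k)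
!⁻¹-binomial n k k≤n = arith (k !⁻¹) ((n ∸ k) !⁻¹) (n !⁻¹) (ι (k !)) (ι ((n ∸ k) !)) (ι (n !)) (ι (n C k))
  (/*ι (k !) {{k ℕ.!≢0}}) (/*ι ((n ∸ k) !) {{(n ∸ k) ℕ.!≢0}}) (/*ι (n !) {{n ℕ.!≢0}})
  (trans (cong (ι (n C k) ℚ.*_) (ι-* (k !) ((n ∸ k) !))) (trans (ι-* (n C k) (k ! ℕ.* (n ∸ k) !)) (cong ι
    (trans (cong (ℕ._* (k ! ℕ.* (n ∸ k) !)) (nCk≡n!/k![n-k]! k≤n))
           (m/n*n≡m {{k ℕ.!* (n ∸ k) !≢0}} (k![n∸k]!∣n! k≤n))))))
  where
  open ℚ-Solver.+-*-Solver
  arith : ∀ a b c A B F C → a ℚ.* A ≡ 1ℚ → b ℚ.* B ≡ 1ℚ → c ℚ.* F ≡ 1ℚ → C ℚ.* (A ℚ.* B) ≡ F → a ℚ.* b ≡ c ℚ.* C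
  arith a b c A B F C aA bB cF CAB = begin
    a ℚ.* b                              ≡⟨ ℚ.*-identityˡ (a ℚ.* b) ⟨
    1ℚ ℚ.* (a ℚ.* b)                     ≡⟨ cong (ℚ._* (a ℚ.* b)) cF ⟨
    c ℚ.* F ℚ.* (a ℚ.* b)                ≡⟨ cong (λ F → c ℚ.* F ℚ.* (a ℚ.* b)) CAB ⟨
    c ℚ.* (C ℚ.* (A ℚ.* B)) ℚ.* (a ℚ.* b)
      ≡⟨ solve 6 (λ a b c A B C → c :* (C :* (A :* B)) :* (a :* b) := c :* C :* ((a :* A) :* (b :* B))) refl a b c A B C ⟩
    c ℚ.* C ℚ.* ((a ℚ.* A) ℚ.* (b ℚ.* B)) ≡⟨ cong (c ℚ.* C ℚ.*_) (cong₂ ℚ._*_ aA bB) ⟩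
    c ℚ.* C ℚ.* (1ℚ ℚ.* 1ℚ)              ≡⟨ ℚ.*-identityʳ (c ℚ.* C) ⟩
    c ℚ.* C                              ∎
    where
    open ≡.≡-Reasoning

-- This is the binomial theorem divided by n!.
expTerm-convolution : ∀ z w n → convolution (expTerm z) (expTerm w) n ≈ᶜ expTerm (z +ᶜ w) n
expTerm-convolution z w n = begin
  convolution (expTerm z) (expTerm w) n
    ≈⟨ sum-cong-≋ {suc n} (λ i → term (toℕ i) (ℕ.≤-pred (Fin.toℕ<n i))) ⟩
  ∑ {suc n} (λ i → fromℚᶜ (n !⁻¹) *ᶜ B.binomialTerm z w n i)
    ≈⟨ *-distribˡ-sum {suc n} (fromℚᶜ (n !⁻¹)) (B.binomialTerm z w n) ⟨
  fromℚᶜ (n !⁻¹) *ᶜ B.binomialExpansion z w n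
    ≈⟨ *ᶜ-cong (≈ᶜ-refl {fromℚᶜ (n !⁻¹)}) (B.theorem n z w) ⟨
  fromℚᶜ (n !⁻¹) *ᶜ (z +ᶜ w) ^ˢ n
    ≡⟨ cong (fromℚᶜ (n !⁻¹) *ᶜ_) (^ᶜ≡^ˢ (z +ᶜ w) n) ⟨
  expTerm (z +ᶜ w) n ∎
  where
  open ≈ᶜ-Reasoning
  module B = Binomial ℂᴿ.commutativeSemiring
  term : ∀ k → k ℕ.≤ n → expTerm z k *ᶜ expTerm w (n ∸ k) ≈ᶜ fromℚᶜ (n !⁻¹) *ᶜ ((n C k) ×ᶜ (z ^ˢ k *ᶜ w ^ˢ (n ∸ k)))
  term k k≤n = begin
    (fromℚᶜ (k !⁻¹) *ᶜ z ^ᶜ k) *ᶜ (fromℚᶜ ((n ∸ k) !⁻¹) *ᶜ w ^ᶜ (n ∸ k))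
      ≈⟨ solve 4 (λ a b c d → (a :* b) :* (c :* d) := (a :* c) :* (b :* d)) ≈ᶜ-refl
           (fromℚᶜ (k !⁻¹)) (z ^ᶜ k) (fromℚᶜ ((n ∸ k) !⁻¹)) (w ^ᶜ (n ∸ k)) ⟩
    (fromℚᶜ (k !⁻¹) *ᶜ fromℚᶜ ((n ∸ k) !⁻¹)) *ᶜ (z ^ᶜ k *ᶜ w ^ᶜ (n ∸ k))
      ≈⟨ *ᶜ-cong (fromℚᶜ-* (k !⁻¹) ((n ∸ k) !⁻¹)) ≈ᶜ-refl ⟨
    fromℚᶜ (k !⁻¹ ℚ.* (n ∸ k) !⁻¹) *ᶜ (z ^ᶜ k *ᶜ w ^ᶜ (n ∸ k))
      ≡⟨ cong (λ q → fromℚᶜ q *ᶜ (z ^ᶜ k *ᶜ w ^ᶜ (n ∸ k))) (!⁻¹-binomial n k k≤n) ⟩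
    fromℚᶜ (n !⁻¹ ℚ.* ι (n C k)) *ᶜ (z ^ᶜ k *ᶜ w ^ᶜ (n ∸ k))
      ≈⟨ *ᶜ-cong (fromℚᶜ-* (n !⁻¹) (ι (n C k))) ≈ᶜ-refl ⟩
    (fromℚᶜ (n !⁻¹) *ᶜ fromℚᶜ (ι (n C k))) *ᶜ (z ^ᶜ k *ᶜ w ^ᶜ (n ∸ k))
      ≈⟨ *ᶜ-assoc _ _ _ ⟩
    fromℚᶜ (n !⁻¹) *ᶜ (fromℚᶜ (ι (n C k)) *ᶜ (z ^ᶜ k *ᶜ w ^ᶜ (n ∸ k)))
      ≈⟨ *ᶜ-cong ≈ᶜ-refl (×ᶜ≈* (n C k) _) ⟨
    fromℚᶜ (n !⁻¹) *ᶜ ((n C k) ×ᶜ (z ^ᶜ k *ᶜ w ^ᶜ (n ∸ k)))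
      ≡⟨ cong₂ (λ x y → fromℚᶜ (n !⁻¹) *ᶜ ((n C k) ×ᶜ (x *ᶜ y))) (^ᶜ≡^ˢ z k) (^ᶜ≡^ˢ w (n ∸ k)) ⟩
    fromℚᶜ (n !⁻¹) *ᶜ ((n C k) ×ᶜ (z ^ˢ k *ᶜ w ^ˢ (n ∸ k))) ∎
    where
    open ℂ-Solver

opaque
  unfolding _+ʳ_ _+ᶜ_

  fromℚᶜ-scale : ∀ q z → fromℚᶜ q *ᶜ z ≈ᶜ (fromℚ q *ʳ re z) +i (fromℚ q *ʳ im z)
  fromℚᶜ-scale q z = approx⇒≈ᶜ
    (λ i → solve 3 (λ q a b → q :* a :+ :- (con 0ℚ :* b) := q :* a) refl q (approx (re z) i) (approx (im z) i))
    (λ i → solve 3 (λ q a b → q :* b :+ con 0ℚ :* a := q :* b) refl q (approx (re z) i) (approx (im z) i))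
    where
    open ℚ-Solver.+-*-Solver

  +i-+ : ∀ a b c d → (a +i b) +ᶜ (c +i d) ≈ᶜ (a +ʳ c) +i (b +ʳ d)
  +i-+ a b c d = ≈ᶜ-refl

∑<-partialSum : ∀ n (y : ℕ → ℂ) → ∑< n (λ k → fromℚᶜ (k !⁻¹) *ᶜ y k)
  ≈ᶜ partialSum (λ k → fromℚ (k !⁻¹) *ʳ re (y k)) n +i partialSum (λ k → fromℚ (k !⁻¹) *ʳ im (y k)) n
∑<-partialSum zero    y = ≈ᶜ-refl
∑<-partialSum (suc n) y = ≈ᶜ-trans (∑<-suc n (λ k → fromℚᶜ (k !⁻¹) *ᶜ y k))
  (≈ᶜ-trans (+ᶜ-cong (∑<-partialSum n y) (fromℚᶜ-scale (n !⁻¹) (y n))) (+i-+ _ _ _ _))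

expSeries-⟶ : ∀ y bnd → (λ n → ∑< n (λ k → fromℚᶜ (k !⁻¹) *ᶜ y k)) ⟶ᶜ expSeries y bnd
expSeries-⟶ y bnd = ⟶ᶜ-cong (λ n → ≈ᶜ-sym (∑<-partialSum n y)) converges
  where
  converges : (λ n → partialSum (λ k → fromℚ (k !⁻¹) *ʳ re (y k)) n +i partialSum (λ k → fromℚ (k !⁻¹) *ʳ im (y k)) n)
              ⟶ᶜ expSeries y bnd
  converges ε
    with M , p ← lim-⟶ (partialSum (λ k → fromℚ (k !⁻¹) *ʳ re (y k))) _ (½· ε) {{½·-positive ε}}
       | N , q ← lim-⟶ (partialSum (λ k → fromℚ (k !⁻¹) *ʳ im (y k))) _ (½· ε) {{½·-positive ε}} = M ℕ.⊔ N , λ n n≥ →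
    subst (‖ (partialSum _ n +i partialSum _ n) +ᶜ -ᶜ expSeries y bnd ‖≤_) (½·+½· ε)
      (Close⇒‖‖≤ {partialSum _ n +i partialSum _ n} {expSeries y bnd} (p n (⊔ˡ M N n≥)) (q n (⊔ʳ M N n≥)))

exp-⟶ : ∀ z → (λ n → ∑< n (expTerm z)) ⟶ᶜ exp z
exp-⟶ z = expSeries-⟶ (λ k → z ^ᶜ k) (power-bounded z)

exp-cong : ∀ {z w} → z ≈ᶜ w → exp z ≈ᶜ exp w
exp-cong {z} {w} z≈w = ⟶ᶜ-unique (exp-⟶ z) (⟶ᶜ-cong
  (λ n → ∑<-cong n (λ k → *ᶜ-cong (≈ᶜ-refl {fromℚᶜ (k !⁻¹)}) (^ᶜ-cong k (≈ᶜ-sym z≈w)))) (exp-⟶ w))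

0≤* : ∀ {x y} → 0ℚ ℚ.≤ x → 0ℚ ℚ.≤ y → 0ℚ ℚ.≤ x ℚ.* y
0≤* {x} {y} 0≤x 0≤y = subst (ℚ._≤ x ℚ.* y) (ℚ.*-zeroˡ y) (ℚ.*-monoʳ-≤-nonNeg y {{ℚ.nonNegative 0≤y}} 0≤x)

-- Of the three factors 2⁻ⁿ in 8⁻ⁿ, two absorb the two factors n because n ≤ 2ⁿ, and the third
-- remains.
n²½^3n≤½^n : ∀ n {x} → 0ℚ ℚ.≤ x → ι n ℚ.* (ι n ℚ.* (x ℚ.* ½^ (3 ℕ.* n))) ℚ.≤ x ℚ.* ½^ n
n²½^3n≤½^n n {x} 0≤x = begin
  ι n ℚ.* (ι n ℚ.* (x ℚ.* ½^ (3 ℕ.* n)))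
    ≡⟨ cong (λ y → ι n ℚ.* (ι n ℚ.* (x ℚ.* y))) (trans (½^-+ n (n ℕ.+ (n ℕ.+ 0)))
         (cong (½^ n ℚ.*_) (trans (½^-+ n (n ℕ.+ 0)) (cong (λ k → ½^ n ℚ.* ½^ k) (ℕ.+-identityʳ n))))) ⟩
  ι n ℚ.* (ι n ℚ.* (x ℚ.* (½^ n ℚ.* (½^ n ℚ.* ½^ n))))
    ≡⟨ solve 3 (λ n x y → n :* (n :* (x :* (y :* (y :* y)))) := (n :* y) :* ((n :* y) :* (x :* y))) refl (ι n) x (½^ n) ⟩
  (ι n ℚ.* ½^ n) ℚ.* ((ι n ℚ.* ½^ n) ℚ.* (x ℚ.* ½^ n))
    ≤⟨ shrink (0≤* (0≤ι*½^ n n) (0≤* 0≤x (0≤½^ n))) ⟩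
  (ι n ℚ.* ½^ n) ℚ.* (x ℚ.* ½^ n)
    ≤⟨ shrink (0≤* 0≤x (0≤½^ n)) ⟩
  x ℚ.* ½^ n ∎
  where
  open ℚ.≤-Reasoning
  open ℚ-Solver.+-*-Solver
  n½^n≤1 : ι n ℚ.* ½^ n ℚ.≤ 1ℚ
  n½^n≤1 = subst (ι n ℚ.* ½^ n ℚ.≤_) (2^*½^ n) (*½^-mono n (ι-mono (n≤2^n n)))
  shrink : ∀ {y} → 0ℚ ℚ.≤ y → (ι n ℚ.* ½^ n) ℚ.* y ℚ.≤ y
  shrink {y} 0≤y = subst ((ι n ℚ.* ½^ n) ℚ.* y ℚ.≤_) (ℚ.*-identityˡ y) (ℚ.*-monoʳ-≤-nonNeg y {{ℚ.nonNegative 0≤y}} n½^n≤1)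

⟶ᶜ-perturb : ∀ {s t z} c → (∀ n → ‖ s n +ᶜ -ᶜ t n ‖≤ ι c ℚ.* ½^ n) → t ⟶ᶜ z → s ⟶ᶜ z
⟶ᶜ-perturb {s} {t} {z} c s-t t⟶z ε = converge (t⟶z (½· ε) {{½·-positive ε}}) (½^-small c (½· ε) {{½·-positive ε}})
  where
  open ℂ-Solver
  converge : ∃[ M ] (∀ n → M ℕ.≤ n → ‖ t n +ᶜ -ᶜ z ‖≤ ½· ε) → ∃[ N ] (ι c ℚ.* ½^ N ℚ.≤ ½· ε) →
            ∃[ K ] (∀ n → K ℕ.≤ n → ‖ s n +ᶜ -ᶜ z ‖≤ ε)
  converge (M , p) (N , q) = M ℕ.⊔ N , λ n n≥ → subst (‖ s n +ᶜ -ᶜ z ‖≤_) (½·+½· ε) (‖‖≤-resp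
    (solve 3 (λ s t z → (s :+ :- t) :+ (t :+ :- z) := s :+ :- z) ≈ᶜ-refl (s n) (t n) z)
    (‖‖≤-+ (‖‖≤-mono (ℚ.≤-trans (ℚ.*-monoˡ-≤-nonNeg (ι c) {{ℚ.nonNegative (0≤ι c)}} (½^-antimono (⊔ʳ M N n≥))) q) (s-t n))
           (p n (⊔ˡ M N n≥))))

cauchyProduct : ∀ a b c d {z} → (∀ k → ‖ a k ‖≤ ι c ℚ.* ½^ (3 ℕ.* k)) → (∀ k → ‖ b k ‖≤ ι d ℚ.* ½^ (3 ℕ.* k)) →
  (λ n → ∑< n (convolution a b)) ⟶ᶜ z → (λ n → ∑< n a *ᶜ ∑< n b) ⟶ᶜ z
cauchyProduct a b c d a≤ b≤ = ⟶ᶜ-perturb (c ℕ.* d) (λ n → ‖‖≤-mono (n²½^3n≤½^n n (0≤ι (c ℕ.* d)))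
  (‖‖≤-resp (+ᶜ-cong ≈ᶜ-refl (-ᶜ-cong (≈ᶜ-sym (∑<-convolution n a b))))
    (square-triangle n 0 n (ℕ.+-identityʳ n) a b h (λ m → 0≤ι*½^ (c ℕ.* d) (3 ℕ.* m)) h-antitone
      (λ i j → subst (‖ a i *ᶜ b j ‖≤_) (h-* i j) (‖‖≤-* (a≤ i) (b≤ j))))))
  where
  open ℚ-Solver.+-*-Solver
  h : ℕ → ℚ
  h m = ι (c ℕ.* d) ℚ.* ½^ (3 ℕ.* m)
  h-antitone : ∀ m → h (suc m) ℚ.≤ h m
  h-antitone m = ℚ.*-monoˡ-≤-nonNeg (ι (c ℕ.* d)) {{ℚ.nonNegative (0≤ι (c ℕ.* d))}} (½^-antimono (ℕ.*-monoʳ-≤ 3 (ℕ.n≤1+n m)))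
  h-* : ∀ i j → (ι c ℚ.* ½^ (3 ℕ.* i)) ℚ.* (ι d ℚ.* ½^ (3 ℕ.* j)) ≡ h (i ℕ.+ j)
  h-* i j = trans
    (solve 4 (λ c x d y → (c :* x) :* (d :* y) := (c :* d) :* (x :* y)) refl (ι c) (½^ (3 ℕ.* i)) (ι d) (½^ (3 ℕ.* j)))
    (cong₂ ℚ._*_ (ι-* c d) (trans (sym (½^-+ (3 ℕ.* i) (3 ℕ.* j))) (cong ½^ (sym (ℕ.*-distribˡ-+ 3 i j)))))

exp-+ : ∀ z w → exp (z +ᶜ w) ≈ᶜ exp z *ᶜ exp w
exp-+ z w = ≈ᶜ-sym (⟶ᶜ-unique (⟶ᶜ-* (exp-⟶ z) (exp-⟶ w))
  (cauchyProduct (expTerm z) (expTerm w) (proj₁ (‖expTerm‖≤ z)) (proj₁ (‖expTerm‖≤ w)) (proj₂ (‖expTerm‖≤ z)) (proj₂ (‖expTerm‖≤ w))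
    (⟶ᶜ-cong (λ n → ∑<-cong n (λ k → ≈ᶜ-sym (expTerm-convolution z w k))) (exp-⟶ (z +ᶜ w)))))

exp-0 : exp 0ᶜ ≈ᶜ 1ᶜ
-- The threshold is 1: the empty partial sum is 0, and every later one is equal to 1.
exp-0 = ⟶ᶜ-unique (exp-⟶ 0ᶜ) λ ε → 1 , λ { (suc n) _ → ‖‖≤-resp
  (≈ᶜ-trans (≈ᶜ-sym (ℂᴿ.-‿inverseʳ 1ᶜ)) (+ᶜ-cong (≈ᶜ-sym (partial n)) ≈ᶜ-refl)) (‖0‖≤ (0≤pos ε)) }
  where
  open ≈ᶜ-Reasoning
  partial : ∀ n → ∑< (suc n) (expTerm 0ᶜ) ≈ᶜ 1ᶜ
  partial n = begin
    1ᶜ *ᶜ 1ᶜ +ᶜ ∑< n (λ k → expTerm 0ᶜ (suc k))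
      ≈⟨ +ᶜ-cong (*ᶜ-identityˡ 1ᶜ) (∑<-cong n (λ k → ≈ᶜ-trans (*ᶜ-cong ≈ᶜ-refl (ℂᴿ.zeroˡ (0ᶜ ^ᶜ k))) (ℂᴿ.zeroʳ (fromℚᶜ (suc k !⁻¹))))) ⟩
    1ᶜ +ᶜ ∑ {n} (λ _ → 0ᶜ)
      ≈⟨ +ᶜ-cong ≈ᶜ-refl (sum-replicate-zero n) ⟩
    1ᶜ +ᶜ 0ᶜ
      ≈⟨ ℂᴿ.+-identityʳ 1ᶜ ⟩
    1ᶜ ∎

conj-∑ : ∀ {n} (f : Fin n → ℂ) → conj (∑ f) ≈ᶜ ∑ (λ i → conj (f i))
conj-∑ {zero}  f = conj-fromℝ 0ʳ
conj-∑ {suc n} f = ≈ᶜ-trans (conj-+ (f zero) (∑ (λ i → f (suc i)))) (+ᶜ-cong ≈ᶜ-refl (conj-∑ (λ i → f (suc i))))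

conj-^ : ∀ z k → conj (z ^ᶜ k) ≈ᶜ conj z ^ᶜ k
conj-^ z zero    = conj-fromℝ 1ʳ
conj-^ z (suc k) = ≈ᶜ-trans (conj-* z (z ^ᶜ k)) (*ᶜ-cong ≈ᶜ-refl (conj-^ z k))

exp-conj : ∀ z → exp (conj z) ≈ᶜ conj (exp z)
exp-conj z = ⟶ᶜ-unique (exp-⟶ (conj z)) (⟶ᶜ-cong
  (λ n → ≈ᶜ-trans (conj-∑ {n} (λ i → expTerm z (toℕ i))) (∑<-cong n (λ k → ≈ᶜ-trans (conj-* (fromℚᶜ (k !⁻¹)) (z ^ᶜ k))
    (*ᶜ-cong (conj-fromℝ (fromℚ (k !⁻¹))) (conj-^ z k)))))
  (⟶ᶜ-conj (exp-⟶ z)))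

exp-×ℕ : ∀ n z → exp (fromℚᶜ (ι n) *ᶜ z) ≈ᶜ exp z ^ᶜ n
exp-×ℕ zero    z = ≈ᶜ-trans (exp-cong (≈ᶜ-sym (×ᶜ≈* 0 z))) exp-0
exp-×ℕ (suc n) z = begin
  exp (fromℚᶜ (ι (suc n)) *ᶜ z)         ≈⟨ exp-cong (×ᶜ≈* (suc n) z) ⟨
  exp (z +ᶜ n ×ᶜ z)                     ≈⟨ exp-+ z (n ×ᶜ z) ⟩
  exp z *ᶜ exp (n ×ᶜ z)                 ≈⟨ *ᶜ-cong ≈ᶜ-refl (exp-cong (×ᶜ≈* n z)) ⟩
  exp z *ᶜ exp (fromℚᶜ (ι n) *ᶜ z)      ≈⟨ *ᶜ-cong ≈ᶜ-refl (exp-×ℕ n z) ⟩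
  exp z *ᶜ exp z ^ᶜ n                   ∎
  where
  open ≈ᶜ-Reasoning

-- Matrix exponentials on eigenvectors

basis-· : ∀ {m} (i : Fin m) (v : Vec m) → (basis · v) i ≈ᶜ v i
basis-· {suc m} zero v = begin
  1ᶜ *ᶜ v zero +ᶜ ∑ (λ j → 0ᶜ *ᶜ v (suc j))   ≈⟨ +ᶜ-cong (*ᶜ-identityˡ (v zero)) (sum-cong-≋ (λ j → ℂᴿ.zeroˡ (v (suc j)))) ⟩
  v zero +ᶜ ∑ {m} (λ j → 0ᶜ)                  ≈⟨ +ᶜ-cong ≈ᶜ-refl (sum-replicate-zero m) ⟩
  v zero +ᶜ 0ᶜ                                ≈⟨ ℂᴿ.+-identityʳ (v zero) ⟩
  v zero                                      ∎
  where
  open ≈ᶜ-Reasoning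
basis-· {suc m} (suc i) v = begin
  0ᶜ *ᶜ v zero +ᶜ ∑ (λ j → basis i j *ᶜ v (suc j))  ≈⟨ +ᶜ-cong (ℂᴿ.zeroˡ (v zero)) (basis-· i (λ j → v (suc j))) ⟩
  0ᶜ +ᶜ v (suc i)                                   ≈⟨ +ᶜ-identityˡ (v (suc i)) ⟩
  v (suc i)                                         ∎
  where
  open ≈ᶜ-Reasoning

module _ {n} (M : Matrix n) (v : Vec n) (μ : ℂ) (eigen : ∀ i → (M · v) i ≈ᶜ μ *ᶜ v i) where
  open ≈ᶜ-Reasoning

  ^ᴹ-eigen : ∀ k i → ((M ^ᴹ k) · v) i ≈ᶜ μ ^ᶜ k *ᶜ v i
  ^ᴹ-eigen zero    i = ≈ᶜ-trans (basis-· i v) (≈ᶜ-sym (*ᶜ-identityˡ (v i)))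
  ^ᴹ-eigen (suc k) i = begin
    ∑ (λ j → ∑ (λ l → M i l *ᶜ (M ^ᴹ k) l j) *ᶜ v j)
      ≈⟨ sum-cong-≋ (λ j → *-distribʳ-sum (v j) (λ l → M i l *ᶜ (M ^ᴹ k) l j)) ⟩
    ∑ (λ j → ∑ (λ l → M i l *ᶜ (M ^ᴹ k) l j *ᶜ v j))
      ≈⟨ ∑-comm (λ j l → M i l *ᶜ (M ^ᴹ k) l j *ᶜ v j) ⟩
    ∑ (λ l → ∑ (λ j → M i l *ᶜ (M ^ᴹ k) l j *ᶜ v j))
      ≈⟨ sum-cong-≋ (λ l → ≈ᶜ-trans (sum-cong-≋ (λ j → *ᶜ-assoc (M i l) ((M ^ᴹ k) l j) (v j)))
                                    (≈ᶜ-sym (*-distribˡ-sum (M i l) (λ j → (M ^ᴹ k) l j *ᶜ v j)))) ⟩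
    ∑ (λ l → M i l *ᶜ ((M ^ᴹ k) · v) l)
      ≈⟨ sum-cong-≋ (λ l → ≈ᶜ-trans (*ᶜ-cong ≈ᶜ-refl (^ᴹ-eigen k l))
           (solve 3 (λ m p x → m :* (p :* x) := p :* (m :* x)) ≈ᶜ-refl (M i l) (μ ^ᶜ k) (v l))) ⟩
    ∑ (λ l → μ ^ᶜ k *ᶜ (M i l *ᶜ v l))
      ≈⟨ *-distribˡ-sum (μ ^ᶜ k) (λ l → M i l *ᶜ v l) ⟨
    μ ^ᶜ k *ᶜ (M · v) i
      ≈⟨ *ᶜ-cong ≈ᶜ-refl (eigen i) ⟩
    μ ^ᶜ k *ᶜ (μ *ᶜ v i)
      ≈⟨ solve 3 (λ p m x → p :* (m :* x) := (m :* p) :* x) ≈ᶜ-refl (μ ^ᶜ k) μ (v i) ⟩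
    μ ^ᶜ suc k *ᶜ v i ∎
    where
    open ℂ-Solver

  -- The entries of `expᴹ` are separate limits, but a finite sum of limits is the limit of the sums.
  -- At each finite stage the eigenvector equation for powers turns the partial sum for the matrix
  -- into that for μ, and uniqueness of limits concludes.
  expᴹ-eigen : ∀ i → (expᴹ M · v) i ≈ᶜ exp μ *ᶜ v i
  expᴹ-eigen i = ⟶ᶜ-unique
    (⟶ᶜ-∑ n (λ k j → ∑< k (λ l → fromℚᶜ (l !⁻¹) *ᶜ (M ^ᴹ l) i j) *ᶜ v j) (λ j → expᴹ M i j *ᶜ v j)
      (λ j → ⟶ᶜ-* (expSeries-⟶ (λ l → (M ^ᴹ l) i j) (powerᴹ-bounded M i j)) (⟶ᶜ-const (v j))))
    (⟶ᶜ-cong (λ k → ≈ᶜ-sym (partial k)) (⟶ᶜ-* (exp-⟶ μ) (⟶ᶜ-const (v i))))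
    where
    open ℂ-Solver
    partial : ∀ k → ∑ (λ j → ∑< k (λ l → fromℚᶜ (l !⁻¹) *ᶜ (M ^ᴹ l) i j) *ᶜ v j) ≈ᶜ ∑< k (expTerm μ) *ᶜ v i
    partial k = begin
      ∑ (λ j → ∑< k (λ l → fromℚᶜ (l !⁻¹) *ᶜ (M ^ᴹ l) i j) *ᶜ v j)
        ≈⟨ sum-cong-≋ (λ j → *-distribʳ-sum {k} (v j) (λ l → fromℚᶜ (toℕ l !⁻¹) *ᶜ (M ^ᴹ toℕ l) i j)) ⟩
      ∑ (λ j → ∑< k (λ l → fromℚᶜ (l !⁻¹) *ᶜ (M ^ᴹ l) i j *ᶜ v j))
        ≈⟨ ∑-comm {n} {k} (λ j l → fromℚᶜ (toℕ l !⁻¹) *ᶜ (M ^ᴹ toℕ l) i j *ᶜ v j) ⟩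
      ∑< k (λ l → ∑ (λ j → fromℚᶜ (l !⁻¹) *ᶜ (M ^ᴹ l) i j *ᶜ v j))
        ≈⟨ ∑<-cong k (λ l → ≈ᶜ-trans (sum-cong-≋ (λ j → *ᶜ-assoc (fromℚᶜ (l !⁻¹)) ((M ^ᴹ l) i j) (v j)))
             (≈ᶜ-sym (*-distribˡ-sum (fromℚᶜ (l !⁻¹)) (λ j → (M ^ᴹ l) i j *ᶜ v j)))) ⟩
      ∑< k (λ l → fromℚᶜ (l !⁻¹) *ᶜ ((M ^ᴹ l) · v) i)
        ≈⟨ ∑<-cong k (λ l → ≈ᶜ-trans (*ᶜ-cong ≈ᶜ-refl (^ᴹ-eigen l i)) (≈ᶜ-sym (*ᶜ-assoc (fromℚᶜ (l !⁻¹)) (μ ^ᶜ l) (v i)))) ⟩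
      ∑< k (λ l → expTerm μ l *ᶜ v i)
        ≈⟨ *-distribʳ-sum {k} (v i) (λ l → expTerm μ (toℕ l)) ⟨
      ∑< k (expTerm μ) *ᶜ v i ∎

-- Trigonometry and roots of unity

^ᶜ-+ : ∀ z m n → z ^ᶜ (m ℕ.+ n) ≈ᶜ z ^ᶜ m *ᶜ z ^ᶜ n
^ᶜ-+ z zero    n = ≈ᶜ-sym (*ᶜ-identityˡ (z ^ᶜ n))
^ᶜ-+ z (suc m) n = ≈ᶜ-trans (*ᶜ-cong ≈ᶜ-refl (^ᶜ-+ z m n)) (≈ᶜ-sym (*ᶜ-assoc z (z ^ᶜ m) (z ^ᶜ n)))

^ᶜ-* : ∀ z m n → z ^ᶜ (n ℕ.* m) ≈ᶜ (z ^ᶜ m) ^ᶜ n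
^ᶜ-* z m zero    = ≈ᶜ-refl
^ᶜ-* z m (suc n) = ≈ᶜ-trans (^ᶜ-+ z m (n ℕ.* m)) (*ᶜ-cong ≈ᶜ-refl (^ᶜ-* z m n))

1^ᶜ : ∀ n → 1ᶜ ^ᶜ n ≈ᶜ 1ᶜ
1^ᶜ zero    = ≈ᶜ-refl
1^ᶜ (suc n) = ≈ᶜ-trans (*ᶜ-identityˡ (1ᶜ ^ᶜ n)) (1^ᶜ n)

geometric : ∀ x n → (x +ᶜ -ᶜ 1ᶜ) *ᶜ ∑< n (x ^ᶜ_) ≈ᶜ x ^ᶜ n +ᶜ -ᶜ 1ᶜ
geometric x zero    = solve 1 (λ x → (x :+ :- con 1ℚ) :* con 0ℚ := con 1ℚ :+ :- con 1ℚ) ≈ᶜ-refl x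
  where
  open ℂ-Solver
geometric x (suc n) = begin
  (x +ᶜ -ᶜ 1ᶜ) *ᶜ ∑< (suc n) (x ^ᶜ_)                             ≈⟨ *ᶜ-cong ≈ᶜ-refl (∑<-suc n (x ^ᶜ_)) ⟩
  (x +ᶜ -ᶜ 1ᶜ) *ᶜ (∑< n (x ^ᶜ_) +ᶜ x ^ᶜ n)                       ≈⟨ ℂᴿ.distribˡ _ _ _ ⟩
  (x +ᶜ -ᶜ 1ᶜ) *ᶜ ∑< n (x ^ᶜ_) +ᶜ (x +ᶜ -ᶜ 1ᶜ) *ᶜ x ^ᶜ n         ≈⟨ +ᶜ-cong (geometric x n) ≈ᶜ-refl ⟩
  (x ^ᶜ n +ᶜ -ᶜ 1ᶜ) +ᶜ (x +ᶜ -ᶜ 1ᶜ) *ᶜ x ^ᶜ n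
    ≈⟨ solve 2 (λ x y → (y :+ :- con 1ℚ) :+ (x :+ :- con 1ℚ) :* y := x :* y :+ :- con 1ℚ) ≈ᶜ-refl x (x ^ᶜ n) ⟩
  x ^ᶜ suc n +ᶜ -ᶜ 1ᶜ                                            ∎
  where
  open ≈ᶜ-Reasoning
  open ℂ-Solver

cis : ℝ → ℂ
cis θ = exp (𝕚 *ᶜ fromℝ θ)

cis≈ : ∀ θ → cis θ ≈ᶜ fromℝ (cos θ) +ᶜ 𝕚 *ᶜ fromℝ (sin θ)
cis≈ θ = re+im (cis θ)

conj-cis : ∀ θ → conj (cis θ) ≈ᶜ fromℝ (cos θ) +ᶜ -ᶜ (𝕚 *ᶜ fromℝ (sin θ))
conj-cis θ = conj≃ (cis θ)

exp-inverse : ∀ z → exp z *ᶜ exp (-ᶜ z) ≈ᶜ 1ᶜ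
exp-inverse z = ≈ᶜ-trans (≈ᶜ-sym (exp-+ z (-ᶜ z))) (≈ᶜ-trans (exp-cong (ℂᴿ.-‿inverseʳ z)) exp-0)

conj-𝕚* : ∀ x → conj (𝕚 *ᶜ fromℝ x) ≈ᶜ -ᶜ (𝕚 *ᶜ fromℝ x)
conj-𝕚* x = ≈ᶜ-trans (conj-* 𝕚 (fromℝ x)) (≈ᶜ-trans (*ᶜ-cong conj-𝕚 (conj-fromℝ x))
  (solve 2 (λ i x → (:- i) :* x := :- (i :* x)) ≈ᶜ-refl 𝕚 (fromℝ x)))
  where
  open ℂ-Solver

exp-neg-𝕚 : ∀ θ → exp (-ᶜ (𝕚 *ᶜ fromℝ θ)) ≈ᶜ conj (cis θ)
exp-neg-𝕚 θ = ≈ᶜ-trans (exp-cong (≈ᶜ-sym (conj-𝕚* θ))) (exp-conj (𝕚 *ᶜ fromℝ θ))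

cis-unit : ∀ θ → cis θ *ᶜ conj (cis θ) ≈ᶜ 1ᶜ
cis-unit θ = ≈ᶜ-trans (*ᶜ-cong ≈ᶜ-refl (≈ᶜ-sym (exp-neg-𝕚 θ))) (exp-inverse (𝕚 *ᶜ fromℝ θ))

opaque
  unfolding _+ʳ_ _+ᶜ_

  fromℝ-∣∣² : ∀ z → fromℝ ∣ z ∣² ≈ᶜ z *ᶜ conj z
  fromℝ-∣∣² z = approx⇒≈ᶜ
    (λ i → solve 2 (λ a b → a :* a :+ b :* b := a :* a :+ :- (b :* (:- b))) refl (approx (re z) i) (approx (im z) i))
    (λ i → solve 2 (λ a b → con 0ℚ := a :* (:- b) :+ b :* a) refl (approx (re z) i) (approx (im z) i))
    where
    open ℚ-Solver.+-*-Solver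

  fromℝ-+ : ∀ x y → fromℝ (x +ʳ y) ≈ᶜ fromℝ x +ᶜ fromℝ y
  fromℝ-+ x y = approx⇒≈ᶜ (λ _ → refl) (λ _ → refl)

  fromℝ-scale : ∀ x z → fromℝ x *ᶜ z ≈ᶜ (x *ʳ re z) +i (x *ʳ im z)
  fromℝ-scale x z = approx⇒≈ᶜ
    (λ i → solve 3 (λ q a b → q :* a :+ :- (con 0ℚ :* b) := q :* a) refl (approx x i) (approx (re z) i) (approx (im z) i))
    (λ i → solve 3 (λ q a b → q :* b :+ con 0ℚ :* a := q :* b) refl (approx x i) (approx (re z) i) (approx (im z) i))
    where
    open ℚ-Solver.+-*-Solver

  -- Positivity of x supplies a rational δ with x ≥ δ from some index on, so |x y| ≤ δ ε forces |y|
  -- ≤ ε. No reciprocal of x has to be formed.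
  *ʳ-cancelˡ-0 : ∀ {x y} → 0ʳ < x → x *ʳ y ≃ 0ʳ → y ≃ 0ʳ
  *ʳ-cancelˡ-0 {x} {y} (δ , δ>0 , x≥δ) xy≃0 ε = ev-zip
    (λ {i} u v → ℚ.*-cancelˡ-≤-pos δ {{δ>0}} (step (approx x i) (approx y i) u v))
    x≥δ (xy≃0 (δ ℚ.* ε) {{ℚ.pos*pos⇒pos δ {{δ>0}} ε}})
    where
    step : ∀ x y → 0ℚ ℚ.+ δ ℚ.≤ x → ∣ x ℚ.* y ℚ.- 0ℚ ∣ ℚ.≤ δ ℚ.* ε → δ ℚ.* ∣ y ℚ.- 0ℚ ∣ ℚ.≤ δ ℚ.* ε
    step x y u v = begin
      δ ℚ.* ∣ y ℚ.- 0ℚ ∣     ≡⟨ cong (λ y → δ ℚ.* ∣ y ∣) (ℚ.+-identityʳ y) ⟩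
      δ ℚ.* ∣ y ∣            ≤⟨ ℚ.*-monoʳ-≤-nonNeg ∣ y ∣ {{ℚ.∣-∣-nonNeg y}} (subst (ℚ._≤ x) (ℚ.+-identityˡ δ) u) ⟩
      x ℚ.* ∣ y ∣            ≡⟨ cong (ℚ._* ∣ y ∣) (ℚ.0≤p⇒∣p∣≡p (ℚ.≤-trans (0≤pos δ {{δ>0}}) (subst (ℚ._≤ x) (ℚ.+-identityˡ δ) u))) ⟨
      ∣ x ∣ ℚ.* ∣ y ∣        ≡⟨ ℚ.∣p*q∣≡∣p∣*∣q∣ x y ⟨
      ∣ x ℚ.* y ∣            ≡⟨ cong ∣_∣ (ℚ.+-identityʳ (x ℚ.* y)) ⟨
      ∣ x ℚ.* y ℚ.- 0ℚ ∣     ≤⟨ v ⟩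
      δ ℚ.* ε                ∎
      where
      open ℚ.≤-Reasoning

  0<scale : ∀ {x} q .{{_ : Positive q}} → 0ʳ < x → 0ʳ < x *ʳ fromℚ q
  0<scale {x} q (δ , δ>0 , x≥δ) = δ ℚ.* q , ℚ.pos*pos⇒pos δ {{δ>0}} q , ev-map
    (λ {i} u → subst (ℚ._≤ approx x i ℚ.* q) (sym (ℚ.+-identityˡ (δ ℚ.* q)))
      (ℚ.*-monoʳ-≤-nonNeg q {{ℚ.pos⇒nonNeg q}} (subst (ℚ._≤ approx x i) (ℚ.+-identityˡ δ) u))) x≥δ

  scale<1 : ∀ {x} q → Positive (1ℚ ℚ.- q) → 0ʳ < x → x *ʳ fromℚ q < x
  scale<1 {x} q 1-q>0 (δ , δ>0 , x≥δ) = δ ℚ.* (1ℚ ℚ.- q) , ℚ.pos*pos⇒pos δ {{δ>0}} (1ℚ ℚ.- q) {{1-q>0}} , ev-map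
    (λ {i} u → step (approx x i) (subst (ℚ._≤ approx x i) (ℚ.+-identityˡ δ) u)) x≥δ
    where
    step : ∀ x → δ ℚ.≤ x → x ℚ.* q ℚ.+ δ ℚ.* (1ℚ ℚ.- q) ℚ.≤ x
    step x u = begin
      x ℚ.* q ℚ.+ δ ℚ.* (1ℚ ℚ.- q)   ≤⟨ ℚ.+-monoʳ-≤ (x ℚ.* q) (ℚ.*-monoʳ-≤-nonNeg (1ℚ ℚ.- q) {{ℚ.pos⇒nonNeg (1ℚ ℚ.- q) {{1-q>0}}}} u) ⟩
      x ℚ.* q ℚ.+ x ℚ.* (1ℚ ℚ.- q)   ≡⟨ solve 2 (λ x q → x :* q :+ x :* (con 1ℚ :+ :- q) := x) refl x q ⟩
      x                              ∎
      where
      open ℚ.≤-Reasoning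
      open ℚ-Solver.+-*-Solver

fromℝ-cong : ∀ {x y} → x ≃ y → fromℝ x ≈ᶜ fromℝ y
fromℝ-cong x≃y = mk≈ (x≃y , ≃-refl {0ʳ})

fromℝ-cancelˡ-0 : ∀ {x z} → 0ʳ < x → fromℝ x *ᶜ z ≈ᶜ 0ᶜ → z ≈ᶜ 0ᶜ
fromℝ-cancelˡ-0 {x} {z} 0<x xz≈0 with mk≈ (p , q) ← ≈ᶜ-trans (≈ᶜ-sym (fromℝ-scale x z)) xz≈0 =
  mk≈ (*ʳ-cancelˡ-0 {x} {re z} 0<x p , *ʳ-cancelˡ-0 {x} {im z} 0<x q)

-- For z on the unit circle z - z̄ = z̄ (z² - 1), and z - z̄ is 2 i sin θ. Hence (z² - 1) s = 0
-- gives sin θ · s = 0, where the positive real factor can be cancelled.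
cis²-cancel : ∀ θ → 0ʳ < sin θ → ∀ s → (cis θ *ᶜ cis θ +ᶜ -ᶜ 1ᶜ) *ᶜ s ≈ᶜ 0ᶜ → s ≈ᶜ 0ᶜ
cis²-cancel θ 0<sin s p = fromℝ-cancelˡ-0 0<sin (begin
  fromℝ (sin θ) *ᶜ s
    -- The solver does not know i² = -1, so u stands for `𝕚 *ᶜ 𝕚` and the discrepancy is collected
    -- in a multiple of 1 + u, which the next step removes.
    ≈⟨ solve 3 (λ x s u → x :* s := con ½ :* (:- u) :* (x :+ x) :* s :+ (con 1ℚ :+ u) :* x :* s) ≈ᶜ-refl (fromℝ (sin θ)) s (𝕚 *ᶜ 𝕚) ⟩
  fromℚᶜ ½ *ᶜ (-ᶜ (𝕚 *ᶜ 𝕚)) *ᶜ (fromℝ (sin θ) +ᶜ fromℝ (sin θ)) *ᶜ s +ᶜ (1ᶜ +ᶜ 𝕚 *ᶜ 𝕚) *ᶜ fromℝ (sin θ) *ᶜ s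
    ≈⟨ +ᶜ-cong ≈ᶜ-refl (*ᶜ-cong (*ᶜ-cong (≈ᶜ-trans (+ᶜ-cong ≈ᶜ-refl 𝕚*𝕚) (ℂᴿ.-‿inverseʳ 1ᶜ)) ≈ᶜ-refl) ≈ᶜ-refl) ⟩
  fromℚᶜ ½ *ᶜ (-ᶜ (𝕚 *ᶜ 𝕚)) *ᶜ (fromℝ (sin θ) +ᶜ fromℝ (sin θ)) *ᶜ s +ᶜ 0ᶜ *ᶜ fromℝ (sin θ) *ᶜ s
    ≈⟨ solve 4 (λ x s i c → con ½ :* (:- (i :* i)) :* (x :+ x) :* s :+ con 0ℚ :* x :* s
                         := con ½ :* (:- i) :* (((c :+ i :* x) :+ :- (c :+ :- (i :* x))) :* s)) ≈ᶜ-refl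
         (fromℝ (sin θ)) s 𝕚 (fromℝ (cos θ)) ⟩
  fromℚᶜ ½ *ᶜ (-ᶜ 𝕚) *ᶜ (((fromℝ (cos θ) +ᶜ 𝕚 *ᶜ fromℝ (sin θ)) +ᶜ -ᶜ (fromℝ (cos θ) +ᶜ -ᶜ (𝕚 *ᶜ fromℝ (sin θ)))) *ᶜ s)
    ≈⟨ *ᶜ-cong ≈ᶜ-refl (*ᶜ-cong (+ᶜ-cong (cis≈ θ) (-ᶜ-cong (conj-cis θ))) ≈ᶜ-refl) ⟨
  fromℚᶜ ½ *ᶜ (-ᶜ 𝕚) *ᶜ ((cis θ +ᶜ -ᶜ conj (cis θ)) *ᶜ s)
    ≈⟨ *ᶜ-cong ≈ᶜ-refl vanishes ⟩
  fromℚᶜ ½ *ᶜ (-ᶜ 𝕚) *ᶜ 0ᶜ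
    ≈⟨ ℂᴿ.zeroʳ _ ⟩
  0ᶜ ∎)
  where
  open ≈ᶜ-Reasoning
  open ℂ-Solver
  vanishes : (cis θ +ᶜ -ᶜ conj (cis θ)) *ᶜ s ≈ᶜ 0ᶜ
  vanishes = begin
    (cis θ +ᶜ -ᶜ conj (cis θ)) *ᶜ s
      -- The relation z z̄ = 1 is likewise isolated as the factor 1 - z w, with w for the conjugate.
      ≈⟨ solve 3 (λ z w s → (z :+ :- w) :* s := w :* ((z :* z :+ :- con 1ℚ) :* s) :+ (con 1ℚ :+ :- (z :* w)) :* (z :* s)) ≈ᶜ-refl (cis θ) (conj (cis θ)) s ⟩
    conj (cis θ) *ᶜ ((cis θ *ᶜ cis θ +ᶜ -ᶜ 1ᶜ) *ᶜ s) +ᶜ (1ᶜ +ᶜ -ᶜ (cis θ *ᶜ conj (cis θ))) *ᶜ (cis θ *ᶜ s)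
      ≈⟨ +ᶜ-cong (*ᶜ-cong ≈ᶜ-refl p) (*ᶜ-cong (+ᶜ-cong ≈ᶜ-refl (-ᶜ-cong (cis-unit θ))) ≈ᶜ-refl) ⟩
    conj (cis θ) *ᶜ 0ᶜ +ᶜ (1ᶜ +ᶜ -ᶜ 1ᶜ) *ᶜ (cis θ *ᶜ s)
      ≈⟨ solve 2 (λ w y → w :* con 0ℚ :+ (con 1ℚ :+ :- con 1ℚ) :* y := con 0ℚ) ≈ᶜ-refl (conj (cis θ)) (cis θ *ᶜ s) ⟩
    0ᶜ ∎

-- α is real and β imaginary, so |α|² + |β|² = α² - β² = (α + β)(α - β), which is `cis t` times its
-- conjugate.
cos²+sin²≃1 : ∀ t → ∣ fromℝ (cos t) ∣² +ʳ ∣ 𝕚 *ᶜ fromℝ (sin t) ∣² ≃ 1ʳ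
cos²+sin²≃1 t = proj₁ (un≈ (begin
  fromℝ (∣ α ∣² +ʳ ∣ β ∣²)              ≈⟨ fromℝ-+ (∣ α ∣²) (∣ β ∣²) ⟩
  fromℝ (∣ α ∣²) +ᶜ fromℝ (∣ β ∣²)      ≈⟨ +ᶜ-cong (fromℝ-∣∣² α) (fromℝ-∣∣² β) ⟩
  α *ᶜ conj α +ᶜ β *ᶜ conj β            ≈⟨ +ᶜ-cong (*ᶜ-cong ≈ᶜ-refl (conj-fromℝ (cos t))) (*ᶜ-cong ≈ᶜ-refl (conj-𝕚* (sin t))) ⟩
  α *ᶜ α +ᶜ β *ᶜ -ᶜ β                   ≈⟨ solve 2 (λ a b → a :* a :+ b :* (:- b) := (a :+ b) :* (a :+ :- b)) ≈ᶜ-refl α β ⟩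
  (α +ᶜ β) *ᶜ (α +ᶜ -ᶜ β)               ≈⟨ *ᶜ-cong (cis≈ t) (conj-cis t) ⟨
  cis t *ᶜ conj (cis t)                 ≈⟨ cis-unit t ⟩
  1ᶜ                                    ∎))
  where
  open ≈ᶜ-Reasoning
  open ℂ-Solver
  α β : ℂ
  α = fromℝ (cos t)
  β = 𝕚 *ᶜ fromℝ (sin t)

opaque
  unfolding _+ʳ_

  -- The distance d of two constant sequences does not shrink with the index, so the tolerance d/2
  -- would give d ≤ d/2 if d were positive.
  fromℚ-injective : ∀ {p q} → fromℚ p ≃ fromℚ q → p ≡ q
  fromℚ-injective {p} {q} p≃q with p ℚ.≟ q
  ... | yes p≡q = p≡q
  ... | no  p≢q = contradiction (ℚ.<-≤-trans half<d d≤half) (ℚ.<-irrefl refl)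
    where
    d : ℚ
    d = ∣ p ℚ.- q ∣
    d>0 : Positive d
    d>0 = ℚ.positive (ℚ.≰⇒> λ d≤0 → p≢q (p-q≡0⇒p≡q (ℚ.∣p∣≡0⇒p≡0 (p ℚ.- q) (ℚ.≤-antisym d≤0 (ℚ.0≤∣p∣ (p ℚ.- q))))))
      where
      p-q≡0⇒p≡q : p ℚ.- q ≡ 0ℚ → p ≡ q
      p-q≡0⇒p≡q eq = trans (solve 2 (λ p q → p := (p :+ :- q) :+ q) refl p q) (trans (cong (ℚ._+ q) eq) (ℚ.+-identityˡ q))
        where
        open ℚ-Solver.+-*-Solver
    half>0 : Positive (½· d)
    half>0 = ½·-positive d {{d>0}}
    half<d : ½· d ℚ.< d
    half<d = subst₂ ℚ._<_ (ℚ.+-identityʳ (½· d)) (½·+½· d) (ℚ.+-monoʳ-< (½· d) (ℚ.positive⁻¹ (½· d) {{half>0}}))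
    d≤half : d ℚ.≤ ½· d
    d≤half = proj₂ (ev-∃ (p≃q (½· d) {{half>0}}))

-- If x were 0, cancelling it from `x *ʳ 1ʳ` would give 1 = 0 in `ℚ`.
0<⇒≄0 : ∀ {x} → 0ʳ < x → ¬ x ≃ 0ʳ
0<⇒≄0 {x} 0<x x≃0 with () ← fromℚ-injective {1ℚ} {0ℚ} (*ʳ-cancelˡ-0 {x} {1ʳ} 0<x (proj₁ (un≈
  (≈ᶜ-trans (fromℝ-* x 1ʳ) (≈ᶜ-trans (ℂᴿ.*-identityʳ (fromℝ x)) (fromℝ-cong {x} {0ʳ} x≃0))))))

𝕚*≄0 : ∀ {x} → 0ʳ < x → ¬ 𝕚 *ᶜ fromℝ x ≃ᶜ 0ᶜ
𝕚*≄0 {x} 0<x p = 0<⇒≄0 {x} 0<x (proj₁ (un≈ (begin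
  fromℝ x                                                ≈⟨ solve 2 (λ x i → x := (:- i) :* (i :* x) :+ (con 1ℚ :+ i :* i) :* x) ≈ᶜ-refl (fromℝ x) 𝕚 ⟩
  -ᶜ 𝕚 *ᶜ (𝕚 *ᶜ fromℝ x) +ᶜ (1ᶜ +ᶜ 𝕚 *ᶜ 𝕚) *ᶜ fromℝ x    ≈⟨ +ᶜ-cong (*ᶜ-cong ≈ᶜ-refl (mk≈ p)) (*ᶜ-cong (+ᶜ-cong ≈ᶜ-refl 𝕚*𝕚) ≈ᶜ-refl) ⟩
  -ᶜ 𝕚 *ᶜ 0ᶜ +ᶜ (1ᶜ +ᶜ -ᶜ 1ᶜ) *ᶜ fromℝ x                 ≈⟨ solve 2 (λ x i → (:- i) :* con 0ℚ :+ (con 1ℚ :+ :- con 1ℚ) :* x := con 0ℚ) ≈ᶜ-refl (fromℝ x) 𝕚 ⟩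
  0ᶜ                                                     ∎)))
  where
  open ≈ᶜ-Reasoning
  open ℂ-Solver

-- `separated` states primitivity as cancellation of ω^j - 1. It is stronger than ω^j ≠ 1, and it
-- gives both the vanishing of geometric sums and the uniqueness of eigenvalues.
record PrimitiveRoot (N : ℕ) : Set where
  field
    ω         : ℂ
    ω^N       : ω ^ᶜ N ≈ᶜ 1ᶜ
    separated : ∀ j → 1 ℕ.≤ j → j ℕ.< N → ∀ s → (ω ^ᶜ j +ᶜ -ᶜ 1ᶜ) *ᶜ s ≈ᶜ 0ᶜ → s ≈ᶜ 0ᶜ

1/_ : ∀ N .{{_ : ℕ.NonZero N}} → ℚ
1/ N = + 1 ℚ./ N

opaque
  1/-positive : ∀ N .{{_ : ℕ.NonZero N}} → Positive (1/ N)
  1/-positive N = ℚ.normalize-pos 1 N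

opaque
  j/N-positive : ∀ j N .{{_ : ℕ.NonZero N}} → 1 ℕ.≤ j → Positive (ι j ℚ.* 1/ N)
  j/N-positive (suc j) N _ = ℚ.positive (ℚ.<-≤-trans (ℚ.positive⁻¹ (1/ N) {{1/-positive N}}) (begin
    1/ N                       ≡⟨ ℚ.*-identityˡ (1/ N) ⟨
    1ℚ ℚ.* 1/ N                ≡⟨ cong (ℚ._* 1/ N) ι1≡1 ⟨
    ι 1 ℚ.* 1/ N               ≤⟨ ℚ.*-monoʳ-≤-nonNeg (1/ N) {{ℚ.pos⇒nonNeg (1/ N) {{1/-positive N}}}} (ι-mono (ℕ.s≤s ℕ.z≤n)) ⟩
    ι (suc j) ℚ.* 1/ N         ∎))
    where
    open ℚ.≤-Reasoning

  1-j/N-positive : ∀ j N .{{_ : ℕ.NonZero N}} → j ℕ.< N → Positive (1ℚ ℚ.- ι j ℚ.* 1/ N)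
  1-j/N-positive j N j<N = subst Positive (begin
    ι (N ∸ j) ℚ.* 1/ N                                       ≡⟨ solve 3 (λ d x j → d :* x := (d :+ j) :* x :+ :- (j :* x)) refl (ι (N ∸ j)) (1/ N) (ι j) ⟩
    (ι (N ∸ j) ℚ.+ ι j) ℚ.* 1/ N ℚ.- ι j ℚ.* 1/ N            ≡⟨ cong (λ x → x ℚ.* 1/ N ℚ.- ι j ℚ.* 1/ N) (trans (ι-+ (N ∸ j) j) (cong ι (ℕ.m∸n+n≡m (ℕ.<⇒≤ j<N)))) ⟩
    ι N ℚ.* 1/ N ℚ.- ι j ℚ.* 1/ N                            ≡⟨ cong (ℚ._- ι j ℚ.* 1/ N) (trans (ℚ.*-comm (ι N) (1/ N)) (/*ι N)) ⟩
    1ℚ ℚ.- ι j ℚ.* 1/ N                                      ∎)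
    (j/N-positive (N ∸ j) N (ℕ.m<n⇒0<n∸m j<N))
    where
    open ≡.≡-Reasoning
    open ℚ-Solver.+-*-Solver

𝕚*-scale : ∀ x q → 𝕚 *ᶜ fromℝ (x *ʳ fromℚ q) ≈ᶜ fromℚᶜ q *ᶜ (𝕚 *ᶜ fromℝ x)
𝕚*-scale x q = ≈ᶜ-trans (*ᶜ-cong ≈ᶜ-refl (fromℝ-* x (fromℚ q)))
  (solve 3 (λ i x q → i :* (x :* q) := q :* (i :* x)) ≈ᶜ-refl 𝕚 (fromℝ x) (fromℚᶜ q))
  where
  open ℂ-Solver

module _ {π} (isPi : IsPi π) where
  open IsPi isPi

  -- Since sin π = 0, `cis π` equals its conjugate, so its square is z z̄ = 1.
  exp-2π𝕚 : exp (fromℚᶜ (ι 2) *ᶜ (𝕚 *ᶜ fromℝ π)) ≈ᶜ 1ᶜ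
  exp-2π𝕚 = begin
    exp (fromℚᶜ (ι 2) *ᶜ (𝕚 *ᶜ fromℝ π))   ≈⟨ exp-×ℕ 2 (𝕚 *ᶜ fromℝ π) ⟩
    cis π *ᶜ (cis π *ᶜ 1ᶜ)                 ≈⟨ *ᶜ-cong ≈ᶜ-refl (ℂᴿ.*-identityʳ (cis π)) ⟩
    cis π *ᶜ cis π                         ≈⟨ *ᶜ-cong ≈ᶜ-refl real ⟩
    cis π *ᶜ conj (cis π)                  ≈⟨ cis-unit π ⟩
    1ᶜ                                     ∎
    where
    open ≈ᶜ-Reasoning
    real : cis π ≈ᶜ conj (cis π)
    real = begin
      cis π                                              ≈⟨ cis≈ π ⟩
      fromℝ (cos π) +ᶜ 𝕚 *ᶜ fromℝ (sin π)                ≈⟨ +ᶜ-cong ≈ᶜ-refl (*ᶜ-cong ≈ᶜ-refl (fromℝ-cong {sin π} {0ʳ} sin≃0)) ⟩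
      fromℝ (cos π) +ᶜ 𝕚 *ᶜ 0ᶜ                           ≈⟨ solve 2 (λ c i → c :+ i :* con 0ℚ := c :+ :- (i :* con 0ℚ)) ≈ᶜ-refl (fromℝ (cos π)) 𝕚 ⟩
      fromℝ (cos π) +ᶜ -ᶜ (𝕚 *ᶜ 0ᶜ)                      ≈⟨ +ᶜ-cong ≈ᶜ-refl (-ᶜ-cong (*ᶜ-cong ≈ᶜ-refl (fromℝ-cong {sin π} {0ʳ} sin≃0))) ⟨
      fromℝ (cos π) +ᶜ -ᶜ (𝕚 *ᶜ fromℝ (sin π))           ≈⟨ conj-cis π ⟨
      conj (cis π)                                       ∎
      where
      open ℂ-Solver

  0<sin : ∀ j N .{{_ : ℕ.NonZero N}} → 1 ℕ.≤ j → j ℕ.< N → 0ʳ < sin (π *ʳ fromℚ (ι j ℚ.* 1/ N))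
  0<sin j N 1≤j j<N = least (π *ʳ fromℚ q) (0<scale {π} q {{j/N-positive j N 1≤j}} positive) (scale<1 {π} q (1-j/N-positive j N j<N) positive)
    where
    q : ℚ
    q = ι j ℚ.* 1/ N

  -- The root is exp(2πi/N). Its jth power is the square of `cis` at half the angle, θ = π j/N, and
  -- for 0 < j < N this θ lies in (0 , π), where the sine is positive.
  primitiveRoot : ∀ N .{{_ : ℕ.NonZero N}} → PrimitiveRoot N
  primitiveRoot N = record
    { ω = root
    ; ω^N = begin
        root ^ᶜ N                                            ≈⟨ exp-×ℕ N (fromℚᶜ (1/ N) *ᶜ 2πi) ⟨
        exp (fromℚᶜ (ι N) *ᶜ (fromℚᶜ (1/ N) *ᶜ 2πi))         ≈⟨ exp-cong (*ᶜ-assoc (fromℚᶜ (ι N)) (fromℚᶜ (1/ N)) 2πi) ⟨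
        exp ((fromℚᶜ (ι N) *ᶜ fromℚᶜ (1/ N)) *ᶜ 2πi)         ≈⟨ exp-cong (*ᶜ-cong (fromℚᶜ-* (ι N) (1/ N)) ≈ᶜ-refl) ⟨
        exp (fromℚᶜ (ι N ℚ.* 1/ N) *ᶜ 2πi)                   ≡⟨ cong (λ q → exp (fromℚᶜ q *ᶜ 2πi)) (trans (ℚ.*-comm (ι N) (1/ N)) (/*ι N)) ⟩
        exp (1ᶜ *ᶜ 2πi)                                      ≈⟨ exp-cong (*ᶜ-identityˡ 2πi) ⟩
        exp 2πi                                              ≈⟨ exp-2π𝕚 ⟩
        1ᶜ                                                   ∎
    ; separated = λ j 1≤j j<N s p → cis²-cancel (θ j) (0<sin j N 1≤j j<N) s
        (≈ᶜ-trans (*ᶜ-cong (+ᶜ-cong (≈ᶜ-sym (root^j j)) ≈ᶜ-refl) ≈ᶜ-refl) p)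
    }
    where
    open ≈ᶜ-Reasoning
    2πi root : ℂ
    2πi = fromℚᶜ (ι 2) *ᶜ (𝕚 *ᶜ fromℝ π)
    root = exp (fromℚᶜ (1/ N) *ᶜ 2πi)
    θ : ℕ → ℝ
    θ j = π *ʳ fromℚ (ι j ℚ.* 1/ N)
    root^j : ∀ j → root ^ᶜ j ≈ᶜ cis (θ j) *ᶜ cis (θ j)
    root^j j = begin
      root ^ᶜ j                                                          ≈⟨ exp-×ℕ j (fromℚᶜ (1/ N) *ᶜ 2πi) ⟨
      exp (fromℚᶜ (ι j) *ᶜ (fromℚᶜ (1/ N) *ᶜ 2πi))                       ≈⟨ exp-cong arg ⟩
      exp (𝕚 *ᶜ fromℝ (θ j) +ᶜ 𝕚 *ᶜ fromℝ (θ j))                         ≈⟨ exp-+ _ _ ⟩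
      cis (θ j) *ᶜ cis (θ j)                                             ∎
      where
      open ℂ-Solver
      arg : fromℚᶜ (ι j) *ᶜ (fromℚᶜ (1/ N) *ᶜ 2πi) ≈ᶜ 𝕚 *ᶜ fromℝ (θ j) +ᶜ 𝕚 *ᶜ fromℝ (θ j)
      arg = begin
        fromℚᶜ (ι j) *ᶜ (fromℚᶜ (1/ N) *ᶜ 2πi)
          ≈⟨ *ᶜ-cong ≈ᶜ-refl (*ᶜ-cong ≈ᶜ-refl (≈ᶜ-sym (×ᶜ≈* 2 (𝕚 *ᶜ fromℝ π)))) ⟩
        fromℚᶜ (ι j) *ᶜ (fromℚᶜ (1/ N) *ᶜ (𝕚 *ᶜ fromℝ π +ᶜ (𝕚 *ᶜ fromℝ π +ᶜ 0ᶜ)))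
          ≈⟨ solve 3 (λ j n x → j :* (n :* (x :+ (x :+ con 0ℚ))) := (j :* n) :* x :+ (j :* n) :* x) ≈ᶜ-refl (fromℚᶜ (ι j)) (fromℚᶜ (1/ N)) (𝕚 *ᶜ fromℝ π) ⟩
        (fromℚᶜ (ι j) *ᶜ fromℚᶜ (1/ N)) *ᶜ (𝕚 *ᶜ fromℝ π) +ᶜ (fromℚᶜ (ι j) *ᶜ fromℚᶜ (1/ N)) *ᶜ (𝕚 *ᶜ fromℝ π)
          ≈⟨ +ᶜ-cong half half ⟨
        𝕚 *ᶜ fromℝ (θ j) +ᶜ 𝕚 *ᶜ fromℝ (θ j) ∎
        where
        half : 𝕚 *ᶜ fromℝ (θ j) ≈ᶜ (fromℚᶜ (ι j) *ᶜ fromℚᶜ (1/ N)) *ᶜ (𝕚 *ᶜ fromℝ π)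
        half = ≈ᶜ-trans (𝕚*-scale π (ι j ℚ.* 1/ N)) (*ᶜ-cong (fromℚᶜ-* (ι j) (1/ N)) ≈ᶜ-refl)

-- Integers inside the complex numbers

/1-+ : ∀ i j → (i ℤ.+ j) ℚ./ 1 ≡ i ℚ./ 1 ℚ.+ j ℚ./ 1
/1-+ i j = ℚ.toℚᵘ-injective (begin
  ℚ.toℚᵘ ((i ℤ.+ j) ℚ./ 1)                 ≈⟨ toℚᵘ-/1 (i ℤ.+ j) ⟩
  ℚᵘ.mkℚᵘ (i ℤ.+ j) 0                      ≈⟨ ℚᵘ.*≡* (cong (ℤ._* + 1) (cong₂ ℤ._+_ (ℤ.*-identityʳ i) (ℤ.*-identityʳ j))) ⟨
  ℚᵘ.mkℚᵘ i 0 ℚᵘ.+ ℚᵘ.mkℚᵘ j 0             ≈⟨ ℚᵘ.+-cong (toℚᵘ-/1 i) (toℚᵘ-/1 j) ⟨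
  ℚ.toℚᵘ (i ℚ./ 1) ℚᵘ.+ ℚ.toℚᵘ (j ℚ./ 1)   ≈⟨ ℚ.toℚᵘ-homo-+ (i ℚ./ 1) (j ℚ./ 1) ⟨
  ℚ.toℚᵘ (i ℚ./ 1 ℚ.+ j ℚ./ 1)             ∎)
  where
  open SetoidReasoning ℚᵘ.≃-setoid

/1-* : ∀ i j → (i ℤ.* j) ℚ./ 1 ≡ (i ℚ./ 1) ℚ.* (j ℚ./ 1)
/1-* i j = ℚ.toℚᵘ-injective (begin
  ℚ.toℚᵘ ((i ℤ.* j) ℚ./ 1)                 ≈⟨ toℚᵘ-/1 (i ℤ.* j) ⟩
  ℚᵘ.mkℚᵘ (i ℤ.* j) 0                      ≈⟨ ℚᵘ.*-cong (toℚᵘ-/1 i) (toℚᵘ-/1 j) ⟨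
  ℚ.toℚᵘ (i ℚ./ 1) ℚᵘ.* ℚ.toℚᵘ (j ℚ./ 1)   ≈⟨ ℚ.toℚᵘ-homo-* (i ℚ./ 1) (j ℚ./ 1) ⟨
  ℚ.toℚᵘ ((i ℚ./ 1) ℚ.* (j ℚ./ 1))             ∎)
  where
  open SetoidReasoning ℚᵘ.≃-setoid

/1-injective : ∀ {i j} → i ℚ./ 1 ≡ j ℚ./ 1 → i ≡ j
/1-injective {i} {j} eq with ℚᵘ.*≡* p ← ℚᵘ.≃-trans (ℚᵘ.≃-sym (toℚᵘ-/1 i)) (ℚᵘ.≃-trans (ℚᵘ.≃-reflexive (cong ℚ.toℚᵘ eq)) (toℚᵘ-/1 j)) =
  trans (sym (ℤ.*-identityʳ i)) (trans p (ℤ.*-identityʳ j))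

fromℤ-+ : ∀ i j → fromℤ (i ℤ.+ j) ≈ᶜ fromℤ i +ᶜ fromℤ j
fromℤ-+ i j = subst (λ q → fromℚᶜ q ≈ᶜ fromℤ i +ᶜ fromℤ j) (sym (/1-+ i j)) (fromℚᶜ-+ (i ℚ./ 1) (j ℚ./ 1))

fromℤ-* : ∀ i j → fromℤ (i ℤ.* j) ≈ᶜ fromℤ i *ᶜ fromℤ j
fromℤ-* i j = subst (λ q → fromℚᶜ q ≈ᶜ fromℤ i *ᶜ fromℤ j) (sym (/1-* i j)) (fromℚᶜ-* (i ℚ./ 1) (j ℚ./ 1))

opaque
  unfolding ι

  fromℤ-+ℕ : ∀ n → fromℤ (+ n) ≡ fromℚᶜ (ι n)
  fromℤ-+ℕ n = refl

fromℤ-injective : ∀ {i j} → fromℤ i ≈ᶜ fromℤ j → i ≡ j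
fromℤ-injective (mk≈ (p , _)) = /1-injective (fromℚ-injective p)

exp-×ℤ : ∀ m z → exp z ≈ᶜ 1ᶜ → exp (fromℤ m *ᶜ z) ≈ᶜ 1ᶜ
exp-×ℤ (+ n) z p = ≈ᶜ-trans (subst (λ w → exp (fromℤ (+ n) *ᶜ z) ≈ᶜ exp (w *ᶜ z)) (fromℤ-+ℕ n) ≈ᶜ-refl)
  (≈ᶜ-trans (exp-×ℕ n z) (≈ᶜ-trans (^ᶜ-cong n p) (1^ᶜ n)))
exp-×ℤ -[1+ n ] z p = begin
  exp (fromℤ -[1+ n ] *ᶜ z)                                    ≈⟨ *ᶜ-identityˡ _ ⟨
  -- The opposite multiple has exponential 1 by the case of natural numbers; inserted as a factor,
  -- it cancels the exponent.
  1ᶜ *ᶜ exp (fromℤ -[1+ n ] *ᶜ z)                              ≈⟨ *ᶜ-cong (exp-×ℤ (+ suc n) z p) ≈ᶜ-refl ⟨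
  exp (fromℤ (+ suc n) *ᶜ z) *ᶜ exp (fromℤ -[1+ n ] *ᶜ z)      ≈⟨ exp-+ _ _ ⟨
  exp (fromℤ (+ suc n) *ᶜ z +ᶜ fromℤ -[1+ n ] *ᶜ z)            ≈⟨ exp-cong (ℂᴿ.distribʳ z (fromℤ (+ suc n)) (fromℤ -[1+ n ])) ⟨
  exp ((fromℤ (+ suc n) +ᶜ fromℤ -[1+ n ]) *ᶜ z)               ≈⟨ exp-cong (*ᶜ-cong (fromℤ-+ (+ suc n) -[1+ n ]) ≈ᶜ-refl) ⟨
  exp (fromℤ (+ suc n ℤ.+ -[1+ n ]) *ᶜ z)                      ≡⟨ cong (λ i → exp (fromℤ i *ᶜ z)) (ℤ.+-inverseʳ (+ suc n)) ⟩
  exp (fromℤ (+ 0) *ᶜ z)                                       ≈⟨ exp-×ℤ (+ 0) z p ⟩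
  1ᶜ                                                           ∎
  where
  open ≈ᶜ-Reasoning

-- Characters of a finite abelian group

module _ {N} .{{_ : ℕ.NonZero N}} (ζ : PrimitiveRoot N) where
  open PrimitiveRoot ζ

  ω^[N*] : ∀ m → ω ^ᶜ (m ℕ.* N) ≈ᶜ 1ᶜ
  ω^[N*] m = ≈ᶜ-trans (^ᶜ-* ω N m) (≈ᶜ-trans (^ᶜ-cong m ω^N) (1^ᶜ m))

  ω^-% : ∀ m → ω ^ᶜ m ≈ᶜ ω ^ᶜ (m % N)
  ω^-% m = begin
    ω ^ᶜ m                                          ≡⟨ cong (ω ^ᶜ_) (m≡m%n+[m/n]*n m N) ⟩
    ω ^ᶜ (m % N ℕ.+ m ℕ./ N ℕ.* N)                  ≈⟨ ^ᶜ-+ ω (m % N) (m ℕ./ N ℕ.* N) ⟩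
    ω ^ᶜ (m % N) *ᶜ ω ^ᶜ (m ℕ./ N ℕ.* N)            ≈⟨ *ᶜ-cong ≈ᶜ-refl (ω^[N*] (m ℕ./ N)) ⟩
    ω ^ᶜ (m % N) *ᶜ 1ᶜ                              ≈⟨ ℂᴿ.*-identityʳ _ ⟩
    ω ^ᶜ (m % N)                                    ∎
    where
    open ≈ᶜ-Reasoning

  ω^-cancel : ∀ m {s} → ω ^ᶜ m *ᶜ s ≈ᶜ 0ᶜ → s ≈ᶜ 0ᶜ
  ω^-cancel m {s} p = begin
    s                                               ≈⟨ *ᶜ-identityˡ s ⟨
    1ᶜ *ᶜ s                                         ≈⟨ *ᶜ-cong (ω^[N*] m) ≈ᶜ-refl ⟨
    -- As m N = m (N - 1) + m, the power ω^(m (N - 1)) is an inverse of ω^m.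
    ω ^ᶜ (m ℕ.* N) *ᶜ s                             ≡⟨ cong (λ k → ω ^ᶜ k *ᶜ s) (trans (cong (m ℕ.*_) (sym (ℕ.suc-pred N))) (trans (ℕ.*-suc m (ℕ.pred N)) (ℕ.+-comm m _))) ⟩
    ω ^ᶜ (m ℕ.* ℕ.pred N ℕ.+ m) *ᶜ s                ≈⟨ *ᶜ-cong (^ᶜ-+ ω (m ℕ.* ℕ.pred N) m) ≈ᶜ-refl ⟩
    (ω ^ᶜ (m ℕ.* ℕ.pred N) *ᶜ ω ^ᶜ m) *ᶜ s          ≈⟨ *ᶜ-assoc _ _ s ⟩
    ω ^ᶜ (m ℕ.* ℕ.pred N) *ᶜ (ω ^ᶜ m *ᶜ s)          ≈⟨ *ᶜ-cong ≈ᶜ-refl p ⟩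
    ω ^ᶜ (m ℕ.* ℕ.pred N) *ᶜ 0ᶜ                     ≈⟨ ℂᴿ.zeroʳ _ ⟩
    0ᶜ                                              ∎
    where
    open ≈ᶜ-Reasoning

  private
    <-separated : ∀ {c d} → c ℕ.< d → d ℕ.< N → ∀ {s} → ω ^ᶜ c *ᶜ s ≈ᶜ ω ^ᶜ d *ᶜ s → s ≈ᶜ 0ᶜ
    <-separated {c} {d} c<d d<N {s} p = separated (d ∸ c) (ℕ.m<n⇒0<n∸m c<d) (ℕ.≤-<-trans (ℕ.m∸n≤m d c) d<N) s (ω^-cancel c (begin
      ω ^ᶜ c *ᶜ ((ω ^ᶜ (d ∸ c) +ᶜ -ᶜ 1ᶜ) *ᶜ s)
        ≈⟨ solve 3 (λ x y s → x :* ((y :+ :- con 1ℚ) :* s) := (x :* y) :* s :+ :- (x :* s)) ≈ᶜ-refl (ω ^ᶜ c) (ω ^ᶜ (d ∸ c)) s ⟩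
      (ω ^ᶜ c *ᶜ ω ^ᶜ (d ∸ c)) *ᶜ s +ᶜ -ᶜ (ω ^ᶜ c *ᶜ s)
        ≈⟨ +ᶜ-cong (*ᶜ-cong (^ᶜ-+ ω c (d ∸ c)) ≈ᶜ-refl) ≈ᶜ-refl ⟨
      ω ^ᶜ (c ℕ.+ (d ∸ c)) *ᶜ s +ᶜ -ᶜ (ω ^ᶜ c *ᶜ s)
        ≡⟨ cong (λ k → ω ^ᶜ k *ᶜ s +ᶜ -ᶜ (ω ^ᶜ c *ᶜ s)) (ℕ.m+[n∸m]≡n (ℕ.<⇒≤ c<d)) ⟩
      ω ^ᶜ d *ᶜ s +ᶜ -ᶜ (ω ^ᶜ c *ᶜ s)
        ≈⟨ +ᶜ-cong ≈ᶜ-refl (-ᶜ-cong p) ⟩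
      ω ^ᶜ d *ᶜ s +ᶜ -ᶜ (ω ^ᶜ d *ᶜ s)
        ≈⟨ ℂᴿ.-‿inverseʳ _ ⟩
      0ᶜ ∎))
      where
      open ≈ᶜ-Reasoning
      open ℂ-Solver

  -- Two distinct eigenvalues for one translation force the eigenfunction to vanish. After reduction
  -- modulo N the smaller power of ω is factored out, which leaves ω^j - 1 with 0 < j < N.
  %-separated : ∀ c d → ¬ c % N ≡ d % N → ∀ {s} → ω ^ᶜ c *ᶜ s ≈ᶜ ω ^ᶜ d *ᶜ s → s ≈ᶜ 0ᶜ
  %-separated c d c≢d {s} p = compare (≈ᶜ-trans (*ᶜ-cong (≈ᶜ-sym (ω^-% c)) ≈ᶜ-refl) (≈ᶜ-trans p (*ᶜ-cong (ω^-% d) ≈ᶜ-refl)))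
    where
    compare : ω ^ᶜ (c % N) *ᶜ s ≈ᶜ ω ^ᶜ (d % N) *ᶜ s → s ≈ᶜ 0ᶜ
    compare q with ℕ.<-cmp (c % N) (d % N)
    ... | tri< c<d _ _ = <-separated c<d (m%n<n d N) q
    ... | tri≈ _ c≡d _ = contradiction c≡d c≢d
    ... | tri> _ _ d<c = <-separated d<c (m%n<n c N) (≈ᶜ-sym q)

  -- Multiplied by ω^j - 1, the geometric sum becomes ω^(jN) - 1 = 0, and the factor is cancelled by
  -- `separated`.
  ∑ω : ∀ j → 1 ℕ.≤ j → j ℕ.< N → ∑< N (λ a → ω ^ᶜ (a ℕ.* j)) ≈ᶜ 0ᶜ
  ∑ω j 1≤j j<N = separated j 1≤j j<N _ (begin
    (ω ^ᶜ j +ᶜ -ᶜ 1ᶜ) *ᶜ ∑< N (λ a → ω ^ᶜ (a ℕ.* j))      ≈⟨ *ᶜ-cong ≈ᶜ-refl (∑<-cong N (λ a → ^ᶜ-* ω j a)) ⟩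
    (ω ^ᶜ j +ᶜ -ᶜ 1ᶜ) *ᶜ ∑< N ((ω ^ᶜ j) ^ᶜ_)              ≈⟨ geometric (ω ^ᶜ j) N ⟩
    (ω ^ᶜ j) ^ᶜ N +ᶜ -ᶜ 1ᶜ                               ≈⟨ +ᶜ-cong (≈ᶜ-trans (≈ᶜ-sym (^ᶜ-* ω j N)) (subst (λ k → ω ^ᶜ k ≈ᶜ 1ᶜ) (ℕ.*-comm j N) (ω^[N*] j))) ≈ᶜ-refl ⟩
    1ᶜ +ᶜ -ᶜ 1ᶜ                                          ≈⟨ ℂᴿ.-‿inverseʳ 1ᶜ ⟩
    0ᶜ                                                   ∎)
    where
    open ≈ᶜ-Reasoning

module _ {c ℓ} (H : FiniteAbelianGroup c ℓ) where
  open FiniteAbelianGroup H hiding (sym; trans)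
  private
    module H = AbelianGroup abelianGroup
    module HP = AbelianGroupProperties abelianGroup

  Respectful : (Carrier → ℂ) → Set (c ⊔ ℓ)
  Respectful φ = ∀ {x y} → x ≈ y → φ x ≈ᶜ φ y

  element-index : ∀ x → element (index x) ≈ x
  element-index = Inverse.strictlyInverseʳ enumeration

  ⊖-⊖ : ∀ x y z → (x ⊖ y) ⊖ z ≈ x ⊖ (y ⊕ z)
  ⊖-⊖ x y z = H.trans (H.assoc x _ _) (H.∙-congˡ (HP.⁻¹-∙-comm y z))

  ⊖-⊕-comm : ∀ x y z → (x ⊖ y) ⊕ z ≈ (x ⊕ z) ⊖ y
  ⊖-⊕-comm x y z = H.trans (H.assoc x _ z) (H.trans (H.∙-congˡ (H.comm _ z)) (H.sym (H.assoc x z _)))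

  ⊖-⊕-cancel : ∀ x y z → (x ⊖ y) ⊕ (y ⊕ z) ≈ x ⊕ z
  ⊖-⊕-cancel x y z = H.trans (H.sym (H.assoc _ y z)) (H.∙-congʳ (H.trans (H.assoc x _ y) (H.trans (H.∙-congˡ (H.inverseˡ y)) (H.identityʳ x))))

  module _ {N} .{{_ : ℕ.NonZero N}} (ζ : PrimitiveRoot N) (annihilates : ∀ x → N ×ᴳ x ≈ 0#) where
    open PrimitiveRoot ζ

    -- The eigenvalue is given by its exponent: natural numbers can be compared modulo N, complex
    -- numbers cannot be compared at all.
    TranslationEigen : (Carrier → ℂ) → Carrier → Set c
    TranslationEigen φ h = ∃[ a ] (∀ x → φ (x ⊖ h) ≈ᶜ ω ^ᶜ a *ᶜ φ x)

    -- A discrete Fourier coefficient along the multiples of h. The length N need only be a multiple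
    -- of the order of h, so one root of unity serves all h.
    eigenprojection : Carrier → ℕ → (Carrier → ℂ) → Carrier → ℂ
    eigenprojection h a φ x = fromℚᶜ (1/ N) *ᶜ ∑< N (λ j → ω ^ᶜ (a ℕ.* j) *ᶜ φ (x ⊕ j ×ᴳ h))

    eigenprojection-respectful : ∀ h a {φ} → Respectful φ → Respectful (eigenprojection h a φ)
    eigenprojection-respectful h a φ-resp x≈y = *ᶜ-cong ≈ᶜ-refl (∑<-cong N (λ j → *ᶜ-cong (≈ᶜ-refl {ω ^ᶜ (a ℕ.* j)}) (φ-resp (H.∙-congʳ {j ×ᴳ h} x≈y))))

    -- The projection is a combination of translations, and these commute with translation by k;
    -- eigenvalues already obtained survive later projections.
    eigenprojection-commutes : ∀ h a {φ} → Respectful φ → ∀ {k} → TranslationEigen φ k → TranslationEigen (eigenprojection h a φ) k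
    eigenprojection-commutes h a {φ} φ-resp {k} (b , eigen) = b , λ x → begin
      fromℚᶜ (1/ N) *ᶜ ∑< N (λ j → ω ^ᶜ (a ℕ.* j) *ᶜ φ ((x ⊖ k) ⊕ j ×ᴳ h))
        ≈⟨ *ᶜ-cong ≈ᶜ-refl (∑<-cong N (λ j → ≈ᶜ-trans
             (*ᶜ-cong (≈ᶜ-refl {ω ^ᶜ (a ℕ.* j)}) (≈ᶜ-trans (φ-resp (⊖-⊕-comm x k (j ×ᴳ h))) (eigen (x ⊕ j ×ᴳ h))))
             (solve 3 (λ x y z → x :* (y :* z) := y :* (x :* z)) ≈ᶜ-refl (ω ^ᶜ (a ℕ.* j)) (ω ^ᶜ b) (φ (x ⊕ j ×ᴳ h))))) ⟩
      fromℚᶜ (1/ N) *ᶜ ∑< N (λ j → ω ^ᶜ b *ᶜ (ω ^ᶜ (a ℕ.* j) *ᶜ φ (x ⊕ j ×ᴳ h)))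
        ≈⟨ *ᶜ-cong ≈ᶜ-refl (*-distribˡ-sum {N} (ω ^ᶜ b) (λ j → ω ^ᶜ (a ℕ.* toℕ j) *ᶜ φ (x ⊕ toℕ j ×ᴳ h))) ⟨
      fromℚᶜ (1/ N) *ᶜ (ω ^ᶜ b *ᶜ ∑< N (λ j → ω ^ᶜ (a ℕ.* j) *ᶜ φ (x ⊕ j ×ᴳ h)))
        ≈⟨ solve 3 (λ x y z → x :* (y :* z) := y :* (x :* z)) ≈ᶜ-refl (fromℚᶜ (1/ N)) (ω ^ᶜ b) _ ⟩
      ω ^ᶜ b *ᶜ eigenprojection h a φ x ∎
      where
      open ≈ᶜ-Reasoning
      open ℂ-Solver

    -- Translating by -h shifts j by one, which takes a factor ω^a out of each term. The sum over a
    -- full period does not change under this shift.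
    eigenprojection-eigen : ∀ h a {φ} → Respectful φ → TranslationEigen (eigenprojection h a φ) h
    eigenprojection-eigen h a {φ} φ-resp = a , λ x → begin
      fromℚᶜ (1/ N) *ᶜ ∑< N (g x)
        ≈⟨ *ᶜ-cong ≈ᶜ-refl (cyclic x) ⟩
      fromℚᶜ (1/ N) *ᶜ ∑< N (λ j → g x (suc j))
        ≈⟨ *ᶜ-cong ≈ᶜ-refl (∑<-cong N (g-suc x)) ⟩
      fromℚᶜ (1/ N) *ᶜ ∑< N (λ j → ω ^ᶜ a *ᶜ (ω ^ᶜ (a ℕ.* j) *ᶜ φ (x ⊕ j ×ᴳ h)))
        ≈⟨ *ᶜ-cong ≈ᶜ-refl (*-distribˡ-sum {N} (ω ^ᶜ a) (λ j → ω ^ᶜ (a ℕ.* toℕ j) *ᶜ φ (x ⊕ toℕ j ×ᴳ h))) ⟨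
      fromℚᶜ (1/ N) *ᶜ (ω ^ᶜ a *ᶜ ∑< N (λ j → ω ^ᶜ (a ℕ.* j) *ᶜ φ (x ⊕ j ×ᴳ h)))
        ≈⟨ solve 3 (λ x y z → x :* (y :* z) := y :* (x :* z)) ≈ᶜ-refl (fromℚᶜ (1/ N)) (ω ^ᶜ a) _ ⟩
      ω ^ᶜ a *ᶜ eigenprojection h a φ x ∎
      where
      open ≈ᶜ-Reasoning
      open ℂ-Solver
      g : Carrier → ℕ → ℂ
      g x j = ω ^ᶜ (a ℕ.* j) *ᶜ φ ((x ⊖ h) ⊕ j ×ᴳ h)
      g-suc : ∀ x j → g x (suc j) ≈ᶜ ω ^ᶜ a *ᶜ (ω ^ᶜ (a ℕ.* j) *ᶜ φ (x ⊕ j ×ᴳ h))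
      g-suc x j = ≈ᶜ-trans
        (*ᶜ-cong (≈ᶜ-trans (subst (λ k → ω ^ᶜ k ≈ᶜ ω ^ᶜ (a ℕ.+ a ℕ.* j)) (sym (ℕ.*-suc a j)) ≈ᶜ-refl) (^ᶜ-+ ω a (a ℕ.* j)))
                 (φ-resp (⊖-⊕-cancel x h (j ×ᴳ h))))
        (*ᶜ-assoc _ _ _)
      periodic : ∀ x → g x N ≈ᶜ g x 0
      periodic x = *ᶜ-cong (≈ᶜ-trans (ω^[N*] ζ a) (subst (λ k → 1ᶜ ≈ᶜ ω ^ᶜ k) (sym (ℕ.*-zeroʳ a)) ≈ᶜ-refl))
                           (φ-resp (H.∙-congˡ (annihilates h)))
      -- The two sums differ by the terms at N and at 0, which agree because ω^N = 1 and N h = 0.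
      cyclic : ∀ x → ∑< N (g x) ≈ᶜ ∑< N (λ j → g x (suc j))
      cyclic x = begin
        ∑< N (g x)                                           ≈⟨ solve 2 (λ s y → s := (s :+ y) :+ :- y) ≈ᶜ-refl (∑< N (g x)) (g x N) ⟩
        (∑< N (g x) +ᶜ g x N) +ᶜ -ᶜ g x N                    ≈⟨ +ᶜ-cong (≈ᶜ-sym (∑<-suc N (g x))) (-ᶜ-cong (periodic x)) ⟩
        (g x 0 +ᶜ ∑< N (λ j → g x (suc j))) +ᶜ -ᶜ g x 0      ≈⟨ solve 2 (λ s y → (y :+ s) :+ :- y := s) ≈ᶜ-refl (∑< N (λ j → g x (suc j))) (g x 0) ⟩
        ∑< N (λ j → g x (suc j))                             ∎

    -- After exchanging the sums, the coefficient of φ(x + j h) is the sum of ω^(a j) over a. It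
    -- vanishes for 0 < j < N and equals N for j = 0, which the factor N⁻¹ cancels.
    ∑-eigenprojection : ∀ h {φ} → Respectful φ → ∀ x → ∑< N (λ a → eigenprojection h a φ x) ≈ᶜ φ x
    ∑-eigenprojection h {φ} φ-resp x = begin
      ∑< N (λ a → fromℚᶜ (1/ N) *ᶜ ∑< N (λ j → ω ^ᶜ (a ℕ.* j) *ᶜ ψ j))
        ≈⟨ *-distribˡ-sum {N} (fromℚᶜ (1/ N)) (λ a → ∑< N (λ j → ω ^ᶜ (toℕ a ℕ.* j) *ᶜ ψ j)) ⟨
      fromℚᶜ (1/ N) *ᶜ ∑< N (λ a → ∑< N (λ j → ω ^ᶜ (a ℕ.* j) *ᶜ ψ j))
        ≈⟨ *ᶜ-cong ≈ᶜ-refl (∑-comm {N} {N} (λ a j → ω ^ᶜ (toℕ a ℕ.* toℕ j) *ᶜ ψ (toℕ j))) ⟩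
      fromℚᶜ (1/ N) *ᶜ ∑< N (λ j → ∑< N (λ a → ω ^ᶜ (a ℕ.* j) *ᶜ ψ j))
        ≈⟨ *ᶜ-cong ≈ᶜ-refl (∑<-cong N (λ j → ≈ᶜ-sym (*-distribʳ-sum {N} (ψ j) (λ a → ω ^ᶜ (toℕ a ℕ.* j))))) ⟩
      fromℚᶜ (1/ N) *ᶜ ∑< N F
        ≈⟨ *ᶜ-cong ≈ᶜ-refl (≈ᶜ-trans (only-first N ℕ.≤-refl) first) ⟩
      fromℚᶜ (1/ N) *ᶜ (fromℚᶜ (ι N) *ᶜ ψ 0)
        ≈⟨ *ᶜ-assoc _ _ _ ⟨
      (fromℚᶜ (1/ N) *ᶜ fromℚᶜ (ι N)) *ᶜ ψ 0
        ≈⟨ *ᶜ-cong (fromℚᶜ-* (1/ N) (ι N)) ≈ᶜ-refl ⟨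
      fromℚᶜ (1/ N ℚ.* ι N) *ᶜ ψ 0
        ≡⟨ cong (λ q → fromℚᶜ q *ᶜ ψ 0) (/*ι N) ⟩
      1ᶜ *ᶜ ψ 0
        ≈⟨ *ᶜ-identityˡ (ψ 0) ⟩
      ψ 0
        ≈⟨ φ-resp (H.identityʳ x) ⟩
      φ x ∎
      where
      open ≈ᶜ-Reasoning
      ψ F : ℕ → ℂ
      ψ j = φ (x ⊕ j ×ᴳ h)
      F j = ∑< N (λ a → ω ^ᶜ (a ℕ.* j)) *ᶜ ψ j
      first : F 0 ≈ᶜ fromℚᶜ (ι N) *ᶜ ψ 0
      first = *ᶜ-cong (begin
        ∑< N (λ a → ω ^ᶜ (a ℕ.* 0))   ≈⟨ ∑<-cong N (λ a → subst (λ k → ω ^ᶜ k ≈ᶜ 1ᶜ) (sym (ℕ.*-zeroʳ a)) ≈ᶜ-refl) ⟩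
        ∑< N (λ a → 1ᶜ)               ≈⟨ ones N ⟩
        fromℚᶜ (ι N)                  ∎) ≈ᶜ-refl
        where
        ones : ∀ n → ∑< n (λ a → 1ᶜ) ≈ᶜ fromℚᶜ (ι n)
        ones zero    = subst (λ q → 0ᶜ ≈ᶜ fromℚᶜ q) (sym ι0≡0) ≈ᶜ-refl
        ones (suc n) = begin
          1ᶜ +ᶜ ∑< n (λ a → 1ᶜ)       ≈⟨ +ᶜ-cong (subst (λ q → 1ᶜ ≈ᶜ fromℚᶜ q) (sym ι1≡1) ≈ᶜ-refl) (ones n) ⟩
          fromℚᶜ (ι 1) +ᶜ fromℚᶜ (ι n) ≈⟨ fromℚᶜ-+ (ι 1) (ι n) ⟨
          fromℚᶜ (ι 1 ℚ.+ ι n)        ≡⟨ cong fromℚᶜ (ι-+ 1 n) ⟩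
          fromℚᶜ (ι (suc n))          ∎
      -- The induction shortens the outer sum alone; the N inside `F` has to stay fixed.
      only-first : ∀ n .{{_ : ℕ.NonZero n}} → n ℕ.≤ N → ∑< n F ≈ᶜ F 0
      only-first (suc zero)    _   = ℂᴿ.+-identityʳ (F 0)
      only-first (suc (suc n)) n≤N = begin
        ∑< (suc (suc n)) F            ≈⟨ ∑<-suc (suc n) F ⟩
        ∑< (suc n) F +ᶜ F (suc n)     ≈⟨ +ᶜ-cong (only-first (suc n) (ℕ.<⇒≤ n≤N))
                                           (≈ᶜ-trans (*ᶜ-cong (∑ω ζ (suc n) (ℕ.s≤s ℕ.z≤n) n≤N) ≈ᶜ-refl) (ℂᴿ.zeroˡ (ψ (suc n)))) ⟩
        F 0 +ᶜ 0ᶜ                     ≈⟨ ℂᴿ.+-identityʳ (F 0) ⟩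
        F 0                           ∎

    module _ {p} (P : (Carrier → ℂ) → Set p)
             (P-resp : ∀ {φ ψ} → (∀ x → φ x ≈ᶜ ψ x) → P φ → P ψ)
             (P-0 : P (λ _ → 0ᶜ))
             (P-+ : ∀ {φ ψ} → P φ → P ψ → P (λ x → φ x +ᶜ ψ x)) where

      P-∑ : ∀ n (φ : ℕ → Carrier → ℂ) → (∀ k → P (φ k)) → P (λ x → ∑< n (λ k → φ k x))
      P-∑ zero    φ p = P-0
      P-∑ (suc n) φ p = P-+ (p 0) (P-∑ n (λ k → φ (suc k)) (λ k → p (suc k)))

      -- A function that is an eigenfunction for the translations in `hs` is split by h into
      -- summands that are eigenfunctions for h as well. The recursion therefore passes to `hs` with
      -- a stronger base case.
      eigen-induction : ∀ hs → (∀ φ → Respectful φ → All (TranslationEigen φ) hs → P φ) → ∀ φ → Respectful φ → P φ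
      eigen-induction []       base φ φ-resp = base φ φ-resp []
      eigen-induction (h ∷ hs) base = eigen-induction hs λ φ φ-resp eigen →
        P-resp (∑-eigenprojection h φ-resp) (P-∑ N (λ a → eigenprojection h a φ) λ a →
          base (eigenprojection h a φ) (eigenprojection-respectful h a φ-resp)
            (eigenprojection-eigen h a φ-resp ∷ All.map (eigenprojection-commutes h a φ-resp) eigen))

      -- This expresses that the eigenfunctions of characters span all functions on H. As an
      -- induction principle it needs neither an enumeration of the characters nor their
      -- orthogonality.
      character-induction :
        (∀ (ψ : Character H) φ → Respectful φ → (∀ x h → φ (x ⊖ h) ≈ᶜ χ ψ h *ᶜ φ x) → P φ) →
        ∀ φ → Respectful φ → P φ
      character-induction base = eigen-induction (List.tabulate element) λ φ φ-resp eigens →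
        character-or-zero φ φ-resp (λ i → All.tabulate⁻ eigens i)
        where
        character-or-zero : ∀ φ → Respectful φ → (∀ i → TranslationEigen φ (element i)) → P φ
        -- Additivity of the exponents modulo N is a decidable condition on finitely many pairs.
        character-or-zero φ φ-resp eigens = decide (Fin.all? λ i → Fin.all? λ j → additive? i j)
          where
          open ≈ᶜ-Reasoning
          exponent : Fin order → ℕ
          exponent i = proj₁ (eigens i)
          Additive : Fin order → Fin order → Set
          Additive i j = exponent (index (element i ⊕ element j)) % N ≡ (exponent i ℕ.+ exponent j) % N
          additive? : ∀ i j → Dec (Additive i j)
          additive? i j = exponent (index (element i ⊕ element j)) % N ℕ.≟ (exponent i ℕ.+ exponent j) % N
          character : Carrier → ℂ
          character h = ω ^ᶜ exponent (index h)
          eigen : ∀ x h → φ (x ⊖ h) ≈ᶜ character h *ᶜ φ x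
          eigen x h = ≈ᶜ-trans (φ-resp (H.∙-congˡ (H.⁻¹-cong (H.sym (element-index h))))) (proj₂ (eigens (index h)) x)
          decide : Dec (∀ i j → Additive i j) → P φ
          decide (yes additive) = base ψ φ φ-resp eigen
            where
            character-cong : ∀ {h k} → h ≈ k → character h ≡ character k
            character-cong h≈k = cong (λ i → ω ^ᶜ exponent i) (Inverse.to-cong enumeration h≈k)
            homo : ∀ h k → character (h ⊕ k) ≈ᶜ character h *ᶜ character k
            homo h k = begin
              character (h ⊕ k)
                ≡⟨ character-cong (H.∙-cong (H.sym (element-index h)) (H.sym (element-index k))) ⟩
              ω ^ᶜ exponent (index (element (index h) ⊕ element (index k)))
                ≈⟨ ω^-% ζ _ ⟩
              ω ^ᶜ (exponent (index (element (index h) ⊕ element (index k))) % N)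
                ≡⟨ cong (ω ^ᶜ_) (additive (index h) (index k)) ⟩
              ω ^ᶜ ((exponent (index h) ℕ.+ exponent (index k)) % N)
                ≈⟨ ω^-% ζ _ ⟨
              ω ^ᶜ (exponent (index h) ℕ.+ exponent (index k))
                ≈⟨ ^ᶜ-+ ω (exponent (index h)) (exponent (index k)) ⟩
              character h *ᶜ character k ∎
            ε-homo : character 0# ≈ᶜ 1ᶜ
            -- From z = z² follows z (z - 1) = 0, and z can be cancelled because it is a power of ω.
            ε-homo = -≈0⇒≈ (ω^-cancel ζ (exponent (index 0#)) (begin
              z *ᶜ (z +ᶜ -ᶜ 1ᶜ)       ≈⟨ solve 1 (λ z → z :* (z :+ :- con 1ℚ) := z :* z :+ :- z) ≈ᶜ-refl z ⟩
              z *ᶜ z +ᶜ -ᶜ z          ≈⟨ +ᶜ-cong (homo 0# 0#) ≈ᶜ-refl ⟨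
              character (0# ⊕ 0#) +ᶜ -ᶜ z ≡⟨ cong (λ w → w +ᶜ -ᶜ z) (character-cong (H.identityˡ 0#)) ⟩
              z +ᶜ -ᶜ z               ≈⟨ ℂᴿ.-‿inverseʳ z ⟩
              0ᶜ                      ∎))
              where
              open ℂ-Solver
              z : ℂ
              z = character 0#
            ψ : Character H
            ψ = record
              { χ = character
              ; isMonoidHomomorphism = record
                { isMagmaHomomorphism = record
                  { isRelHomomorphism = record { cong = λ h≈k → un≈ (ℂᴿ.reflexive (character-cong h≈k)) }
                  ; homo = λ h k → un≈ (homo h k) }
                ; ε-homo = un≈ ε-homo }
              }
          decide (no ¬additive)
            with i , ¬additiveᵢ ← Fin.¬∀⟶∃¬ order (λ i → ∀ j → Additive i j) (λ i → Fin.all? (additive? i)) ¬additive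
            with j , ¬additiveᵢⱼ ← Fin.¬∀⟶∃¬ order (Additive i) (additive? i) ¬additiveᵢ =
            -- Translation by `element i ⊕ element j` multiplies φ by ω to the exponent of the sum,
            -- but also by ω to the sum of the exponents. These differ modulo N, so φ is 0.
            P-resp (λ x → ≈ᶜ-sym (%-separated ζ _ _ ¬additiveᵢⱼ (begin
              ω ^ᶜ exponent (index (element i ⊕ element j)) *ᶜ φ x
                ≈⟨ eigen x (element i ⊕ element j) ⟨
              φ (x ⊖ (element i ⊕ element j))
                ≈⟨ φ-resp (⊖-⊖ x (element i) (element j)) ⟨
              φ ((x ⊖ element i) ⊖ element j)
                ≈⟨ proj₂ (eigens j) (x ⊖ element i) ⟩
              ω ^ᶜ exponent j *ᶜ φ (x ⊖ element i)
                ≈⟨ *ᶜ-cong ≈ᶜ-refl (proj₂ (eigens i) x) ⟩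
              ω ^ᶜ exponent j *ᶜ (ω ^ᶜ exponent i *ᶜ φ x)
                ≈⟨ solve 3 (λ a b c → a :* (b :* c) := (b :* a) :* c) ≈ᶜ-refl (ω ^ᶜ exponent j) (ω ^ᶜ exponent i) (φ x) ⟩
              (ω ^ᶜ exponent i *ᶜ ω ^ᶜ exponent j) *ᶜ φ x
                ≈⟨ *ᶜ-cong (^ᶜ-+ ω (exponent i) (exponent j)) ≈ᶜ-refl ⟨
              ω ^ᶜ (exponent i ℕ.+ exponent j) *ᶜ φ x ∎))) P-0
            where
            open ℂ-Solver

-- The spectrum of the Cayley graph

if-cong : ∀ {b b′} {z z′ w : ℂ} → b ≡ b′ → z ≈ᶜ z′ → (if b then z else w) ≈ᶜ (if b′ then z′ else w)
if-cong {true}  refl z≈z′ = z≈z′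
if-cong {false} refl _    = ≈ᶜ-refl

if-*ʳ : ∀ b z w → (if b then z *ᶜ w else 0ᶜ) ≈ᶜ (if b then z else 0ᶜ) *ᶜ w
if-*ʳ true  z w = ≈ᶜ-refl
if-*ʳ false z w = ≈ᶜ-sym (ℂᴿ.zeroˡ w)

if-*ˡ : ∀ b z w → (if b then z *ᶜ w else 0ᶜ) ≈ᶜ z *ᶜ (if b then w else 0ᶜ)
if-*ˡ true  z w = ≈ᶜ-refl
if-*ˡ false z w = ≈ᶜ-sym (ℂᴿ.zeroʳ z)

if-1-* : ∀ b z → (if b then 1ᶜ else 0ᶜ) *ᶜ z ≈ᶜ (if b then z else 0ᶜ)
if-1-* true  z = *ᶜ-identityˡ z
if-1-* false z = ℂᴿ.zeroˡ z

∑-↑ : ∀ m {n} (f : Fin (m ℕ.+ n) → ℂ) → ∑ f ≈ᶜ ∑ (λ i → f (i ↑ˡ n)) +ᶜ ∑ (λ j → f (m ↑ʳ j))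
∑-↑ zero    f = ≈ᶜ-sym (+ᶜ-identityˡ (∑ f))
∑-↑ (suc m) f = ≈ᶜ-trans (+ᶜ-cong ≈ᶜ-refl (∑-↑ m (λ i → f (suc i)))) (≈ᶜ-sym (+ᶜ-assoc _ _ _))

∑-combine : ∀ m n (f : Fin (m ℕ.* n) → ℂ) → ∑ f ≈ᶜ ∑ {m} (λ q → ∑ {n} (λ r → f (combine q r)))
∑-combine zero    n f = ≈ᶜ-refl
∑-combine (suc m) n f = ≈ᶜ-trans (∑-↑ n f) (+ᶜ-cong ≈ᶜ-refl (∑-combine m n (λ i → f (n ↑ʳ i))))

module _ {c ℓ} (G : FiniteAbelianGroup c ℓ) where
  open FiniteAbelianGroup G hiding (sym; trans)
  private
    module G = AbelianGroup abelianGroup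
    module GP = AbelianGroupProperties abelianGroup
    module E = Inverse enumeration

  index-element : ∀ i → index (element i) ≡ i
  index-element = E.strictlyInverseˡ

  index-injective : ∀ {x y} → index x ≡ index y → x ≈ y
  index-injective {x} {y} eq = G.trans (G.sym (element-index G x)) (G.trans (E.from-cong eq) (element-index G y))

  ⊖-⊖-cancel : ∀ x y → x ⊖ (x ⊖ y) ≈ y
  ⊖-⊖-cancel x y = G.trans (G.∙-congˡ (GP.⁻¹-anti-homo‿- x y)) (G.trans (G.comm x (y ⊖ x)) (G.trans (G.assoc y _ x)
    (G.trans (G.∙-congˡ (G.inverseˡ x)) (G.identityʳ y))))

  ⊖-congʳ : ∀ x {y z} → y ≈ z → x ⊖ y ≈ x ⊖ z
  ⊖-congʳ x y≈z = G.∙-congˡ (G.⁻¹-cong y≈z)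

  reflection : Carrier → Permutation order order
  reflection x = mk↔ₛ′ π π involutive involutive
    where
    π : Fin order → Fin order
    π i = index (x ⊖ element i)
    involutive : ∀ i → π (π i) ≡ i
    involutive i = trans (E.to-cong (G.trans (⊖-congʳ x (element-index G _)) (⊖-⊖-cancel x (element i)))) (index-element i)

  ∑-delta : ∀ x (φ : Carrier → ℂ) → Respectful G φ → ∑ᴳ G (λ y → if does (y ≟ x) then φ y else 0ᶜ) ≈ᶜ φ x
  ∑-delta x φ φ-resp = begin
    ∑ (λ i → if does (element i ≟ x) then φ (element i) else 0ᶜ)
      ≈⟨ sum-cong-≋ (λ i → ≈ᶜ-trans (if-cong (does-⇔ (eq i) (element i ≟ x) (index x Fin.≟ i)) (≈ᶜ-refl {φ (element i)}))
           (≈ᶜ-sym (if-1-* (does (index x Fin.≟ i)) (φ (element i))))) ⟩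
    ∑ (λ i → basis (index x) i *ᶜ φ (element i))
      ≈⟨ basis-· (index x) (λ i → φ (element i)) ⟩
    φ (element (index x))
      ≈⟨ φ-resp (element-index G x) ⟩
    φ x ∎
    where
    open ≈ᶜ-Reasoning
    eq : ∀ i → element i ≈ x ⇔ index x ≡ i
    eq i = mk⇔ (λ p → trans (E.to-cong (G.sym p)) (index-element i)) (λ p → G.trans (E.from-cong (sym p)) (element-index G x))

  module _ {s} (S : Subset G s) where

    does-member-cong : ∀ {x y} → x ≈ y → does (member? S x) ≡ does (member? S y)
    does-member-cong {x} {y} x≈y = does-⇔ (mk⇔ (Subset.respects S x≈y) (Subset.respects S (G.sym x≈y))) (member? S x) (member? S y)

    -- The row of i sums over those j with i - j in S. The substitution j = i - x is an involution
    -- of the group and turns this into a sum over S.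
    adjacency-· : ∀ {φ} → Respectful G φ → ∀ i →
      (adjacency G S · (λ j → φ (element j))) i ≈ᶜ ∑[_] G S (λ x → φ (element i ⊖ x))
    adjacency-· {φ} φ-resp i = ≈ᶜ-sym (≈ᶜ-trans (sum-permute F (reflection (element i))) (sum-cong-≋ (λ j → ≈ᶜ-trans
      (if-cong (does-member-cong (element-index G (element i ⊖ element j)))
               (φ-resp (G.trans (⊖-congʳ (element i) (element-index G _)) (⊖-⊖-cancel (element i) (element j)))))
      (≈ᶜ-sym (if-1-* (does (member? S (element i ⊖ element j))) (φ (element j)))))))
      where
      F : Fin order → ℂ
      F k = if does (member? S (element k)) then φ (element i ⊖ element k) else 0ᶜ

    adjacency-eigen : ∀ {φ} → Respectful G φ → (θ : Carrier → ℂ) → (∀ x y → φ (x ⊖ y) ≈ᶜ θ y *ᶜ φ x) → ∀ i →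
      (adjacency G S · (λ j → φ (element j))) i ≈ᶜ ∑[_] G S θ *ᶜ φ (element i)
    adjacency-eigen {φ} φ-resp θ eigen i = ≈ᶜ-trans (adjacency-· φ-resp i) (≈ᶜ-trans
      (sum-cong-≋ (λ j → ≈ᶜ-trans (if-cong {does (member? S (element j))} refl (eigen (element i) (element j)))
                                  (if-*ʳ (does (member? S (element j))) (θ (element j)) (φ (element i)))))
      (≈ᶜ-sym (*-distribʳ-sum (φ (element i)) (λ j → if does (member? S (element j)) then θ (element j) else 0ᶜ))))

•-eigen : ∀ {n} (M : Matrix n) (v : Vec n) z μ → (∀ i → (M · v) i ≈ᶜ μ *ᶜ v i) → ∀ i → ((z • M) · v) i ≈ᶜ (z *ᶜ μ) *ᶜ v i
•-eigen M v z μ eigen i = begin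
  ∑ (λ j → (z *ᶜ M i j) *ᶜ v j)   ≈⟨ sum-cong-≋ (λ j → *ᶜ-assoc z (M i j) (v j)) ⟩
  ∑ (λ j → z *ᶜ (M i j *ᶜ v j))   ≈⟨ *-distribˡ-sum z (λ j → M i j *ᶜ v j) ⟨
  z *ᶜ (M · v) i                  ≈⟨ *ᶜ-cong ≈ᶜ-refl (eigen i) ⟩
  z *ᶜ (μ *ᶜ v i)                 ≈⟨ *ᶜ-assoc z μ (v i) ⟨
  (z *ᶜ μ) *ᶜ v i                 ∎
  where
  open ≈ᶜ-Reasoning

sign-+ : ∀ x y → sign (x ℙ.+ y) ≈ᶜ sign x *ᶜ sign y
sign-+ 0ℙ y  = ≈ᶜ-sym (*ᶜ-identityˡ (sign y))
sign-+ 1ℙ 0ℙ = ≈ᶜ-sym (ℂᴿ.*-identityʳ (-ᶜ 1ᶜ))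
sign-+ 1ℙ 1ℙ = solve 0 (con 1ℚ := (:- con 1ℚ) :* (:- con 1ℚ)) ≈ᶜ-refl
  where
  open ℂ-Solver

module _ {c ℓ} (H : FiniteAbelianGroup c ℓ) where
  private
    module H = FiniteAbelianGroup H
    module G = FiniteAbelianGroup (ℤ₂ ×ᶠ H)
    module HA = AbelianGroup H.abelianGroup
    module GA = AbelianGroup G.abelianGroup

  ∑ᴳ-ℤ₂× : ∀ φ → ∑ᴳ (ℤ₂ ×ᶠ H) φ ≈ᶜ ∑ᴳ H (λ y → φ (0ℙ , y)) +ᶜ ∑ᴳ H (λ y → φ (1ℙ , y))
  ∑ᴳ-ℤ₂× φ = begin
    ∑ (λ k → φ (G.element k))
      ≈⟨ ∑-combine 2 H.order (λ k → φ (G.element k)) ⟩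
    ∑ {H.order} (λ r → φ (G.element (combine {2} zero r))) +ᶜ (∑ {H.order} (λ r → φ (G.element (combine {2} (suc zero) r))) +ᶜ 0ᶜ)
      ≈⟨ +ᶜ-cong (sum-cong-≋ (λ r → ℂᴿ.reflexive (cong φ (element-combine zero r))))
           (≈ᶜ-trans (ℂᴿ.+-identityʳ _) (sum-cong-≋ (λ r → ℂᴿ.reflexive (cong φ (element-combine (suc zero) r))))) ⟩
    ∑ᴳ H (λ y → φ (0ℙ , y)) +ᶜ ∑ᴳ H (λ y → φ (1ℙ , y)) ∎
    where
    open ≈ᶜ-Reasoning
    element-combine : ∀ q r → G.element (combine q r) ≡ (FiniteAbelianGroup.element ℤ₂ q , H.element r)
    element-combine q r = cong (λ (q , r) → FiniteAbelianGroup.element ℤ₂ q , H.element r) (Fin.remQuot-combine {2} q r)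

  twist : Parity → (H.Carrier → ℂ) → G.Carrier → ℂ
  twist a φ (x , y) = sign (a ℙ.* x) *ᶜ φ y

  twist-respectful : ∀ a {φ} → Respectful H φ → Respectful (ℤ₂ ×ᶠ H) (twist a φ)
  twist-respectful a φ-resp (refl , y≈) = *ᶜ-cong ≈ᶜ-refl (φ-resp y≈)

  twist-translate : ∀ a (ψ : Character H) φ → (∀ y h → φ (y H.⊖ h) ≈ᶜ χ ψ h *ᶜ φ y) → ∀ g k →
    twist a φ (g G.⊖ k) ≈ᶜ productCharacter H a ψ k *ᶜ twist a φ g
  twist-translate a ψ φ eigen (x , y) (u , h) = begin
    sign (a ℙ.* (x ℙ.+ u)) *ᶜ φ (y H.⊖ h)
      ≈⟨ *ᶜ-cong (≈ᶜ-trans (ℂᴿ.reflexive (cong sign (ℙ.*-distribˡ-+ a x u))) (sign-+ (a ℙ.* x) (a ℙ.* u))) (eigen y h) ⟩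
    (sign (a ℙ.* x) *ᶜ sign (a ℙ.* u)) *ᶜ (χ ψ h *ᶜ φ y)
      ≈⟨ solve 4 (λ p q r s → (p :* q) :* (r :* s) := (q :* r) :* (p :* s)) ≈ᶜ-refl (sign (a ℙ.* x)) (sign (a ℙ.* u)) (χ ψ h) (φ y) ⟩
    (sign (a ℙ.* u) *ᶜ χ ψ h) *ᶜ (sign (a ℙ.* x) *ᶜ φ y) ∎
    where
    open ≈ᶜ-Reasoning
    open ℂ-Solver

  χ-respectful : ∀ (ψ : Character H) → Respectful H (χ ψ)
  χ-respectful ψ x≈y = mk≈ (IsMonoidHomomorphism.⟦⟧-cong (Character.isMonoidHomomorphism ψ) x≈y)

  χ-0# : ∀ (ψ : Character H) → χ ψ H.0# ≈ᶜ 1ᶜ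
  χ-0# ψ = mk≈ (IsMonoidHomomorphism.ε-homo (Character.isMonoidHomomorphism ψ))

  module _ {s} (S₁ : Subset H s) (0∉S₁ : ¬ member S₁ H.0#) where
    private
      S : Subset (ℤ₂ ×ᶠ H) _
      S = connectionSet H S₁

    connectionSet-0 : ∀ y → does (member? S (0ℙ , y)) ≡ does (member? S₁ y)
    connectionSet-0 y = does-⇔ (mk⇔
      (λ { (inj₁ (() , _)) ; (inj₂ (inj₁ (_ , y∈S₁))) → y∈S₁ ; (inj₂ (inj₂ (() , _))) })
      (λ y∈S₁ → inj₂ (inj₁ (refl , y∈S₁)))) (member? S (0ℙ , y)) (member? S₁ y)

    -- As 0 is not in S₁, the set S₁ and the extra point 0 are disjoint in the layer 1, so their
    -- indicators add.
    connectionSet-1 : ∀ y z → (if does (member? S (1ℙ , y)) then z else 0ᶜ)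
      ≈ᶜ (if does (member? S₁ y) then z else 0ᶜ) +ᶜ (if does (y H.≟ H.0#) then z else 0ᶜ)
    connectionSet-1 y z = cases (member? S₁ y) (y H.≟ H.0#) refl refl
      where
      cases : ∀ (d : Dec (member S₁ y)) (d′ : Dec (y H.≈ H.0#)) → does d ≡ does (member? S₁ y) → does d′ ≡ does (y H.≟ H.0#) →
        (if does (member? S (1ℙ , y)) then z else 0ᶜ)
        ≈ᶜ (if does (member? S₁ y) then z else 0ᶜ) +ᶜ (if does (y H.≟ H.0#) then z else 0ᶜ)
      cases (yes y∈) (yes y≈0) _ _ = contradiction (Subset.respects S₁ y≈0 y∈) 0∉S₁
      cases (yes y∈) (no y≉0) p q = ≈ᶜ-trans
        (if-cong {b′ = true} (dec-true (member? S (1ℙ , y)) (inj₁ (refl , y∈))) ≈ᶜ-refl)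
        (≈ᶜ-trans (≈ᶜ-sym (ℂᴿ.+-identityʳ z)) (+ᶜ-cong (if-cong p ≈ᶜ-refl) (if-cong q ≈ᶜ-refl)))
      cases (no y∉) (yes y≈0) p q = ≈ᶜ-trans
        (if-cong {b′ = true} (dec-true (member? S (1ℙ , y)) (inj₂ (inj₂ (refl , y≈0)))) ≈ᶜ-refl)
        (≈ᶜ-trans (≈ᶜ-sym (+ᶜ-identityˡ z)) (+ᶜ-cong (if-cong p ≈ᶜ-refl) (if-cong q ≈ᶜ-refl)))
      cases (no y∉) (no y≉0) p q = ≈ᶜ-trans
        (if-cong {b′ = false} {z′ = z} (dec-false (member? S (1ℙ , y))
          (λ { (inj₁ (_ , y∈)) → y∉ y∈ ; (inj₂ (inj₁ (() , _))) ; (inj₂ (inj₂ (_ , y≈0))) → y≉0 y≈0 })) ≈ᶜ-refl)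
        (≈ᶜ-trans (≈ᶜ-sym (+ᶜ-identityˡ 0ᶜ)) (+ᶜ-cong (if-cong {false} {z = z} p ≈ᶜ-refl) (if-cong {false} {z = z} q ≈ᶜ-refl)))

    -- The layer 0 contributes the character sum over S₁. The layer 1 contributes it again with the
    -- sign of a, together with ψ(0) = 1 from the point (1 , 0).
    eigenvalue≈ : ∀ a ψ → eigenvalue H S₁ a ψ ≈ᶜ ∑[_] H S₁ (χ ψ) +ᶜ sign a *ᶜ (∑[_] H S₁ (χ ψ) +ᶜ 1ᶜ)
    eigenvalue≈ a ψ = begin
      eigenvalue H S₁ a ψ
        ≈⟨ ∑ᴳ-ℤ₂× (λ g → if does (member? S g) then productCharacter H a ψ g else 0ᶜ) ⟩
      ∑ᴳ H (λ y → if does (member? S (0ℙ , y)) then sign (a ℙ.* 0ℙ) *ᶜ χ ψ y else 0ᶜ)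
        +ᶜ ∑ᴳ H (λ y → if does (member? S (1ℙ , y)) then sign (a ℙ.* 1ℙ) *ᶜ χ ψ y else 0ᶜ)
        ≈⟨ +ᶜ-cong (sum-cong-≋ (λ i → term₀ (H.element i))) (sum-cong-≋ (λ i → term₁ (H.element i))) ⟩
      ∑[_] H S₁ (χ ψ) +ᶜ ∑ᴳ H (λ y → sign a *ᶜ ((if does (member? S₁ y) then χ ψ y else 0ᶜ) +ᶜ (if does (y H.≟ H.0#) then χ ψ y else 0ᶜ)))
        ≈⟨ +ᶜ-cong ≈ᶜ-refl (≈ᶜ-sym (*-distribˡ-sum (sign a) (λ i → δ₁ (H.element i) +ᶜ δ₂ (H.element i)))) ⟩
      ∑[_] H S₁ (χ ψ) +ᶜ sign a *ᶜ ∑ᴳ H (λ y → δ₁ y +ᶜ δ₂ y)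
        ≈⟨ +ᶜ-cong ≈ᶜ-refl (*ᶜ-cong ≈ᶜ-refl (≈ᶜ-trans (∑-distrib-+ (λ i → δ₁ (H.element i)) (λ i → δ₂ (H.element i)))
             (+ᶜ-cong ≈ᶜ-refl (≈ᶜ-trans (∑-delta H H.0# (χ ψ) (χ-respectful ψ)) (χ-0# ψ))))) ⟩
      ∑[_] H S₁ (χ ψ) +ᶜ sign a *ᶜ (∑[_] H S₁ (χ ψ) +ᶜ 1ᶜ) ∎
      where
      open ≈ᶜ-Reasoning
      δ₁ δ₂ : H.Carrier → ℂ
      δ₁ y = if does (member? S₁ y) then χ ψ y else 0ᶜ
      δ₂ y = if does (y H.≟ H.0#) then χ ψ y else 0ᶜ
      term₀ : ∀ y → (if does (member? S (0ℙ , y)) then sign (a ℙ.* 0ℙ) *ᶜ χ ψ y else 0ᶜ) ≈ᶜ δ₁ y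
      term₀ y = if-cong (connectionSet-0 y) (≈ᶜ-trans (*ᶜ-cong (ℂᴿ.reflexive (cong sign (ℙ.*-zeroʳ a))) ≈ᶜ-refl) (*ᶜ-identityˡ (χ ψ y)))
      term₁ : ∀ y → (if does (member? S (1ℙ , y)) then sign (a ℙ.* 1ℙ) *ᶜ χ ψ y else 0ᶜ) ≈ᶜ sign a *ᶜ (δ₁ y +ᶜ δ₂ y)
      term₁ y = ≈ᶜ-trans (if-*ˡ (does (member? S (1ℙ , y))) (sign (a ℙ.* 1ℙ)) (χ ψ y))
        (*ᶜ-cong (ℂᴿ.reflexive (cong sign (ℙ.*-identityʳ a))) (connectionSet-1 y (χ ψ y)))

-- Fourier coefficients and the plateau congruence

fromℤ-sum : ∀ {n} (f : Fin n → ℕ) → fromℤ (+ sumℕ f) ≈ᶜ ∑ (λ i → fromℤ (+ f i))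
fromℤ-sum {zero}  f = ≈ᶜ-trans (ℂᴿ.reflexive (fromℤ-+ℕ 0)) (subst (λ q → fromℚᶜ q ≈ᶜ 0ᶜ) (sym ι0≡0) ≈ᶜ-refl)
fromℤ-sum {suc n} f = ≈ᶜ-trans (fromℤ-+ (+ f zero) (+ sumℕ (λ i → f (suc i)))) (+ᶜ-cong ≈ᶜ-refl (fromℤ-sum (λ i → f (suc i))))

fromℤ-if : ∀ b → fromℤ (if b then + 1 else + 0) ≈ᶜ (if b then 1ᶜ else 0ᶜ)
fromℤ-if true  = ≈ᶜ-trans (ℂᴿ.reflexive (fromℤ-+ℕ 1)) (subst (λ q → fromℚᶜ q ≈ᶜ 1ᶜ) (sym ι1≡1) ≈ᶜ-refl)
fromℤ-if false = ≈ᶜ-trans (ℂᴿ.reflexive (fromℤ-+ℕ 0)) (subst (λ q → fromℚᶜ q ≈ᶜ 0ᶜ) (sym ι0≡0) ≈ᶜ-refl)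

module _ {c ℓ s} (H : FiniteAbelianGroup c ℓ) (S : Subset H s) where
  private
    module H = FiniteAbelianGroup H

  -- The Fourier transform conjugates the character and the eigenvalue does not. The indicator is
  -- real, so the two sums are conjugate; the conjugation disappears once the value is known to be
  -- an integer.
  ∑χ≈conj-fourier : ∀ (ψ : Character H) → ∑[_] H S (χ ψ) ≈ᶜ conj (fourier H (indicator H S) ψ)
  ∑χ≈conj-fourier ψ = ≈ᶜ-sym (≈ᶜ-trans
    (conj-∑ (λ i → fromℤ (indicator H S (H.element i)) *ᶜ conj (χ ψ (H.element i))))
    (sum-cong-≋ (λ i → term (does (member? S (H.element i))) (χ ψ (H.element i)))))
    where
    open ≈ᶜ-Reasoning
    term : ∀ b z → conj (fromℤ (if b then + 1 else + 0) *ᶜ conj z) ≈ᶜ (if b then z else 0ᶜ)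
    term b z = begin
      conj (fromℤ (if b then + 1 else + 0) *ᶜ conj z)             ≈⟨ conj-* _ (conj z) ⟩
      conj (fromℤ (if b then + 1 else + 0)) *ᶜ conj (conj z)      ≈⟨ *ᶜ-cong (conj-fromℝ _) (conj-involutive z) ⟩
      fromℤ (if b then + 1 else + 0) *ᶜ z                         ≈⟨ *ᶜ-cong (fromℤ-if b) ≈ᶜ-refl ⟩
      (if b then 1ᶜ else 0ᶜ) *ᶜ z                                 ≈⟨ if-1-* b z ⟩
      (if b then z else 0ᶜ)                                       ∎

  trivialCharacter : Character H
  trivialCharacter = record
    { χ = λ _ → 1ᶜ
    ; isMonoidHomomorphism = record
      { isMagmaHomomorphism = record
        { isRelHomomorphism = record { cong = λ _ → un≈ (≈ᶜ-refl {1ᶜ}) }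
        ; homo = λ _ _ → un≈ (≈ᶜ-sym (*ᶜ-identityˡ 1ᶜ)) }
      ; ε-homo = un≈ (≈ᶜ-refl {1ᶜ}) }
    }

  fourier-trivial : fourier H (indicator H S) trivialCharacter ≈ᶜ fromℤ (+ cardinality H S)
  fourier-trivial = ≈ᶜ-sym (≈ᶜ-trans (fromℤ-sum (λ i → if does (member? S (H.element i)) then 1 else 0))
    (sum-cong-≋ (λ i → term (does (member? S (H.element i))))))
    where
    term : ∀ b → fromℤ (+ (if b then 1 else 0)) ≈ᶜ fromℤ (if b then + 1 else + 0) *ᶜ conj 1ᶜ
    term true  = ≈ᶜ-sym (≈ᶜ-trans (*ᶜ-cong ≈ᶜ-refl (conj-fromℝ 1ʳ)) (ℂᴿ.*-identityʳ (fromℤ (+ 1))))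
    term false = ≈ᶜ-sym (≈ᶜ-trans (*ᶜ-cong ≈ᶜ-refl (conj-fromℝ 1ʳ)) (ℂᴿ.*-identityʳ (fromℤ (+ 0))))

  -- The trivial character turns the unknown residue into the cardinality, which is a multiple of P.
  ∑χ-divisible : ∀ {e m P} → P ∣ m → P ∣ cardinality H S → FourierConstantMod H e m (indicator H S) →
    ∀ (ψ : Character H) → ∃[ q ] (∑[_] H S (χ ψ) ≈ᶜ fromℤ (q ℤ.* + P))
  ∑χ-divisible {m = m} {P} (divides m′ m≡) (divides d′ d≡) (k , residue) ψ
    with j₀ , f₀≈ ← residue trivialCharacter | j , f≈ ← residue ψ =
      q , ≈ᶜ-trans (∑χ≈conj-fourier ψ) (≈ᶜ-trans (conj-cong (mk≈ f≈)) (≈ᶜ-trans (conj-fromℝ _) (ℂᴿ.reflexive (cong fromℤ eq))))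
    where
    open ℤ-Solver.+-*-Solver
    q : ℤ
    -- Eliminating k, the coefficient k + j m equals d + (j - j₀) m, and both d = d′ P and m = m′ P
    -- are multiples of P.
    q = + d′ ℤ.+ (j ℤ.- j₀) ℤ.* + m′
    d≡k+j₀m : + cardinality H S ≡ k ℤ.+ j₀ ℤ.* + m
    d≡k+j₀m = fromℤ-injective (≈ᶜ-trans (≈ᶜ-sym fourier-trivial) (mk≈ f₀≈))
    eq : k ℤ.+ j ℤ.* + m ≡ q ℤ.* + P
    eq = begin
      k ℤ.+ j ℤ.* + m                                        ≡⟨ solve 4 (λ k j j₀ m → k :+ j :* m := (k :+ j₀ :* m) :+ (j :- j₀) :* m) refl k j j₀ (+ m) ⟩
      (k ℤ.+ j₀ ℤ.* + m) ℤ.+ (j ℤ.- j₀) ℤ.* + m              ≡⟨ cong (ℤ._+ (j ℤ.- j₀) ℤ.* + m) d≡k+j₀m ⟨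
      + cardinality H S ℤ.+ (j ℤ.- j₀) ℤ.* + m               ≡⟨ cong₂ (λ d m → + d ℤ.+ (j ℤ.- j₀) ℤ.* + m) d≡ m≡ ⟩
      + (d′ ℕ.* P) ℤ.+ (j ℤ.- j₀) ℤ.* + (m′ ℕ.* P)           ≡⟨ cong₂ (λ x y → x ℤ.+ (j ℤ.- j₀) ℤ.* y) (ℤ.pos-* d′ P) (ℤ.pos-* m′ P) ⟩
      + d′ ℤ.* + P ℤ.+ (j ℤ.- j₀) ℤ.* (+ m′ ℤ.* + P)         ≡⟨ solve 5 (λ d j j₀ m P → d :* P :+ (j :- j₀) :* (m :* P) := (d :+ (j :- j₀) :* m) :* P) refl (+ d′) j j₀ (+ m′) (+ P) ⟩
      q ℤ.* + P                                              ∎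
      where
      open ≡.≡-Reasoning

-- The factor P of the integer cancels the denominator of π/P, which leaves q times 2πi.
exp-period : ∀ {π} → IsPi π → ∀ P .{{_ : ℕ.NonZero P}} q →
  exp (𝕚 *ᶜ fromℝ (π *ʳ fromℚ (1/ P)) *ᶜ (fromℚᶜ (ι 2) *ᶜ fromℤ (q ℤ.* + P))) ≈ᶜ 1ᶜ
exp-period {π} isPi P q = ≈ᶜ-trans (exp-cong (begin
  𝕚 *ᶜ fromℝ (π *ʳ fromℚ (1/ P)) *ᶜ (fromℚᶜ (ι 2) *ᶜ fromℤ (q ℤ.* + P))
    ≈⟨ *ᶜ-cong (𝕚*-scale π (1/ P)) (*ᶜ-cong ≈ᶜ-refl (≈ᶜ-trans (fromℤ-* q (+ P)) (*ᶜ-cong ≈ᶜ-refl (ℂᴿ.reflexive (fromℤ-+ℕ P))))) ⟩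
  (fromℚᶜ (1/ P) *ᶜ (𝕚 *ᶜ fromℝ π)) *ᶜ (fromℚᶜ (ι 2) *ᶜ (fromℤ q *ᶜ fromℚᶜ (ι P)))
    ≈⟨ solve 5 (λ u x t q P → (u :* x) :* (t :* (q :* P)) := (u :* P) :* (q :* (t :* x))) ≈ᶜ-refl
         (fromℚᶜ (1/ P)) (𝕚 *ᶜ fromℝ π) (fromℚᶜ (ι 2)) (fromℤ q) (fromℚᶜ (ι P)) ⟩
  (fromℚᶜ (1/ P) *ᶜ fromℚᶜ (ι P)) *ᶜ (fromℤ q *ᶜ (fromℚᶜ (ι 2) *ᶜ (𝕚 *ᶜ fromℝ π)))
    ≈⟨ *ᶜ-cong (≈ᶜ-trans (≈ᶜ-sym (fromℚᶜ-* (1/ P) (ι P))) (ℂᴿ.reflexive (cong fromℚᶜ (/*ι P)))) ≈ᶜ-refl ⟩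
  1ᶜ *ᶜ (fromℤ q *ᶜ (fromℚᶜ (ι 2) *ᶜ (𝕚 *ᶜ fromℝ π)))
    ≈⟨ *ᶜ-identityˡ _ ⟩
  fromℤ q *ᶜ (fromℚᶜ (ι 2) *ᶜ (𝕚 *ᶜ fromℝ π)) ∎))
  (exp-×ℤ q _ (exp-2π𝕚 isPi))
  where
  open ≈ᶜ-Reasoning
  open ℂ-Solver

module _ {c ℓ s} (H : FiniteAbelianGroup c ℓ) (S₁ : Subset H s) (0∉S₁ : ¬ member S₁ (FiniteAbelianGroup.0# H)) where

  eigenvalue-0 : ∀ ψ → eigenvalue H S₁ 0ℙ ψ ≈ᶜ fromℚᶜ (ι 2) *ᶜ ∑[_] H S₁ (χ ψ) +ᶜ 1ᶜ
  eigenvalue-0 ψ = begin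
    eigenvalue H S₁ 0ℙ ψ                 ≈⟨ eigenvalue≈ H S₁ 0∉S₁ 0ℙ ψ ⟩
    T +ᶜ 1ᶜ *ᶜ (T +ᶜ 1ᶜ)                 ≈⟨ solve 1 (λ t → t :+ con 1ℚ :* (t :+ con 1ℚ) := (t :+ (t :+ con 0ℚ)) :+ con 1ℚ) ≈ᶜ-refl T ⟩
    (T +ᶜ (T +ᶜ 0ᶜ)) +ᶜ 1ᶜ               ≈⟨ +ᶜ-cong (×ᶜ≈* 2 T) ≈ᶜ-refl ⟩
    fromℚᶜ (ι 2) *ᶜ T +ᶜ 1ᶜ              ∎
    where
    open ≈ᶜ-Reasoning
    open ℂ-Solver
    T : ℂ
    T = ∑[_] H S₁ (χ ψ)

  eigenvalue-1 : ∀ ψ → eigenvalue H S₁ 1ℙ ψ ≈ᶜ -ᶜ 1ᶜ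
  eigenvalue-1 ψ = ≈ᶜ-trans (eigenvalue≈ H S₁ 0∉S₁ 1ℙ ψ)
    (solve 1 (λ t → t :+ (:- con 1ℚ) :* (t :+ con 1ℚ) := :- con 1ℚ) ≈ᶜ-refl (∑[_] H S₁ (χ ψ)))
    where
    open ℂ-Solver

-- From the values of exp(i t λ) to the revival

module _ {c ℓ} (H : FiniteAbelianGroup c ℓ) where
  private
    module H = FiniteAbelianGroup H
    module G = FiniteAbelianGroup (ℤ₂ ×ᶠ H)

  module _ (M : Matrix G.order) (κ : Parity → ℂ) where

    -- The factor `κ a` depends on a but not on φ. This makes the property linear in φ, so that it
    -- carries over to sums of eigenfunctions of different characters.
    ActsOnTwists : (H.Carrier → ℂ) → Set
    ActsOnTwists φ = ∀ a i → (M · (λ k → twist H a φ (G.element k))) i ≈ᶜ κ a *ᶜ twist H a φ (G.element i)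

    actsOnTwists-resp : ∀ {φ ψ} → (∀ y → φ y ≈ᶜ ψ y) → ActsOnTwists φ → ActsOnTwists ψ
    actsOnTwists-resp φ≈ψ acts a i = ≈ᶜ-trans
      (sum-cong-≋ (λ k → *ᶜ-cong (≈ᶜ-refl {M i k}) (*ᶜ-cong ≈ᶜ-refl (≈ᶜ-sym (φ≈ψ _)))))
      (≈ᶜ-trans (acts a i) (*ᶜ-cong ≈ᶜ-refl (*ᶜ-cong ≈ᶜ-refl (φ≈ψ _))))

    actsOnTwists-0 : ActsOnTwists (λ _ → 0ᶜ)
    actsOnTwists-0 a i = ≈ᶜ-trans
      (sum-cong-≋ (λ k → ≈ᶜ-trans (*ᶜ-cong (≈ᶜ-refl {M i k}) (ℂᴿ.zeroʳ _)) (ℂᴿ.zeroʳ (M i k))))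
      (≈ᶜ-trans (sum-replicate-zero G.order) (≈ᶜ-sym (≈ᶜ-trans (*ᶜ-cong ≈ᶜ-refl (ℂᴿ.zeroʳ _)) (ℂᴿ.zeroʳ (κ a)))))

    actsOnTwists-+ : ∀ {φ ψ} → ActsOnTwists φ → ActsOnTwists ψ → ActsOnTwists (λ y → φ y +ᶜ ψ y)
    actsOnTwists-+ {φ} {ψ} φ-acts ψ-acts a i = begin
      ∑ (λ k → M i k *ᶜ (sgn k *ᶜ (φ (y k) +ᶜ ψ (y k))))
        ≈⟨ sum-cong-≋ (λ k → solve 4 (λ m s u v → m :* (s :* (u :+ v)) := m :* (s :* u) :+ m :* (s :* v)) ≈ᶜ-refl (M i k) (sgn k) (φ (y k)) (ψ (y k))) ⟩
      ∑ (λ k → M i k *ᶜ (sgn k *ᶜ φ (y k)) +ᶜ M i k *ᶜ (sgn k *ᶜ ψ (y k)))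
        ≈⟨ ∑-distrib-+ (λ k → M i k *ᶜ (sgn k *ᶜ φ (y k))) (λ k → M i k *ᶜ (sgn k *ᶜ ψ (y k))) ⟩
      ∑ (λ k → M i k *ᶜ (sgn k *ᶜ φ (y k))) +ᶜ ∑ (λ k → M i k *ᶜ (sgn k *ᶜ ψ (y k)))
        ≈⟨ +ᶜ-cong (φ-acts a i) (ψ-acts a i) ⟩
      κ a *ᶜ (sgn i *ᶜ φ (y i)) +ᶜ κ a *ᶜ (sgn i *ᶜ ψ (y i))
        ≈⟨ solve 4 (λ m s u v → m :* (s :* (u :+ v)) := m :* (s :* u) :+ m :* (s :* v)) ≈ᶜ-refl (κ a) (sgn i) (φ (y i)) (ψ (y i)) ⟨
      κ a *ᶜ (sgn i *ᶜ (φ (y i) +ᶜ ψ (y i))) ∎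
      where
      open ≈ᶜ-Reasoning
      open ℂ-Solver
      sgn : Fin G.order → ℂ
      sgn k = sign (a ℙ.* proj₁ (G.element k))
      y : Fin G.order → H.Carrier
      y k = proj₂ (G.element k)

  delta : H.Carrier → H.Carrier → ℂ
  delta y₁ y = basis (H.index y₁) (H.index y)

  delta-respectful : ∀ y₁ → Respectful H (delta y₁)
  delta-respectful y₁ y≈y′ = ℂᴿ.reflexive (cong (basis (H.index y₁)) (Inverse.to-cong H.enumeration y≈y′))

  -- The average ½ (1 + (-1)^(x₁ + x)) is the indicator of x = x₁ on ℤ₂, so the two twists of a
  -- point mass on H give the point mass on the product.
  basis-twist : ∀ x₁ y₁ i → basis (G.index (x₁ , y₁)) i
    ≈ᶜ fromℚᶜ ½ *ᶜ (twist H 0ℙ (delta y₁) (G.element i) +ᶜ sign x₁ *ᶜ twist H 1ℙ (delta y₁) (G.element i))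
  basis-twist x₁ y₁ i = ≈ᶜ-trans
    (if-cong (does-⇔ (mk⇔ to from) (G.index (x₁ , y₁) Fin.≟ i) ((x₁ ℙ.≟ x) ×-dec (H.index y₁ Fin.≟ H.index y))) ≈ᶜ-refl)
    (cases x₁ x (does (H.index y₁ Fin.≟ H.index y)))
    where
    open ℂ-Solver
    x : Parity
    x = proj₁ (G.element i)
    y : H.Carrier
    y = proj₂ (G.element i)
    to : G.index (x₁ , y₁) ≡ i → x₁ ≡ x × H.index y₁ ≡ H.index y
    to p with x₁≡x , y₁≈y ← index-injective (ℤ₂ ×ᶠ H) {x₁ , y₁} {x , y} (trans p (sym (index-element (ℤ₂ ×ᶠ H) i))) =
      x₁≡x , Inverse.to-cong H.enumeration y₁≈y
    from : x₁ ≡ x × H.index y₁ ≡ H.index y → G.index (x₁ , y₁) ≡ i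
    from (x₁≡x , y₁≡y) = trans (Inverse.to-cong G.enumeration (x₁≡x , index-injective H y₁≡y)) (index-element (ℤ₂ ×ᶠ H) i)
    cases : ∀ x₁ x b → (if does (x₁ ℙ.≟ x) ∧ b then 1ᶜ else 0ᶜ)
      ≈ᶜ fromℚᶜ ½ *ᶜ (sign (0ℙ ℙ.* x) *ᶜ (if b then 1ᶜ else 0ᶜ) +ᶜ sign x₁ *ᶜ (sign (1ℙ ℙ.* x) *ᶜ (if b then 1ᶜ else 0ᶜ)))
    cases 0ℙ 0ℙ b = solve 1 (λ d → d := con ½ :* (con 1ℚ :* d :+ con 1ℚ :* (con 1ℚ :* d))) ≈ᶜ-refl (if b then 1ᶜ else 0ᶜ)
    cases 0ℙ 1ℙ b = solve 1 (λ d → con 0ℚ := con ½ :* (con 1ℚ :* d :+ con 1ℚ :* ((:- con 1ℚ) :* d))) ≈ᶜ-refl (if b then 1ᶜ else 0ᶜ)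
    cases 1ℙ 0ℙ b = solve 1 (λ d → con 0ℚ := con ½ :* (con 1ℚ :* d :+ (:- con 1ℚ) :* (con 1ℚ :* d))) ≈ᶜ-refl (if b then 1ᶜ else 0ᶜ)
    cases 1ℙ 1ℙ b = solve 1 (λ d → d := con ½ :* (con 1ℚ :* d :+ (:- con 1ℚ) :* ((:- con 1ℚ) :* d))) ≈ᶜ-refl (if b then 1ᶜ else 0ᶜ)

  -- On the even twist M multiplies by α + β, on the odd one by α - β. The part with β thus changes
  -- the relative sign of the two twists, and this is the passage from the vertex (x + 1 , y) to (x
  -- , y).
  twists⇒revival : ∀ (M : Matrix G.order) α β → (∀ φ → Respectful H φ → ActsOnTwists M (λ a → α +ᶜ sign a *ᶜ β) φ) →
    ∀ x y i → (M · basis (G.index (x ℙ.+ 1ℙ , y))) i ≈ᶜ α *ᶜ basis (G.index (x ℙ.+ 1ℙ , y)) i +ᶜ β *ᶜ basis (G.index (x , y)) i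
  twists⇒revival M α β acts x y i = begin
    ∑ (λ k → M i k *ᶜ basis (G.index (x′ , y)) k)
      ≈⟨ sum-cong-≋ (λ k → ≈ᶜ-trans (*ᶜ-cong (≈ᶜ-refl {M i k}) (basis-twist x′ y k))
           (solve 4 (λ m u s v → m :* (con ½ :* (u :+ s :* v)) := con ½ :* (m :* u) :+ con ½ :* s :* (m :* v)) ≈ᶜ-refl (M i k) (t 0ℙ k) (sign x′) (t 1ℙ k))) ⟩
    ∑ (λ k → fromℚᶜ ½ *ᶜ (M i k *ᶜ t 0ℙ k) +ᶜ fromℚᶜ ½ *ᶜ sign x′ *ᶜ (M i k *ᶜ t 1ℙ k))
      ≈⟨ ∑-distrib-+ (λ k → fromℚᶜ ½ *ᶜ (M i k *ᶜ t 0ℙ k)) (λ k → fromℚᶜ ½ *ᶜ sign x′ *ᶜ (M i k *ᶜ t 1ℙ k)) ⟩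
    ∑ (λ k → fromℚᶜ ½ *ᶜ (M i k *ᶜ t 0ℙ k)) +ᶜ ∑ (λ k → fromℚᶜ ½ *ᶜ sign x′ *ᶜ (M i k *ᶜ t 1ℙ k))
      ≈⟨ +ᶜ-cong (*-distribˡ-sum (fromℚᶜ ½) (λ k → M i k *ᶜ t 0ℙ k)) (*-distribˡ-sum (fromℚᶜ ½ *ᶜ sign x′) (λ k → M i k *ᶜ t 1ℙ k)) ⟨
    fromℚᶜ ½ *ᶜ (M · t 0ℙ) i +ᶜ fromℚᶜ ½ *ᶜ sign x′ *ᶜ (M · t 1ℙ) i
      ≈⟨ +ᶜ-cong (*ᶜ-cong ≈ᶜ-refl (acts (delta y) (delta-respectful y) 0ℙ i)) (*ᶜ-cong ≈ᶜ-refl (acts (delta y) (delta-respectful y) 1ℙ i)) ⟩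
    fromℚᶜ ½ *ᶜ ((α +ᶜ 1ᶜ *ᶜ β) *ᶜ t 0ℙ i) +ᶜ fromℚᶜ ½ *ᶜ sign x′ *ᶜ ((α +ᶜ -ᶜ 1ᶜ *ᶜ β) *ᶜ t 1ℙ i)
      -- Regrouping by α and β leaves -s in the second bracket; `flip` identifies it with the sign
      -- of x.
      ≈⟨ solve 5 (λ α β s u v → con ½ :* ((α :+ con 1ℚ :* β) :* u) :+ con ½ :* s :* ((α :+ (:- con 1ℚ) :* β) :* v)
                             := α :* (con ½ :* (u :+ s :* v)) :+ β :* (con ½ :* (u :+ (:- s) :* v))) ≈ᶜ-refl α β (sign x′) (t 0ℙ i) (t 1ℙ i) ⟩
    α *ᶜ (fromℚᶜ ½ *ᶜ (t 0ℙ i +ᶜ sign x′ *ᶜ t 1ℙ i)) +ᶜ β *ᶜ (fromℚᶜ ½ *ᶜ (t 0ℙ i +ᶜ -ᶜ sign x′ *ᶜ t 1ℙ i))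
      ≈⟨ +ᶜ-cong ≈ᶜ-refl (*ᶜ-cong ≈ᶜ-refl (*ᶜ-cong ≈ᶜ-refl (+ᶜ-cong ≈ᶜ-refl (*ᶜ-cong flip ≈ᶜ-refl)))) ⟩
    α *ᶜ (fromℚᶜ ½ *ᶜ (t 0ℙ i +ᶜ sign x′ *ᶜ t 1ℙ i)) +ᶜ β *ᶜ (fromℚᶜ ½ *ᶜ (t 0ℙ i +ᶜ sign x *ᶜ t 1ℙ i))
      ≈⟨ +ᶜ-cong (*ᶜ-cong ≈ᶜ-refl (basis-twist x′ y i)) (*ᶜ-cong ≈ᶜ-refl (basis-twist x y i)) ⟨
    α *ᶜ basis (G.index (x′ , y)) i +ᶜ β *ᶜ basis (G.index (x , y)) i ∎
    where
    open ≈ᶜ-Reasoning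
    open ℂ-Solver
    x′ : Parity
    x′ = x ℙ.+ 1ℙ
    t : Parity → Fin G.order → ℂ
    t a k = twist H a (delta y) (G.element k)
    flip : -ᶜ sign x′ ≈ᶜ sign x
    flip = begin
      -ᶜ sign (x ℙ.+ 1ℙ)           ≈⟨ -ᶜ-cong (sign-+ x 1ℙ) ⟩
      -ᶜ (sign x *ᶜ -ᶜ 1ᶜ)         ≈⟨ solve 1 (λ s → :- (s :* (:- con 1ℚ)) := s) ≈ᶜ-refl (sign x) ⟩
      sign x                       ∎

module _ {c ℓ s} (H : FiniteAbelianGroup c ℓ) (S₁ : Subset H s) {N} .{{_ : ℕ.NonZero N}} (ζ : PrimitiveRoot N)
         (annihilates : ∀ x → FiniteAbelianGroup._≈_ H (FiniteAbelianGroup._×ᴳ_ H N x) (FiniteAbelianGroup.0# H)) where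
  private
    module H = FiniteAbelianGroup H
    module G = FiniteAbelianGroup (ℤ₂ ×ᶠ H)
    A : Matrix G.order
    A = adjacency (ℤ₂ ×ᶠ H) (connectionSet H S₁)

  twist-eigen : ∀ a (ψ : Character H) φ → Respectful H φ → (∀ y h → φ (y H.⊖ h) ≈ᶜ χ ψ h *ᶜ φ y) → ∀ i →
    (A · (λ k → twist H a φ (G.element k))) i ≈ᶜ eigenvalue H S₁ a ψ *ᶜ twist H a φ (G.element i)
  twist-eigen a ψ φ φ-resp eigen = adjacency-eigen (ℤ₂ ×ᶠ H) (connectionSet H S₁) (twist-respectful H a φ-resp)
    (productCharacter H a ψ) (twist-translate H a ψ φ eigen)

  -- On the twist of an eigenfunction for ψ the exponential acts by exp(z λ). The hypothesis makes
  -- this number independent of ψ, which is what the induction over characters requires.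
  expᴹ-acts : ∀ z (κ : Parity → ℂ) → (∀ a (ψ : Character H) → exp (z *ᶜ eigenvalue H S₁ a ψ) ≈ᶜ κ a) →
    ∀ φ → Respectful H φ → ActsOnTwists H (expᴹ (z • A)) κ φ
  expᴹ-acts z κ exp-eigenvalue = character-induction H ζ annihilates (ActsOnTwists H (expᴹ (z • A)) κ)
    (λ {φ} {ψ} → actsOnTwists-resp H (expᴹ (z • A)) κ {φ} {ψ})
    (actsOnTwists-0 H (expᴹ (z • A)) κ)
    (λ {φ} {ψ} → actsOnTwists-+ H (expᴹ (z • A)) κ {φ} {ψ})
    λ ψ φ φ-resp eigen a i → ≈ᶜ-trans
      (expᴹ-eigen (z • A) (λ k → twist H a φ (G.element k)) (z *ᶜ eigenvalue H S₁ a ψ)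
        (•-eigen A (λ k → twist H a φ (G.element k)) z (eigenvalue H S₁ a ψ) (twist-eigen a ψ φ φ-resp eigen)) i)
      (*ᶜ-cong (exp-eigenvalue a ψ) ≈ᶜ-refl)

module _ {c ℓ s} (H : FiniteAbelianGroup c ℓ) (S₁ : Subset H s) (0∉S₁ : ¬ member S₁ (FiniteAbelianGroup.0# H))
         {π} (isPi : IsPi π) (P : ℕ) .{{_ : ℕ.NonZero P}} (1<P : 1 ℕ.< P)
         (∑χ : ∀ (ψ : Character H) → ∃[ q ] (∑[_] H S₁ (χ ψ) ≈ᶜ fromℤ (q ℤ.* + P))) where
  private
    module G = FiniteAbelianGroup (ℤ₂ ×ᶠ H)
    t : ℝ
    t = π *ʳ fromℚ (1/ P)
    it α β : ℂ
    it = 𝕚 *ᶜ fromℝ t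
    α = fromℝ (cos t)
    β = 𝕚 *ᶜ fromℝ (sin t)
    κ : Parity → ℂ
    κ a = α +ᶜ sign a *ᶜ β

  exp-eigenvalue-0 : ∀ ψ → exp (it *ᶜ eigenvalue H S₁ 0ℙ ψ) ≈ᶜ exp it
  exp-eigenvalue-0 ψ = begin
    exp (it *ᶜ eigenvalue H S₁ 0ℙ ψ)
      ≈⟨ exp-cong (*ᶜ-cong ≈ᶜ-refl (≈ᶜ-trans (eigenvalue-0 H S₁ 0∉S₁ ψ) (+ᶜ-cong (*ᶜ-cong ≈ᶜ-refl (proj₂ (∑χ ψ))) ≈ᶜ-refl))) ⟩
    exp (it *ᶜ (fromℚᶜ (ι 2) *ᶜ fromℤ (proj₁ (∑χ ψ) ℤ.* + P) +ᶜ 1ᶜ))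
      ≈⟨ exp-cong (≈ᶜ-trans (ℂᴿ.distribˡ it _ 1ᶜ) (+ᶜ-cong ≈ᶜ-refl (ℂᴿ.*-identityʳ it))) ⟩
    exp (it *ᶜ (fromℚᶜ (ι 2) *ᶜ fromℤ (proj₁ (∑χ ψ) ℤ.* + P)) +ᶜ it)
      ≈⟨ exp-+ _ it ⟩
    exp (it *ᶜ (fromℚᶜ (ι 2) *ᶜ fromℤ (proj₁ (∑χ ψ) ℤ.* + P))) *ᶜ exp it
      ≈⟨ *ᶜ-cong (exp-period isPi P (proj₁ (∑χ ψ))) ≈ᶜ-refl ⟩
    1ᶜ *ᶜ exp it
      ≈⟨ *ᶜ-identityˡ (exp it) ⟩
    exp it ∎
    where
    open ≈ᶜ-Reasoning

  exp-eigenvalue-1 : ∀ ψ → exp (it *ᶜ eigenvalue H S₁ 1ℙ ψ) ≈ᶜ exp (-ᶜ it)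
  exp-eigenvalue-1 ψ = exp-cong (≈ᶜ-trans (*ᶜ-cong ≈ᶜ-refl (eigenvalue-1 H S₁ 0∉S₁ ψ))
    (solve 1 (λ z → z :* (:- con 1ℚ) := :- z) ≈ᶜ-refl it))
    where
    open ℂ-Solver

  exp-eigenvalue : ∀ a ψ → exp (it *ᶜ eigenvalue H S₁ a ψ) ≈ᶜ κ a
  exp-eigenvalue 0ℙ ψ = ≈ᶜ-trans (exp-eigenvalue-0 ψ) (≈ᶜ-trans (cis≈ t) (+ᶜ-cong ≈ᶜ-refl (≈ᶜ-sym (*ᶜ-identityˡ β))))
  exp-eigenvalue 1ℙ ψ = ≈ᶜ-trans (exp-eigenvalue-1 ψ) (≈ᶜ-trans (exp-neg-𝕚 t) (≈ᶜ-trans (conj-cis t)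
    (+ᶜ-cong ≈ᶜ-refl (solve 1 (λ b → :- b := (:- con 1ℚ) :* b) ≈ᶜ-refl β))))
    where
    open ℂ-Solver

  -- With P > 1 the time π/P lies strictly between 0 and π. This is the source of β ≠ 0.
  0<sin-t : 0ʳ < sin t
  0<sin-t = IsPi.least isPi t
    (0<scale {π} (1/ P) {{1/-positive P}} (IsPi.positive isPi))
    (scale<1 {π} (1/ P) (subst (λ q → ℚ.Positive (1ℚ ℚ.- q)) (trans (cong (ℚ._* 1/ P) ι1≡1) (ℚ.*-identityˡ (1/ P))) (1-j/N-positive 1 P 1<P)) (IsPi.positive isPi))

  revival : ∀ {N} .{{_ : ℕ.NonZero N}} → (∀ x → FiniteAbelianGroup._≈_ H (FiniteAbelianGroup._×ᴳ_ H N x) (FiniteAbelianGroup.0# H)) →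
    ∀ x y → FractionalRevival (ℤ₂ ×ᶠ H) (connectionSet H S₁) t (x + 1ℙ , y) (x , y) α β
  revival {N} annihilates x y = record
    { evolution  = λ i → un≈ (twists⇒revival H (expᴹ (it • adjacency (ℤ₂ ×ᶠ H) (connectionSet H S₁))) α β
                     (expᴹ-acts H S₁ (primitiveRoot isPi N) annihilates it κ exp-eigenvalue) x y i)
    ; nonzero    = 𝕚*≄0 0<sin-t
    ; normalised = cos²+sin²≃1 t
    }

^-∣ : ∀ p {m n} → m ≤ n → p ℕ.^ m ∣ p ℕ.^ n
^-∣ p {m} {n} m≤n = divides (p ℕ.^ (n ∸ m)) (trans (cong (p ℕ.^_) (sym (ℕ.m∸n+n≡m m≤n))) (ℕ.^-distribˡ-+-* p (n ∸ m) m))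

theorem3p6 : ∀ {c ℓ s} (H : FiniteAbelianGroup c ℓ) (e : ℕ) → IsExponent H e →
    (S₁ : Subset H s) → ¬ member S₁ (FiniteAbelianGroup.0# H) →
    (∀ n → n ∈ℤ* e → dilate H n S₁ ≐ member S₁) →
    (p : ℕ) (p-prime : Prime p) → p ∣ cardinality H S₁ →
    (r : ℕ) → 1 ≤ r → IsPlateaued H e p r (indicator H S₁) →
    (v : ℕ) → IsValuation p (cardinality H S₁) v →
    (π : ℝ) → IsPi π →
    let r₀ = r ⊓ v
        t  = angle π p-prime r₀
        it = 𝕚 *ᶜ fromℝ t
    in 1 ≤ r₀
       × (∀ x y → FractionalRevival (ℤ₂ ×ᶠ H) (connectionSet H S₁) t (x + 1ℙ , y) (x , y)
                    (fromℝ (cos t)) (𝕚 *ᶜ fromℝ (sin t)))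
       × (∀ ψ → exp (it *ᶜ eigenvalue H S₁ 0ℙ ψ) ≃ᶜ exp it)
       × (∀ ψ → exp (it *ᶜ eigenvalue H S₁ 1ℙ ψ) ≃ᶜ exp (-ᶜ it))
theorem3p6 H e isExponent S₁ 0∉S₁ _ p p-prime p∣d r 1≤r isPlateaued v (p^v∣d , p^1+v∤d) π isPi =
    1≤r₀
  , revival H S₁ 0∉S₁ isPi P 1<P ∑χ {e} {{ℕ.>-nonZero (IsExponent.positive isExponent)}} (IsExponent.annihilates isExponent)
  , (λ ψ → un≈ (exp-eigenvalue-0 H S₁ 0∉S₁ isPi P 1<P ∑χ ψ))
  , (λ ψ → un≈ (exp-eigenvalue-1 H S₁ 0∉S₁ isPi P 1<P ∑χ ψ))
  where
  P : ℕ
  P = p ℕ.^ (r ⊓ v)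
  instance
    P≢0 : ℕ.NonZero P
    P≢0 = ℕ.m^n≢0 p (r ⊓ v) {{prime⇒nonZero p-prime}}

  1≤v : ∀ w → ¬ (p ℕ.^ suc w ∣ cardinality H S₁) → 1 ≤ w
  -- For v = 0 the maximality of v would say that p¹, which unfolds to p · 1, does not divide d.
  1≤v zero    p∤d = contradiction (subst (_∣ cardinality H S₁) (sym (ℕ.*-identityʳ p)) p∣d) p∤d
  1≤v (suc w) _   = ℕ.s≤s ℕ.z≤n

  1≤r₀ : 1 ≤ r ⊓ v
  1≤r₀ = ℕ.⊓-glb 1≤r (1≤v v p^1+v∤d)

  1<P : 1 ℕ.< P
  1<P = ℕ.<-≤-trans (ℕ.nonTrivial⇒n>1 p {{prime⇒nonTrivial p-prime}})
    (subst (ℕ._≤ P) (ℕ.*-identityʳ p) (ℕ.^-monoʳ-≤ p {{prime⇒nonZero p-prime}} 1≤r₀))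

  ∑χ : ∀ (ψ : Character H) → ∃[ q ] (∑[_] H S₁ (χ ψ) ≈ᶜ fromℤ (q ℤ.* + P))
  -- As r₀ is the minimum, P divides both the modulus p^r of the congruence and, through p^v, the
  -- cardinality d.
  ∑χ = ∑χ-divisible H S₁ {e} (^-∣ p (ℕ.m⊓n≤m r v)) (∣-trans (^-∣ p (ℕ.m⊓n≤n r v)) p^v∣d) (IsPlateaued.congruence isPlateaued)
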